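{- Let $\mathbb F_q$ range over finite fields with $q$ elements whose characteristic is not $2$, and for $E\subset \mathbb F_q^d$ and an integer $k\ge 2$ let $\Delta_k(E)=\{\|\mathbf x_1+\cdots+\mathbf x_k\|: \mathbf x_1,\dots,\mathbf x_k\in E\}\subset \mathbb F_q$. (1) If $d=4$ or $d=6$, there exist a constant $C>1$ and a constant $0<c\le 1$, both independent of $q$, such that for every such $q$ and every $E\subset \mathbb F_q^d$ with $|E|\ge C q^{\frac{d+1}{2}-\frac{1}{6d+2}}$ we have $|\Delta_3(E)|\ge c q$. (2) If $d\ge 8$ is even, there exist a constant $C>1$ and a constant $0<c\le 1$, both independent of $q$, such that for every such $q$ and every $E\subset \mathbb F_q^d$ with $|E|\ge C q^{\frac{d+1}{2}-\frac{1}{6d+2}}$ we have $|\Delta_4(E)|\ge c q$.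
   Context: For $\mathbf v=(v_1,\dots,v_d)\in\mathbb F_q^d$, $\|\mathbf v\|=v_1^2+\cdots+v_d^2\in\mathbb F_q$ (not a norm, just this quadratic form). -}

module Defs where

open import Level using (0ℓ)
open import Algebra.Bundles using (CommutativeRing)
open import Data.Nat using (ℕ; zero; suc)
open import Data.Fin using (Fin)
open import Data.Vec using (Vec; []; _∷_; zipWith; replicate; foldr)
open import Data.List using (List; []; _∷_; map; concatMap; length; deduplicate)
open import Data.Product using (∃)
open import Function.Bundles using (_↔_)
open import Relation.Nullary using (¬_)
open import Relation.Binary.PropositionalEquality using (_≡_)
open import Relation.Binary.Definitions using (DecidableEquality)

record FiniteField (q : ℕ) : Set₁ where
  field
    commRing : CommutativeRing 0ℓ 0ℓ
  open CommutativeRing commRing public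
  field
    ≈⇒≡        : ∀ {x y} → x ≈ y → x ≡ y
    _≟_        : DecidableEquality Carrier
    0≢1        : ¬ (0# ≈ 1#)
    inverse    : ∀ x → ¬ (x ≈ 0#) → ∃ λ y → x * y ≈ 1#
    enumeration : Fin q ↔ Carrier

CharNot2 : ∀ {q} → FiniteField q → Set
CharNot2 F = ¬ (1# + 1# ≈ 0#) where open FiniteField F

module _ {q : ℕ} (F : FiniteField q) where
  open FiniteField F

  _+ᵥ_ : ∀ {d} → Vec Carrier d → Vec Carrier d → Vec Carrier d
  _+ᵥ_ = zipWith _+_

  ‖_‖ : ∀ {d} → Vec Carrier d → Carrier
  ‖ v ‖ = foldr _ (λ x acc → x * x + acc) 0# v

  kSums : ∀ {d} → ℕ → List (Vec Carrier d) → List (Vec Carrier d)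
  kSums zero    E = replicate _ 0# ∷ []
  kSums (suc k) E = concatMap (λ x → map (x +ᵥ_) (kSums k E)) E

  ∣Δ∣ : ∀ {d} → ℕ → List (Vec Carrier d) → ℕ
  ∣Δ∣ k E = length (deduplicate _≟_ (map ‖_‖ (kSums k E)))

{-# OPTIONS --safe #-}
-- Let N = |E|, d = 2n and q^{n+1/2-δ} ≲ N with δ = 1/(6d+2).  Everything is a double count of
-- collisions, the only input from geometry being that an affine hyperplane has q^{d-1} points.
--
-- Fix s and count (x₁, x₂, y, y′) in E⁴ with ‖s+x₁+x₂+y‖ = ‖s+x₁+x₂+y′‖.  With z = y′ - y this is a
-- linear condition on x₁ + x₂ with normal z, which holds for at most S(z) pairs (x₁, x₂), where S(z)
-- counts the pairs of E on a common hyperplane normal to z.  The excess of S(z) over N²/q is small on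
-- average over z and constant on lines through 0, so only those z can contribute too much whose line
-- is "rich": some translate of it contains more than N²/2q^d points of E.
--
-- If the rich directions lie in a subspace W of dimension at most n, the z in W are harmless: for
-- u = s+x₁+x₂+y the function w ↦ ‖u+w‖ - ‖u‖ on W is a polynomial of degree two, so it has O(q^{n-1})
-- zeros unless it vanishes identically, which happens for at most q^n points u.  Cauchy-Schwarz then
-- gives at least q/12 values.
--
-- Otherwise there are n + 1 independent rich directions.  If there are at most q/2 values, then a
-- second count gives |E+E| ≤ q^{d+1}/N, so by Petridis' form of Plünnecke's inequality the sum of
-- n + 1 pieces of E on lines in these directions has at most (q^{d+1}/N²)^{n+1} N elements, whereas
-- by independence it has more than (N²/2q^d)^{n+1}.  For N as above these bounds are incompatible.
module Submission where

open import Level using (0ℓ)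
open import Algebra.Bundles using (CommutativeRing)
open import Algebra.Bundles.Raw using (RawRing)
open import Data.Nat using (ℕ; zero; suc)
open import Data.Integer as ℤ using (ℤ; -[1+_]; _⊖_) renaming (+_ to pos)
import Data.Nat as ℕ
import Data.Nat.Properties as ℕ
import Data.Integer.Properties as ℤ
import Algebra.Solver.Ring
open import Algebra.Solver.Ring.AlmostCommutativeRing using (_-Raw-AlmostCommutative⟶_; fromCommutativeRing)
import Algebra.Properties.Semiring.Mult.TCOptimised
import Algebra.Properties.Ring
import Algebra.Properties.AbelianGroup
import Relation.Binary.PropositionalEquality as ≡
open import Relation.Binary.Consequences using (dec⇒weaklyDec)
import Data.Maybe as Maybe
import Relation.Binary.Reasoning.Setoid

-- If each difference z = y′ - y is counted with the trivial multiplicity N, the total excess is at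
-- most N² q^(d+1), which stays below the main term N⁴ only for N ≥ q^((d+1)/2). Going below that
-- exponent rests on homogeneity: the excess agrees on all nonzero multiples of z, so the
-- multiplicity may be averaged over a punctured line. The average is too big only if E nearly fills
-- some translate of the line: a rich line has more than about q^(1-2δ) of its q points. The
-- dimension n is forced from both sides. On a W of dimension m a typical u has up to O(q^(m-1))
-- zeros, and q times this must not exceed N ≈ q^(n+1/2-δ), so m ≤ n; the q^n points u on which the
-- polynomial vanishes identically must also be few against N. Conversely, n rich lines would give
-- about q^n sums, fewer than N and no contradiction. With n + 1 lines the comparison is
-- q^((n+1)(1-2δ)) against q^(2δ(n+1)) N, and the exponents clash as soon as δ < 1/(4d+6).

-- A ring solver with integer coefficients

module IntegerCoefficients (R : CommutativeRing 0ℓ 0ℓ) where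
  open CommutativeRing R
  open Algebra.Properties.Semiring.Mult.TCOptimised semiring
  open Algebra.Properties.Ring ring using (-‿distribˡ-*; -‿distribʳ-*; -0#≈0#; -‿involutive)
  open Algebra.Properties.AbelianGroup +-abelianGroup using (⁻¹-∙-comm)
  open Relation.Binary.Reasoning.Setoid setoid

  -- With the optimised multiple `_×_`, `embed` sends 0 and 1 definitionally to `0#` and `1#`, so
  -- the solver constants `:0` and `:1` match the goals as written.
  embed : ℤ → Carrier
  embed (pos n)     = n × 1#
  embed -[1+ n ]  = - (suc n × 1#)

  private
    embed-⊖ : ∀ m n → embed (m ⊖ n) ≈ m × 1# - n × 1#
    embed-⊖ m zero = sym (trans (+-congˡ -0#≈0#) (+-identityʳ _))
    embed-⊖ zero (suc n) = sym (+-identityˡ _)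
    embed-⊖ (suc m) (suc n) = begin
      embed (suc m ⊖ suc n)                ≡⟨ ≡.cong embed (ℤ.[1+m]⊖[1+n]≡m⊖n m n) ⟩
      embed (m ⊖ n)                        ≈⟨ embed-⊖ m n ⟩
      m × 1# - n × 1#                      ≈⟨ +-congʳ (+-identityʳ _) ⟨
      m × 1# + 0# - n × 1#                 ≈⟨ +-congʳ (+-congˡ (-‿inverseʳ 1#)) ⟨
      m × 1# + (1# - 1#) - n × 1#          ≈⟨ +-congʳ (trans (sym (+-assoc _ _ _)) (+-congʳ (+-comm _ _))) ⟩
      1# + m × 1# - 1# - n × 1#            ≈⟨ +-assoc _ _ _ ⟩
      1# + m × 1# + (- 1# - n × 1#)        ≈⟨ +-cong (1+× m 1#) (trans (-‿cong (1+× n 1#)) (sym (⁻¹-∙-comm 1# _))) ⟨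
      suc m × 1# - suc n × 1#              ∎

    embed-+ : ∀ i j → embed (i ℤ.+ j) ≈ embed i + embed j
    embed-+ (pos m)    (pos n)    = ×-homo-+ 1# m n
    embed-+ (pos m)    -[1+ n ] = embed-⊖ m (suc n)
    embed-+ -[1+ m ] (pos n)    = trans (embed-⊖ n (suc m)) (+-comm _ _)
    embed-+ -[1+ m ] -[1+ n ] = begin
      - (suc (suc (m ℕ.+ n)) × 1#)       ≡⟨ ≡.cong (λ k → - (suc k × 1#)) (ℕ.+-suc m n) ⟨
      - ((suc m ℕ.+ suc n) × 1#)         ≈⟨ -‿cong (×-homo-+ 1# (suc m) (suc n)) ⟩
      - (suc m × 1# + suc n × 1#)        ≈⟨ ⁻¹-∙-comm _ _ ⟨
      - (suc m × 1#) - suc n × 1#        ∎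

    embed-neg : ∀ i → embed (ℤ.- i) ≈ - embed i
    embed-neg (pos zero)  = sym -0#≈0#
    embed-neg (pos (suc n)) = refl
    embed-neg -[1+ n ]  = sym (-‿involutive _)

    embed-+* : ∀ m j → embed (pos m ℤ.* j) ≈ m × 1# * embed j
    embed-+* m (pos n) = trans (reflexive (≡.cong embed (≡.sym (ℤ.pos-* m n)))) (×1-homo-* m n)
    embed-+* m -[1+ n ] = begin
      embed (pos m ℤ.* -[1+ n ])          ≡⟨ ≡.cong embed (ℤ.neg-distribʳ-* (pos m) (pos (suc n))) ⟨
      embed (ℤ.- (pos m ℤ.* pos (suc n)))     ≈⟨ embed-neg (pos m ℤ.* pos (suc n)) ⟩
      - embed (pos m ℤ.* pos (suc n))         ≈⟨ -‿cong (embed-+* m (pos (suc n))) ⟩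
      - (m × 1# * suc n × 1#)           ≈⟨ -‿distribʳ-* _ _ ⟩
      m × 1# * - (suc n × 1#)           ∎

    embed-* : ∀ i j → embed (i ℤ.* j) ≈ embed i * embed j
    embed-* (pos m)    j = embed-+* m j
    embed-* -[1+ m ] j = begin
      embed (-[1+ m ] ℤ.* j)          ≡⟨ ≡.cong embed (ℤ.neg-distribˡ-* (pos (suc m)) j) ⟨
      embed (ℤ.- (pos (suc m) ℤ.* j))     ≈⟨ embed-neg (pos (suc m) ℤ.* j) ⟩
      - embed (pos (suc m) ℤ.* j)         ≈⟨ -‿cong (embed-+* (suc m) j) ⟩
      - (suc m × 1# * embed j)        ≈⟨ -‿distribˡ-* _ _ ⟩
      - (suc m × 1#) * embed j        ∎

  private
    integers : RawRing 0ℓ 0ℓ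
    integers = ℤ.+-*-rawRing

    morphism : integers -Raw-AlmostCommutative⟶ fromCommutativeRing R
    morphism = record
      { ⟦_⟧    = embed
      ; +-homo = embed-+
      ; *-homo = embed-*
      ; -‿homo = embed-neg
      ; 0-homo = refl
      ; 1-homo = refl
      }

  -- Integer coefficients have an equality test that computes, so terms that cancel disappear from
  -- normal forms over an abstract field.
  module Solver = Algebra.Solver.Ring integers (fromCommutativeRing R) morphism
    (λ i j → Maybe.map (λ p → reflexive (≡.cong embed p)) (dec⇒weaklyDec ℤ._≟_ i j))


  :0 :1 : ∀ {n} → Solver.Polynomial n
  :0 = Solver.con (pos 0)
  :1 = Solver.con (pos 1)

open import Defs
open import Data.Bool using (Bool; true; false; _∧_; _∨_)
open import Data.Bool.ListAction using (any; all)
open import Data.Bool.Properties using (∨-zeroʳ; ∨-identityʳ)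
open import Data.Empty using (⊥-elim)
open import Data.List using (List; []; _∷_; _++_; map; length; cartesianProductWith; filter; deduplicate; allFin)
open import Data.List.Membership.Propositional using (_∈_; lose; find)
open import Data.List.Membership.Propositional.Properties
  using (∈-map⁺; ∈-map⁻; ∈-filter⁺; ∈-filter⁻; ∈-concatMap⁺; ∈-deduplicate⁺; ∈-allFin; ∈-cartesianProductWith⁺; ∈-cartesianProductWith⁻)
open import Data.List.Properties using (length-map; length-tabulate)
open import Data.List.Relation.Unary.All using (All; []; _∷_)
open import Data.List.Relation.Unary.AllPairs using ([]; _∷_)
open import Data.List.Relation.Unary.Any as Any using (Any; here; there)
open import Data.List.Relation.Unary.Unique.Propositional using (Unique)
open import Data.Nat using (_+_; _*_; _∸_; _^_; _≤_; _<_; _≤?_; _<?_; z≤n; s≤s; NonZero; >-nonZero)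
open import Data.Nat.Induction using (<-wellFounded)
open import Data.Nat.Properties hiding (_≟_; _≤?_; _<?_)
open import Data.Nat.Tactic.RingSolver using (solve-∀)
open import Data.Product using (_×_; _,_; proj₁; proj₂; Σ; ∃; ∃₂)
open import Data.Sum using (_⊎_; inj₁; inj₂)
open import Data.Vec using (Vec; []; _∷_; zipWith; replicate)
open import Data.Vec.Relation.Binary.Pointwise.Inductive using (Pointwise; []; _∷_)
open import Function using (_∘_)
open import Function.Bundles using (Inverse)
open import Induction.WellFounded using (Acc; acc)
open import Relation.Binary.Definitions using (DecidableEquality)
open import Relation.Binary.PropositionalEquality using (_≡_; _≢_; refl; sym; trans; cong; cong₂; subst; module ≡-Reasoning)
open import Relation.Nullary using (Dec; yes; no; ¬_; does; contradiction)
open import Relation.Nullary.Decidable using (¬?; _×-dec_; decidable-stable)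
import Data.Bool
import Data.List.Membership.DecPropositional as DecMembership
import Data.List.Relation.Unary.Unique.DecPropositional.Properties as UniqueDec
import Data.List.Relation.Unary.Unique.Propositional.Properties as Unique
import Data.Vec as Vec
import Data.Vec.Properties as Vec

-- Sums over lists and collision counts

private variable
  A B C Φ Ψ : Set

∑ : List A → (A → ℕ) → ℕ
∑ []       f = 0
∑ (x ∷ xs) f = f x + ∑ xs f

infixr 10 ∑
syntax ∑ L (λ x → e) = ∑[ x ∈ L ] e

⟦_⟧ : Dec Φ → ℕ
⟦ yes _ ⟧ = 1
⟦ no _ ⟧  = 0

⟦⟧≤1 : (Φ? : Dec Φ) → ⟦ Φ? ⟧ ≤ 1
⟦⟧≤1 (yes _) = ≤-refl
⟦⟧≤1 (no _)  = z≤n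

⟦⟧-yes : (Φ? : Dec Φ) → Φ → ⟦ Φ? ⟧ ≡ 1
⟦⟧-yes (yes _) p = refl
⟦⟧-yes (no ¬p) p = ⊥-elim (¬p p)

⟦⟧-no : (Φ? : Dec Φ) → ¬ Φ → ⟦ Φ? ⟧ ≡ 0
⟦⟧-no (yes p) ¬p = ⊥-elim (¬p p)
⟦⟧-no (no _)  ¬p = refl

⟦⟧-mono : (Φ? : Dec Φ) (Ψ? : Dec Ψ) → (Φ → Ψ) → ⟦ Φ? ⟧ ≤ ⟦ Ψ? ⟧
⟦⟧-mono (yes p) Ψ? f = ≤-reflexive (sym (⟦⟧-yes Ψ? (f p)))
⟦⟧-mono (no _)  Ψ? f = z≤n

⟦⟧-cong : (Φ? : Dec Φ) (Ψ? : Dec Ψ) → (Φ → Ψ) → (Ψ → Φ) → ⟦ Φ? ⟧ ≡ ⟦ Ψ? ⟧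
⟦⟧-cong Φ? Ψ? f g = ≤-antisym (⟦⟧-mono Φ? Ψ? f) (⟦⟧-mono Ψ? Φ? g)

⟦⟧*-≤ : (Φ? : Dec Φ) {m n : ℕ} → (Φ → m ≤ n) → ⟦ Φ? ⟧ * m ≤ n
⟦⟧*-≤ (yes p) {m} h = ≤-trans (≤-reflexive (+-identityʳ m)) (h p)
⟦⟧*-≤ (no _)      h = z≤n

⟦⟧*-mono : (Φ? : Dec Φ) {m n : ℕ} → (Φ → m ≤ n) → ⟦ Φ? ⟧ * m ≤ ⟦ Φ? ⟧ * n
⟦⟧*-mono (yes p) h = *-monoʳ-≤ 1 (h p)
⟦⟧*-mono (no _)  h = z≤n

⟦⟧*-cong : (Φ? : Dec Φ) {m n : ℕ} → (Φ → m ≡ n) → ⟦ Φ? ⟧ * m ≡ ⟦ Φ? ⟧ * n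
⟦⟧*-cong (yes p) h = cong (_+ 0) (h p)
⟦⟧*-cong (no _)  h = refl

∑-cong : (L : List A) {f g : A → ℕ} → (∀ x → f x ≡ g x) → ∑ L f ≡ ∑ L g
∑-cong []      h = refl
∑-cong (x ∷ L) h = cong₂ _+_ (h x) (∑-cong L h)

∑-mono-∈ : (L : List A) {f g : A → ℕ} → (∀ x → x ∈ L → f x ≤ g x) → ∑ L f ≤ ∑ L g
∑-mono-∈ []      h = z≤n
∑-mono-∈ (x ∷ L) h = +-mono-≤ (h x (here refl)) (∑-mono-∈ L (λ y → h y ∘ there))

∑-mono : (L : List A) {f g : A → ℕ} → (∀ x → f x ≤ g x) → ∑ L f ≤ ∑ L g
∑-mono L h = ∑-mono-∈ L (λ x _ → h x)

∑-const : (L : List A) (c : ℕ) → ∑ L (λ _ → c) ≡ length L * c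
∑-const []      c = refl
∑-const (x ∷ L) c = cong (c +_) (∑-const L c)

∑-zero : (L : List A) → ∑ L (λ _ → 0) ≡ 0
∑-zero L = trans (∑-const L 0) (*-zeroʳ (length L))

∑-bound : (L : List A) {f : A → ℕ} (c : ℕ) → (∀ x → x ∈ L → f x ≤ c) → ∑ L f ≤ length L * c
∑-bound L c h = ≤-trans (∑-mono-∈ L h) (≤-reflexive (∑-const L c))

∑-one : (L : List A) → ∑ L (λ _ → 1) ≡ length L
∑-one L = trans (∑-const L 1) (*-identityʳ _)

∑-+ : (L : List A) (f g : A → ℕ) → ∑ L (λ x → f x + g x) ≡ ∑ L f + ∑ L g
∑-+ []      f g = refl
∑-+ (x ∷ L) f g rewrite ∑-+ L f g = assoc₄ (f x) (g x) (∑ L f) (∑ L g)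
  where
  assoc₄ : ∀ a b c d → a + b + (c + d) ≡ a + c + (b + d)
  assoc₄ = solve-∀

∑-*ˡ : (L : List A) (c : ℕ) (f : A → ℕ) → ∑ L (λ x → c * f x) ≡ c * ∑ L f
∑-*ˡ []      c f = sym (*-zeroʳ c)
∑-*ˡ (x ∷ L) c f rewrite ∑-*ˡ L c f = sym (*-distribˡ-+ c (f x) (∑ L f))

∑-*ʳ : (L : List A) (c : ℕ) (f : A → ℕ) → ∑ L (λ x → f x * c) ≡ ∑ L f * c
∑-*ʳ L c f = trans (∑-cong L (λ x → *-comm (f x) c)) (trans (∑-*ˡ L c f) (*-comm c _))

∑-swap : (K : List A) (L : List B) (f : A → B → ℕ) →
  (∑[ x ∈ K ] ∑[ y ∈ L ] f x y) ≡ (∑[ y ∈ L ] ∑[ x ∈ K ] f x y)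
∑-swap []      L f = sym (∑-zero L)
∑-swap (x ∷ K) L f =
  trans (cong (∑ L (f x) +_) (∑-swap K L f)) (sym (∑-+ L (f x) (λ y → ∑ K (λ x′ → f x′ y))))

∑-product : (K : List A) (L : List B) (f : A → ℕ) (g : B → ℕ) →
  (∑[ x ∈ K ] ∑[ y ∈ L ] (f x * g y)) ≡ ∑ K f * ∑ L g
∑-product K L f g = trans (∑-cong K (λ x → ∑-*ˡ L (f x) g)) (∑-*ʳ K (∑ L g) f)

∑-++ : (K L : List A) (f : A → ℕ) → ∑ (K ++ L) f ≡ ∑ K f + ∑ L f
∑-++ []      L f = refl
∑-++ (x ∷ K) L f rewrite ∑-++ K L f = sym (+-assoc (f x) _ _)

∑-map : (L : List A) (g : A → B) (f : B → ℕ) → ∑ (map g L) f ≡ ∑ L (f ∘ g)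
∑-map []      g f = refl
∑-map (x ∷ L) g f = cong (f (g x) +_) (∑-map L g f)

∑-∈ : (L : List A) (f : A → ℕ) {a : A} → a ∈ L → f a ≤ ∑ L f
∑-∈ (x ∷ L) f (here refl) = m≤m+n _ _
∑-∈ (x ∷ L) f (there a∈L) = ≤-trans (∑-∈ L f a∈L) (m≤n+m _ _)

∑-Unique : (_≟_ : DecidableEquality A) {L : List A} → Unique L →
  ∀ a → ∑[ x ∈ L ] ⟦ x ≟ a ⟧ ≤ 1
∑-Unique _≟_ []              a = z≤n
∑-Unique _≟_ (_∷_ {x} {L} x∉L uL) a with x ≟ a
... | no _     = ∑-Unique _≟_ uL a
... | yes refl = ≤-reflexive (cong suc (absent x∉L))
  where
  absent : ∀ {K} → All (λ y → ¬ x ≡ y) K → ∑[ y ∈ K ] ⟦ y ≟ x ⟧ ≡ 0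
  absent []                = refl
  absent (_∷_ {y} x≢y x∉K) = cong₂ _+_ (⟦⟧-no (y ≟ x) (x≢y ∘ sym)) (absent x∉K)

∑-member : (_≟_ : DecidableEquality A) {L : List A} {a : A} → a ∈ L → 1 ≤ ∑[ x ∈ L ] ⟦ x ≟ a ⟧
∑-member _≟_ {L} {a} a∈L =
  ≤-trans (≤-reflexive (sym (⟦⟧-yes (a ≟ a) refl))) (∑-∈ L (λ x → ⟦ x ≟ a ⟧) a∈L)

∑-member⁻ : (_≟_ : DecidableEquality A) (L : List A) {a : A} → 1 ≤ ∑[ x ∈ L ] ⟦ x ≟ a ⟧ → a ∈ L
∑-member⁻ _≟_ (x ∷ L) {a} h with x ≟ a
... | yes x≡a = here (sym x≡a)
... | no _    = there (∑-member⁻ _≟_ L h)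

2mn≤m²+n² : ∀ m n → 2 * (m * n) ≤ m * m + n * n
2mn≤m²+n² zero    n       = z≤n
2mn≤m²+n² (suc m) zero    rewrite *-zeroʳ m = z≤n
2mn≤m²+n² (suc m) (suc n) = begin
  2 * (suc m * suc n)                 ≡⟨ lhs m n ⟩
  2 * (m * n) + (2 * m + 2 * n + 2)   ≤⟨ +-monoˡ-≤ _ (2mn≤m²+n² m n) ⟩
  m * m + n * n + (2 * m + 2 * n + 2) ≡⟨ rhs m n ⟩
  suc m * suc m + suc n * suc n       ∎
  where
  open ≤-Reasoning
  lhs : ∀ m n → 2 * ((1 + m) * (1 + n)) ≡ 2 * (m * n) + (2 * m + 2 * n + 2)
  lhs = solve-∀
  rhs : ∀ m n → m * m + n * n + (2 * m + 2 * n + 2) ≡ (1 + m) * (1 + m) + (1 + n) * (1 + n)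
  rhs = solve-∀

cauchy-schwarz : (L : List A) (h : A → ℕ) → ∑ L h * ∑ L h ≤ length L * ∑[ x ∈ L ] (h x * h x)
cauchy-schwarz L h = *-cancelˡ-≤ 2 (begin
  2 * (∑ L h * ∑ L h)                                     ≡⟨ cong (2 *_) (∑-product L L h h) ⟨
  2 * (∑[ x ∈ L ] ∑[ y ∈ L ] (h x * h y))                 ≡⟨ ∑-*ˡ L 2 _ ⟨
  ∑[ x ∈ L ] (2 * ∑[ y ∈ L ] (h x * h y))                 ≡⟨ ∑-cong L (λ x → ∑-*ˡ L 2 _) ⟨
  ∑[ x ∈ L ] ∑[ y ∈ L ] (2 * (h x * h y))                 ≤⟨ ∑-mono L (λ x → ∑-mono L (λ y → 2mn≤m²+n² (h x) (h y))) ⟩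
  ∑[ x ∈ L ] ∑[ y ∈ L ] (h x * h x + h y * h y)           ≡⟨ ∑-cong L (λ x → trans (∑-+ L _ _) (cong (_+ H) (∑-const L _))) ⟩
  ∑[ x ∈ L ] (length L * (h x * h x) + H)                 ≡⟨ trans (∑-+ L _ _) (cong₂ _+_ (∑-*ˡ L (length L) _) (∑-const L H)) ⟩
  length L * H + length L * H                             ≡⟨ cong (length L * H +_) (+-identityʳ _) ⟨
  2 * (length L * H)                                      ∎)
  where
  open ≤-Reasoning
  H = ∑[ x ∈ L ] (h x * h x)

-- Cauchy-Schwarz applied to the weights of the fibres of `φ` over `K`. The weight `g` allows points
-- to be discarded: it will be constant 1 or the indicator of the generic points.
collisions : (_≟_ : DecidableEquality B) {K : List B} → Unique K → (L : List A) (g : A → ℕ) (φ : A → B) →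
  (∀ x → x ∈ L → 1 ≤ g x → φ x ∈ K) →
  ∑ L g * ∑ L g ≤ length K * ∑[ x ∈ L ] ∑[ y ∈ L ] (g x * g y * ⟦ φ x ≟ φ y ⟧)
collisions {B} {A} _≟_ {K} uK L g φ φ∈K = begin
  ∑ L g * ∑ L g                                 ≤⟨ *-mono-≤ cover cover ⟩
  ∑ K h * ∑ K h                                 ≤⟨ cauchy-schwarz K h ⟩
  length K * ∑[ b ∈ K ] (h b * h b)             ≤⟨ *-monoʳ-≤ (length K) square ⟩
  length K * ∑[ x ∈ L ] ∑[ y ∈ L ] (g x * g y * ⟦ φ x ≟ φ y ⟧) ∎
  where
  open ≤-Reasoning
  h : B → ℕ
  h b = ∑[ x ∈ L ] (g x * ⟦ φ x ≟ b ⟧)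
  weight : ∀ x → x ∈ L → g x ≤ ∑[ b ∈ K ] (g x * ⟦ φ x ≟ b ⟧)
  weight x x∈L with g x in eq
  ... | zero  = z≤n
  ... | suc m = begin
    suc m                                  ≡⟨ *-identityʳ (suc m) ⟨
    suc m * 1                              ≤⟨ *-monoʳ-≤ (suc m) (∑-member _≟_ (φ∈K x x∈L (subst (1 ≤_) (sym eq) (s≤s z≤n)))) ⟩
    suc m * ∑[ b ∈ K ] ⟦ b ≟ φ x ⟧         ≡⟨ ∑-*ˡ K (suc m) _ ⟨
    ∑[ b ∈ K ] (suc m * ⟦ b ≟ φ x ⟧)       ≡⟨ ∑-cong K (λ b → cong (suc m *_) (⟦⟧-cong (b ≟ φ x) (φ x ≟ b) sym sym)) ⟩
    ∑[ b ∈ K ] (suc m * ⟦ φ x ≟ b ⟧)       ∎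
  cover : ∑ L g ≤ ∑ K h
  cover = ≤-trans (∑-mono-∈ L weight) (≤-reflexive (∑-swap L K _))
  cell : ∀ x y → ∑[ b ∈ K ] (g x * ⟦ φ x ≟ b ⟧ * (g y * ⟦ φ y ≟ b ⟧)) ≤ g x * g y * ⟦ φ x ≟ φ y ⟧
  cell x y = begin
    ∑[ b ∈ K ] (g x * ⟦ φ x ≟ b ⟧ * (g y * ⟦ φ y ≟ b ⟧)) ≤⟨ ∑-mono K (λ b → pointwise b) ⟩
    ∑[ b ∈ K ] (g x * g y * ⟦ φ x ≟ φ y ⟧ * ⟦ b ≟ φ x ⟧) ≡⟨ ∑-*ˡ K (g x * g y * ⟦ φ x ≟ φ y ⟧) _ ⟩
    g x * g y * ⟦ φ x ≟ φ y ⟧ * ∑[ b ∈ K ] ⟦ b ≟ φ x ⟧   ≤⟨ *-monoʳ-≤ (g x * g y * ⟦ φ x ≟ φ y ⟧) (∑-Unique _≟_ uK (φ x)) ⟩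
    g x * g y * ⟦ φ x ≟ φ y ⟧ * 1                        ≡⟨ *-identityʳ _ ⟩
    g x * g y * ⟦ φ x ≟ φ y ⟧                            ∎
    where
    arrange : ∀ a b c d → a * c * (b * d) ≡ a * b * (c * d)
    arrange = solve-∀
    pointwise : ∀ b → g x * ⟦ φ x ≟ b ⟧ * (g y * ⟦ φ y ≟ b ⟧) ≤ g x * g y * ⟦ φ x ≟ φ y ⟧ * ⟦ b ≟ φ x ⟧
    pointwise b = begin
      g x * ⟦ φ x ≟ b ⟧ * (g y * ⟦ φ y ≟ b ⟧)    ≡⟨ arrange (g x) (g y) ⟦ φ x ≟ b ⟧ ⟦ φ y ≟ b ⟧ ⟩
      g x * g y * (⟦ φ x ≟ b ⟧ * ⟦ φ y ≟ b ⟧)    ≤⟨ *-monoʳ-≤ (g x * g y) (both (φ x ≟ b) (φ y ≟ b)) ⟩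
      g x * g y * (⟦ φ x ≟ φ y ⟧ * ⟦ b ≟ φ x ⟧)  ≡⟨ *-assoc (g x * g y) _ _ ⟨
      g x * g y * ⟦ φ x ≟ φ y ⟧ * ⟦ b ≟ φ x ⟧    ∎
      where
      both : (p : Dec (φ x ≡ b)) (r : Dec (φ y ≡ b)) → ⟦ p ⟧ * ⟦ r ⟧ ≤ ⟦ φ x ≟ φ y ⟧ * ⟦ b ≟ φ x ⟧
      both (no _)  _       = z≤n
      both (yes _) (no _)  = z≤n
      both (yes p) (yes r) = ≤-reflexive (sym (cong₂ _*_ (⟦⟧-yes (φ x ≟ φ y) (trans p (sym r))) (⟦⟧-yes (b ≟ φ x) (sym p))))
  square : ∑[ b ∈ K ] (h b * h b) ≤ ∑[ x ∈ L ] ∑[ y ∈ L ] (g x * g y * ⟦ φ x ≟ φ y ⟧)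
  square = begin
    ∑[ b ∈ K ] (h b * h b)
      ≡⟨ ∑-cong K (λ b → ∑-product L L _ _) ⟨
    ∑[ b ∈ K ] ∑[ x ∈ L ] ∑[ y ∈ L ] (g x * ⟦ φ x ≟ b ⟧ * (g y * ⟦ φ y ≟ b ⟧))
      ≡⟨ ∑-swap K L _ ⟩
    ∑[ x ∈ L ] ∑[ b ∈ K ] ∑[ y ∈ L ] (g x * ⟦ φ x ≟ b ⟧ * (g y * ⟦ φ y ≟ b ⟧))
      ≡⟨ ∑-cong L (λ x → ∑-swap K L _) ⟩
    ∑[ x ∈ L ] ∑[ y ∈ L ] ∑[ b ∈ K ] (g x * ⟦ φ x ≟ b ⟧ * (g y * ⟦ φ y ≟ b ⟧))
      ≤⟨ ∑-mono L (λ x → ∑-mono L (cell x)) ⟩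
    ∑[ x ∈ L ] ∑[ y ∈ L ] (g x * g y * ⟦ φ x ≟ φ y ⟧) ∎

-- Finite types and reindexing of sums

record Enumeration (A : Set) : Set where
  infix 4 _≟_
  field
    elements : List A
    _≟_      : DecidableEquality A
    unique   : Unique elements
    complete : ∀ a → a ∈ elements

  size : ℕ
  size = length elements

  once : ∀ a → ∑[ x ∈ elements ] ⟦ x ≟ a ⟧ ≡ 1
  once a = ≤-antisym (∑-Unique _≟_ unique a) (∑-member _≟_ (complete a))

  pick : (f : A → ℕ) (a : A) → ∑[ x ∈ elements ] (⟦ x ≟ a ⟧ * f x) ≡ f a
  pick f a = begin
    ∑[ x ∈ elements ] (⟦ x ≟ a ⟧ * f x)  ≡⟨ ∑-cong elements (λ x → ⟦⟧*-cong (x ≟ a) (cong f)) ⟩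
    ∑[ x ∈ elements ] (⟦ x ≟ a ⟧ * f a)  ≡⟨ ∑-*ʳ elements (f a) _ ⟩
    (∑[ x ∈ elements ] ⟦ x ≟ a ⟧) * f a  ≡⟨ cong (_* f a) (once a) ⟩
    1 * f a                              ≡⟨ *-identityˡ (f a) ⟩
    f a                                  ∎
    where open ≡-Reasoning

  reindex : (φ ψ : A → A) → (∀ x → ψ (φ x) ≡ x) → (∀ y → φ (ψ y) ≡ y) → (f : A → ℕ) →
    ∑ elements (f ∘ φ) ≡ ∑ elements f
  reindex φ ψ ψφ φψ f = begin
    ∑[ x ∈ elements ] f (φ x)
      ≡⟨ ∑-cong elements (λ x → pick f (φ x)) ⟨
    ∑[ x ∈ elements ] ∑[ y ∈ elements ] (⟦ y ≟ φ x ⟧ * f y)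
      ≡⟨ ∑-swap elements elements _ ⟩
    ∑[ y ∈ elements ] ∑[ x ∈ elements ] (⟦ y ≟ φ x ⟧ * f y)
      ≡⟨ ∑-cong elements (λ y → ∑-cong elements (λ x → cong (_* f y)
           (⟦⟧-cong (y ≟ φ x) (x ≟ ψ y)
             (λ p → trans (sym (ψφ x)) (cong ψ (sym p))) (λ p → trans (sym (φψ y)) (cong φ (sym p)))))) ⟩
    ∑[ y ∈ elements ] ∑[ x ∈ elements ] (⟦ x ≟ ψ y ⟧ * f y)
      ≡⟨ ∑-cong elements (λ y → pick (λ _ → f y) (ψ y)) ⟩
    ∑[ y ∈ elements ] f y ∎
    where open ≡-Reasoning

  -- Injectivity is phrased as fibre counts along the list, so it also excludes repetitions in `L`.
  ∑-image : (L : List B) (f : B → A) → (∀ a → ∑[ x ∈ L ] ⟦ f x ≟ a ⟧ ≤ 1) → (g : A → ℕ) →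
    ∑[ x ∈ L ] g (f x) ≤ ∑ elements g
  ∑-image L f inj g = begin
    ∑[ x ∈ L ] g (f x)                                     ≡⟨ ∑-cong L (λ x → pick g (f x)) ⟨
    ∑[ x ∈ L ] ∑[ a ∈ elements ] (⟦ a ≟ f x ⟧ * g a)       ≡⟨ ∑-swap L elements _ ⟩
    ∑[ a ∈ elements ] ∑[ x ∈ L ] (⟦ a ≟ f x ⟧ * g a)       ≡⟨ ∑-cong elements (λ a → ∑-*ʳ L (g a) _) ⟩
    ∑[ a ∈ elements ] ((∑[ x ∈ L ] ⟦ a ≟ f x ⟧) * g a)     ≡⟨ ∑-cong elements (λ a → cong (_* g a) (∑-cong L (λ x → ⟦⟧-cong (a ≟ f x) (f x ≟ a) sym sym))) ⟩
    ∑[ a ∈ elements ] ((∑[ x ∈ L ] ⟦ f x ≟ a ⟧) * g a)     ≤⟨ ∑-mono elements (λ a → *-monoˡ-≤ (g a) (inj a)) ⟩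
    ∑[ a ∈ elements ] (1 * g a)                            ≡⟨ ∑-cong elements (λ a → *-identityˡ (g a)) ⟩
    ∑ elements g                                           ∎
    where open ≤-Reasoning

∑-cartesianProductWith : (g : A → B → C) (K : List A) (L : List B) (f : C → ℕ) →
  ∑ (cartesianProductWith g K L) f ≡ ∑[ x ∈ K ] ∑[ y ∈ L ] f (g x y)
∑-cartesianProductWith g []      L f = refl
∑-cartesianProductWith g (x ∷ K) L f =
  trans (∑-++ (map (g x) L) _ f) (cong₂ _+_ (∑-map L (g x) f) (∑-cartesianProductWith g K L f))

vectors : Enumeration A → ∀ n → Enumeration (Vec A n)
vectors {A} 𝔸 n = record
  { elements = tuples n
  ; _≟_      = Vec.≡-dec (Enumeration._≟_ 𝔸)
  ; unique   = tuples-unique n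
  ; complete = tuples-complete
  }
  where
  open Enumeration 𝔸 using (elements; unique; complete)
  tuples : ∀ n → List (Vec A n)
  tuples zero    = [] ∷ []
  tuples (suc n) = cartesianProductWith _∷_ elements (tuples n)
  tuples-unique : ∀ n → Unique (tuples n)
  tuples-unique zero    = [] ∷ []
  tuples-unique (suc n) = Unique.cartesianProductWith⁺ _∷_ Vec.∷-injective unique (tuples-unique n)
  tuples-complete : ∀ {n} (v : Vec A n) → v ∈ tuples n
  tuples-complete []      = here refl
  tuples-complete (a ∷ v) = ∈-cartesianProductWith⁺ _∷_ (complete a) (tuples-complete v)

∑-vectors : (𝔸 : Enumeration A) {n : ℕ} (f : Vec A (suc n) → ℕ) →
  ∑ (Enumeration.elements (vectors 𝔸 (suc n))) f ≡
  ∑[ a ∈ Enumeration.elements 𝔸 ] ∑[ v ∈ Enumeration.elements (vectors 𝔸 n) ] f (a ∷ v)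
∑-vectors 𝔸 {n} f =
  ∑-cartesianProductWith _∷_ (Enumeration.elements 𝔸) (Enumeration.elements (vectors 𝔸 n)) f

size-vectors : (𝔸 : Enumeration A) (n : ℕ) →
  Enumeration.size (vectors 𝔸 n) ≡ Enumeration.size 𝔸 ^ n
size-vectors 𝔸 zero    = refl
size-vectors 𝔸 (suc n) = begin
  size (vectors 𝔸 (suc n))                             ≡⟨ ∑-one (elements (vectors 𝔸 (suc n))) ⟨
  ∑ (elements (vectors 𝔸 (suc n))) (λ _ → 1)           ≡⟨ ∑-vectors 𝔸 (λ _ → 1) ⟩
  ∑[ a ∈ elements 𝔸 ] ∑ (elements (vectors 𝔸 n)) (λ _ → 1) ≡⟨ ∑-const (elements 𝔸) _ ⟩
  size 𝔸 * ∑ (elements (vectors 𝔸 n)) (λ _ → 1)        ≡⟨ cong (size 𝔸 *_) (∑-one (elements (vectors 𝔸 n))) ⟩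
  size 𝔸 * size (vectors 𝔸 n)                          ≡⟨ cong (size 𝔸 *_) (size-vectors 𝔸 n) ⟩
  size 𝔸 * size 𝔸 ^ n                                  ∎
  where
  open ≡-Reasoning
  open Enumeration

pair-collisions : (_≟_ : DecidableEquality B) {K : List B} → Unique K → (L : List A) (φ : A → B) →
  (∀ x → x ∈ L → φ x ∈ K) →
  length L * length L ≤ length K * ∑[ x ∈ L ] ∑[ y ∈ L ] ⟦ φ x ≟ φ y ⟧
pair-collisions _≟_ {K} uK L φ φ∈K = begin
  length L * length L
    ≡⟨ cong₂ _*_ (∑-one L) (∑-one L) ⟨
  ∑ L (λ _ → 1) * ∑ L (λ _ → 1)
    ≤⟨ collisions _≟_ uK L (λ _ → 1) φ (λ x x∈L _ → φ∈K x x∈L) ⟩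
  length K * ∑[ x ∈ L ] ∑[ y ∈ L ] (1 * 1 * ⟦ φ x ≟ φ y ⟧)
    ≡⟨ cong (length K *_) (∑-cong L (λ x → ∑-cong L (λ y → *-identityˡ _))) ⟩
  length K * ∑[ x ∈ L ] ∑[ y ∈ L ] ⟦ φ x ≟ φ y ⟧ ∎
  where open ≤-Reasoning

∑∑-cauchy-schwarz : (L : List A) (h : A → A → ℕ) →
  (∑[ x ∈ L ] ∑[ y ∈ L ] h x y) * (∑[ x ∈ L ] ∑[ y ∈ L ] h x y) ≤
  length L * length L * ∑[ x ∈ L ] ∑[ y ∈ L ] (h x y * h x y)
∑∑-cauchy-schwarz L h = begin
  (∑[ x ∈ L ] ∑ L (h x)) * (∑[ x ∈ L ] ∑ L (h x))
    ≤⟨ cauchy-schwarz L (λ x → ∑ L (h x)) ⟩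
  length L * ∑[ x ∈ L ] (∑ L (h x) * ∑ L (h x))
    ≤⟨ *-monoʳ-≤ (length L) (∑-mono L (λ x → cauchy-schwarz L (h x))) ⟩
  length L * ∑[ x ∈ L ] (length L * ∑[ y ∈ L ] (h x y * h x y))
    ≡⟨ cong (length L *_) (∑-*ˡ L (length L) _) ⟩
  length L * (length L * ∑[ x ∈ L ] ∑[ y ∈ L ] (h x y * h x y))
    ≡⟨ *-assoc (length L) (length L) _ ⟨
  length L * length L * ∑[ x ∈ L ] ∑[ y ∈ L ] (h x y * h x y) ∎
  where open ≤-Reasoning

-- Boolean quantifiers over lists

any⁺ : (p : A → Bool) {L : List A} {x : A} → x ∈ L → p x ≡ true → any p L ≡ true
any⁺ p (here refl) px rewrite px = refl
any⁺ p {y ∷ L} (there x∈L) px rewrite any⁺ p x∈L px = ∨-zeroʳ (p y)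

any⁻ : (p : A → Bool) (L : List A) → any p L ≡ true → ∃ λ x → x ∈ L × p x ≡ true
any⁻ p (y ∷ L) h with p y in py
... | true  = y , here refl , py
... | false with any⁻ p L h
...   | x , x∈L , px = x , there x∈L , px

all⁺ : (p : A → Bool) (L : List A) → (∀ x → x ∈ L → p x ≡ true) → all p L ≡ true
all⁺ p []      h = refl
all⁺ p (y ∷ L) h rewrite h y (here refl) = all⁺ p L (λ x → h x ∘ there)

all⁻ : (p : A → Bool) {L : List A} {x : A} → all p L ≡ true → x ∈ L → p x ≡ true
all⁻ p {y ∷ L} h x∈L with p y in py
all⁻ p {y ∷ L} h (here refl) | true = py
all⁻ p {y ∷ L} h (there x∈L) | true = all⁻ p h x∈L

𝟙 : Bool → ℕ
𝟙 true  = 1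
𝟙 false = 0

𝟙-mono : ∀ {a b} → (a ≡ true → b ≡ true) → 𝟙 a ≤ 𝟙 b
𝟙-mono {true}  h rewrite h refl = ≤-refl
𝟙-mono {false} h = z≤n

-- Arithmetic of the size condition

^-distribʳ-* : ∀ a b k → (a * b) ^ k ≡ a ^ k * b ^ k
^-distribʳ-* a b zero    = refl
^-distribʳ-* a b (suc k) = trans (cong (a * b *_) (^-distribʳ-* a b k)) (interchange a b (a ^ k) (b ^ k))
  where
  interchange : ∀ a b x y → a * b * (x * y) ≡ a * x * (b * y)
  interchange = solve-∀

-- The bound N ≥ (4/1) q^((d+1)/2 - 1/(6d+2)) raised to the power 2(3d+1), which makes all exponents
-- integral: (d+1)(3d+1) - 1 = d(3d+4). The factor with base 1 is the denominator of C, kept so that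
-- the type agrees with the theorem at a = 4, b = 1.
Dense : ℕ → ℕ → ℕ → Set
Dense d q N = 4 ^ (2 * (3 * d + 1)) * q ^ (d * (3 * d + 4)) ≤ 1 ^ (2 * (3 * d + 1)) * N ^ (2 * (3 * d + 1))

dense⇒^≤ : ∀ {d q N} → Dense d q N → 4 ^ (2 * (3 * d + 1)) * q ^ (d * (3 * d + 4)) ≤ N ^ (2 * (3 * d + 1))
dense⇒^≤ {d} {q} {N} dense = ≤-trans dense (≤-reflexive
  (trans (cong (_* N ^ (2 * (3 * d + 1))) (^-zeroˡ (2 * (3 * d + 1)))) (*-identityˡ _)))

-- The critical exponent is at least d/2 = n: after raising to the power M the gap between the
-- exponents of q is 3d. The constant 4 is the one met later in the bounds for zeros on a subspace.
dense⇒large : ∀ {d n q N} → d ≡ n + n → 1 ≤ q → Dense d q N → 4 * q ^ n ≤ N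
dense⇒large {n = n} {q} {N} refl 1≤q dense = ≮⇒≥ (λ small → <⇒≱ (^-monoˡ-< M {{nonzero}} small) (begin
  (4 * q ^ n) ^ M                     ≡⟨ trans (^-distribʳ-* 4 (q ^ n) M) (cong (4 ^ M *_) (^-*-assoc q n M)) ⟩
  4 ^ M * q ^ (n * M)                 ≤⟨ *-monoʳ-≤ (4 ^ M) (^-monoʳ-≤ q {{>-nonZero 1≤q}} (≤-trans (m≤m+n (n * M) (3 * (n + n))) (≤-reflexive (exponents n)))) ⟩
  4 ^ M * q ^ ((n + n) * (3 * (n + n) + 4)) ≤⟨ dense⇒^≤ {n + n} {q} {N} dense ⟩
  N ^ M                               ∎))
  where
  open ≤-Reasoning
  M = 2 * (3 * (n + n) + 1)
  nonzero : NonZero M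
  nonzero = >-nonZero (*-mono-≤ {1} {2} (s≤s z≤n) (m≤n+m 1 (3 * (n + n))))
  exponents : ∀ n → n * (2 * (3 * (n + n) + 1)) + 3 * (n + n) ≡ (n + n) * (3 * (n + n) + 4)
  exponents = solve-∀

-- Cancelling one N turns the inequality into N^(4n+3) ≤ 2^(n+1) q^((2d+1)(n+1)), that is, N is at
-- most a constant times q^((d+1)/2 - 1/(4d+6)). For d ≥ 2 one has 4d+6 ≤ 6d+2, so `Dense`
-- contradicts it.
dense⇒growing : ∀ {d n q N} → d ≡ n + n → 1 ≤ n → 1 ≤ q → 0 < N → Dense d q N →
  ¬ ((N * N) ^ suc n * (N * N) ^ suc n ≤ (2 * q ^ d) ^ suc n * (q * q ^ d) ^ suc n * N)
dense⇒growing {n = suc n} {q} {N} refl _ 1≤q 0<N dense small = <⇒≱ gap (begin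
  4 ^ (M * (4 * k + 3)) * q ^ (P * (4 * k + 3))
    ≡⟨ cong₂ _*_ (^-*-assoc 4 M (4 * k + 3)) (^-*-assoc q P (4 * k + 3)) ⟨
  (4 ^ M) ^ (4 * k + 3) * (q ^ P) ^ (4 * k + 3)
    ≡⟨ ^-distribʳ-* (4 ^ M) (q ^ P) (4 * k + 3) ⟨
  (4 ^ M * q ^ P) ^ (4 * k + 3)
    ≤⟨ ^-monoˡ-≤ (4 * k + 3) (dense⇒^≤ {k + k} {q} {N} dense) ⟩
  (N ^ M) ^ (4 * k + 3)
    ≡⟨ trans (^-*-assoc N M (4 * k + 3)) (trans (cong (N ^_) (*-comm M (4 * k + 3))) (sym (^-*-assoc N (4 * k + 3) M))) ⟩
  (N ^ (4 * k + 3)) ^ M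
    ≤⟨ ^-monoˡ-≤ M cancelled ⟩
  (2 ^ suc k * q ^ ((2 * (k + k) + 1) * suc k)) ^ M
    ≡⟨ trans (^-distribʳ-* (2 ^ suc k) _ M) (cong₂ _*_ (^-*-assoc 2 (suc k) M) (^-*-assoc q ((2 * (k + k) + 1) * suc k) M)) ⟩
  2 ^ (suc k * M) * q ^ ((2 * (k + k) + 1) * suc k * M) ∎)
  where
  open ≤-Reasoning
  k = suc n
  M = 2 * (3 * (k + k) + 1)
  P = (k + k) * (3 * (k + k) + 4)
  instance
    q≢0 : NonZero q
    q≢0 = >-nonZero 1≤q
    N≢0 : NonZero N
    N≢0 = >-nonZero 0<N
  left : (N * N) ^ suc k * (N * N) ^ suc k ≡ N ^ (4 * k + 3) * N
  left = begin-equality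
    (N * N) ^ suc k * (N * N) ^ suc k                    ≡⟨ cong₂ _*_ (^-distribʳ-* N N (suc k)) (^-distribʳ-* N N (suc k)) ⟩
    N ^ suc k * N ^ suc k * (N ^ suc k * N ^ suc k)      ≡⟨ cong₂ _*_ (^-distribˡ-+-* N (suc k) (suc k)) (^-distribˡ-+-* N (suc k) (suc k)) ⟨
    N ^ (suc k + suc k) * N ^ (suc k + suc k)            ≡⟨ ^-distribˡ-+-* N (suc k + suc k) (suc k + suc k) ⟨
    N ^ (suc k + suc k + (suc k + suc k))                ≡⟨ cong (N ^_) (exponents k) ⟩
    N ^ suc (4 * k + 3)                                  ≡⟨ *-comm N _ ⟩
    N ^ (4 * k + 3) * N                                  ∎
    where
    exponents : ∀ k → (1 + k) + (1 + k) + ((1 + k) + (1 + k)) ≡ 1 + (4 * k + 3)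
    exponents = solve-∀
  right : (2 * q ^ (k + k)) ^ suc k * (q * q ^ (k + k)) ^ suc k ≡ 2 ^ suc k * q ^ ((2 * (k + k) + 1) * suc k)
  right = begin-equality
    (2 * q ^ (k + k)) ^ suc k * (q * q ^ (k + k)) ^ suc k   ≡⟨ ^-distribʳ-* (2 * q ^ (k + k)) (q * q ^ (k + k)) (suc k) ⟨
    (2 * q ^ (k + k) * (q * q ^ (k + k))) ^ suc k           ≡⟨ cong (_^ suc k) (*-assoc 2 (q ^ (k + k)) _) ⟩
    (2 * (q ^ (k + k) * (q * q ^ (k + k)))) ^ suc k         ≡⟨ cong (λ x → (2 * x) ^ suc k) (^-distribˡ-+-* q (k + k) (suc (k + k))) ⟨
    (2 * q ^ (k + k + suc (k + k))) ^ suc k                 ≡⟨ cong (λ x → (2 * q ^ x) ^ suc k) (exponents (k + k)) ⟩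
    (2 * q ^ (2 * (k + k) + 1)) ^ suc k                     ≡⟨ ^-distribʳ-* 2 (q ^ (2 * (k + k) + 1)) (suc k) ⟩
    2 ^ suc k * (q ^ (2 * (k + k) + 1)) ^ suc k             ≡⟨ cong (2 ^ suc k *_) (^-*-assoc q (2 * (k + k) + 1) (suc k)) ⟩
    2 ^ suc k * q ^ ((2 * (k + k) + 1) * suc k)             ∎
    where
    exponents : ∀ e → e + (1 + e) ≡ 2 * e + 1
    exponents = solve-∀
  cancelled : N ^ (4 * k + 3) ≤ 2 ^ suc k * q ^ ((2 * (k + k) + 1) * suc k)
  cancelled = *-cancelʳ-≤ _ _ N (begin
    N ^ (4 * k + 3) * N                                           ≡⟨ left ⟨
    (N * N) ^ suc k * (N * N) ^ suc k                             ≤⟨ small ⟩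
    (2 * q ^ (k + k)) ^ suc k * (q * q ^ (k + k)) ^ suc k * N     ≡⟨ cong (_* N) right ⟩
    2 ^ suc k * q ^ ((2 * (k + k) + 1) * suc k) * N               ∎)
  -- Here k = 1 + n is half the dimension. The exponents of q differ by exactly 2n, which vanishes
  -- for d = 2, so strictness has to come from the constants 2 < 4.
  gap : 2 ^ (suc k * M) * q ^ ((2 * (k + k) + 1) * suc k * M) < 4 ^ (M * (4 * k + 3)) * q ^ (P * (4 * k + 3))
  gap = begin-strict
    2 ^ (suc k * M) * q ^ ((2 * (k + k) + 1) * suc k * M)
      ≤⟨ *-mono-≤ (^-monoʳ-≤ 2 (≤-trans (m≤m+n (suc k * M) ((3 * k + 2) * M)) (≤-reflexive (exponents₁ k M))))
                  (^-monoʳ-≤ q (≤-trans (m≤m+n ((2 * (k + k) + 1) * suc k * M) (2 * n)) (≤-reflexive (exponents₂ n)))) ⟩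
    2 ^ (M * (4 * k + 3)) * q ^ (P * (4 * k + 3))
      <⟨ *-monoˡ-< (q ^ (P * (4 * k + 3))) {{m^n≢0 q (P * (4 * k + 3))}}
           (^-monoˡ-< (M * (4 * k + 3)) {{>-nonZero 0<exponent}} {2} {4} (s≤s (s≤s (s≤s z≤n)))) ⟩
    4 ^ (M * (4 * k + 3)) * q ^ (P * (4 * k + 3)) ∎
    where
    0<exponent : 0 < M * (4 * k + 3)
    0<exponent = *-mono-≤ {1} {M} (*-mono-≤ {1} {2} (s≤s z≤n) (m≤n+m 1 (3 * (k + k)))) (≤-trans (s≤s z≤n) (m≤n+m 3 (4 * k)))
    exponents₁ : ∀ k m → (1 + k) * m + (3 * k + 2) * m ≡ m * (4 * k + 3)
    exponents₁ = solve-∀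
    exponents₂ : ∀ n → (2 * ((1 + n) + (1 + n)) + 1) * (1 + (1 + n)) * (2 * (3 * ((1 + n) + (1 + n)) + 1)) + 2 * n ≡
      ((1 + n) + (1 + n)) * (3 * ((1 + n) + (1 + n)) + 4) * (4 * (1 + n) + 3)
    exponents₂ = solve-∀

-- Finite field arithmetic and the size of a hyperplane

module OverField {q : ℕ} (F : FiniteField q) where
  open FiniteField F
    using (commRing; Carrier; 0#; 1#; _≈_; ≈⇒≡; enumeration)
    renaming (_+_ to _+ᶠ_; _*_ to _*ᶠ_; -_ to -ᶠ_; _≟_ to infix 4 _≟ᶠ_)
  open FiniteField F using (0≢1; inverse) renaming (refl to ≈-refl)

  infixl 6 _-ᶠ_
  _-ᶠ_ : Carrier → Carrier → Carrier
  x -ᶠ y = x +ᶠ (-ᶠ y)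

  open IntegerCoefficients commRing using (module Solver; :0; :1)
  open Solver using (solve; _:=_; _:+_; _:*_; _:-_; :-_)

  ≡⇒≈ : ∀ {x y} → x ≡ y → x ≈ y
  ≡⇒≈ refl = ≈-refl

  1≢0 : 1# ≢ 0#
  1≢0 p = 0≢1 (≡⇒≈ (sym p))

  inv : ∀ {x} → x ≢ 0# → Carrier
  inv x≢0 = proj₁ (inverse _ (x≢0 ∘ ≈⇒≡))

  *-inv : ∀ {x} (x≢0 : x ≢ 0#) → x *ᶠ inv x≢0 ≡ 1#
  *-inv x≢0 = ≈⇒≡ (proj₂ (inverse _ (x≢0 ∘ ≈⇒≡)))

  *ᶠ-identityˡ : ∀ x → 1# *ᶠ x ≡ x
  *ᶠ-identityˡ x = ≈⇒≡ (solve 1 (λ x → :1 :* x := x) ≈-refl x)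

  *ᶠ-assoc : ∀ x y z → x *ᶠ (y *ᶠ z) ≡ x *ᶠ y *ᶠ z
  *ᶠ-assoc x y z = ≈⇒≡ (solve 3 (λ x y z → x :* (y :* z) := x :* y :* z) ≈-refl x y z)

  *ᶠ-comm : ∀ x y → x *ᶠ y ≡ y *ᶠ x
  *ᶠ-comm x y = ≈⇒≡ (solve 2 (λ x y → x :* y := y :* x) ≈-refl x y)

  *ᶠ-zeroʳ : ∀ x → x *ᶠ 0# ≡ 0#
  *ᶠ-zeroʳ x = ≈⇒≡ (solve 1 (λ x → x :* :0 := :0) ≈-refl x)

  inv-cancelˡ : ∀ {x} (x≢0 : x ≢ 0#) y → inv x≢0 *ᶠ (x *ᶠ y) ≡ y
  inv-cancelˡ {x} x≢0 y = begin
    inv x≢0 *ᶠ (x *ᶠ y)  ≡⟨ *ᶠ-assoc _ x y ⟩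
    inv x≢0 *ᶠ x *ᶠ y    ≡⟨ cong (_*ᶠ y) (trans (*ᶠ-comm _ x) (*-inv x≢0)) ⟩
    1# *ᶠ y              ≡⟨ *ᶠ-identityˡ y ⟩
    y                    ∎
    where open ≡-Reasoning

  inv-cancelʳ : ∀ {x} (x≢0 : x ≢ 0#) y → x *ᶠ (inv x≢0 *ᶠ y) ≡ y
  inv-cancelʳ {x} x≢0 y =
    trans (*ᶠ-assoc x _ y) (trans (cong (_*ᶠ y) (*-inv x≢0)) (*ᶠ-identityˡ y))

  inv≢0 : ∀ {x} (x≢0 : x ≢ 0#) → inv x≢0 ≢ 0#
  inv≢0 {x} x≢0 p = 1≢0 (trans (sym (*-inv x≢0)) (trans (cong (x *ᶠ_) p) (*ᶠ-zeroʳ x)))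

  integral : ∀ {x y} → x ≢ 0# → x *ᶠ y ≡ 0# → y ≡ 0#
  integral {x} {y} x≢0 xy≡0 =
    trans (sym (inv-cancelˡ x≢0 y)) (trans (cong (inv x≢0 *ᶠ_) xy≡0) (*ᶠ-zeroʳ _))

  x-y≡0⇒x≡y : ∀ {x y} → x -ᶠ y ≡ 0# → x ≡ y
  x-y≡0⇒x≡y {x} {y} p = trans (sym (≈⇒≡ (solve 2 (λ x y → x :- y :+ y := x) ≈-refl x y))) (trans (cong (_+ᶠ y) p) (≈⇒≡ (solve 1 (λ y → :0 :+ y := y) ≈-refl y)))

  x≡y⇒x-y≡0 : ∀ {x y} → x ≡ y → x -ᶠ y ≡ 0#
  x≡y⇒x-y≡0 {x} refl = ≈⇒≡ (solve 1 (λ x → x :- x := :0) ≈-refl x)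

  scalars : Enumeration Carrier
  scalars = record
    { elements = map to (allFin q)
    ; _≟_      = _≟ᶠ_
    ; unique   = Unique.map⁺ injective (Unique.allFin⁺ q)
    ; complete = λ a → subst (_∈ map to (allFin q)) (strictlyInverseˡ a) (∈-map⁺ to (∈-allFin (from a)))
    }
    where
    open Inverse enumeration using (to; from; strictlyInverseˡ; strictlyInverseʳ)
    injective : ∀ {i j} → to i ≡ to j → i ≡ j
    injective {i} {j} p = trans (sym (strictlyInverseʳ i)) (trans (cong from p) (strictlyInverseʳ j))

  Fs : List Carrier
  Fs = Enumeration.elements scalars

  Vs : ∀ n → List (Vec Carrier n)
  Vs n = Enumeration.elements (vectors scalars n)

  infix 4 _≟ᵛ_
  _≟ᵛ_ : ∀ {n} → DecidableEquality (Vec Carrier n)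
  _≟ᵛ_ {n} = Enumeration._≟_ (vectors scalars n)

  length-Fs : length Fs ≡ q
  length-Fs = trans (length-map _ (allFin q)) (length-tabulate {n = q} _)

  length-Vs : ∀ n → length (Vs n) ≡ q ^ n
  length-Vs n = trans (size-vectors scalars n) (cong (_^ n) length-Fs)

  nonzero : Carrier → ℕ
  nonzero r = 1 Data.Nat.∸ ⟦ r ≟ᶠ 0# ⟧

  2≤q : 2 ≤ q
  2≤q = begin
    2                                              ≡⟨ cong₂ _+_ (Enumeration.once scalars 0#) (Enumeration.once scalars 1#) ⟨
    ∑[ x ∈ Fs ] ⟦ x ≟ᶠ 0# ⟧ + ∑[ x ∈ Fs ] ⟦ x ≟ᶠ 1# ⟧  ≡⟨ ∑-+ Fs _ _ ⟨
    ∑[ x ∈ Fs ] (⟦ x ≟ᶠ 0# ⟧ + ⟦ x ≟ᶠ 1# ⟧)          ≤⟨ ∑-mono Fs disjoint ⟩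
    ∑ Fs (λ _ → 1)                                 ≡⟨ trans (∑-one Fs) length-Fs ⟩
    q                                              ∎
    where
    open ≤-Reasoning
    disjoint : ∀ x → ⟦ x ≟ᶠ 0# ⟧ + ⟦ x ≟ᶠ 1# ⟧ ≤ 1
    disjoint x with x ≟ᶠ 0# | x ≟ᶠ 1#
    ... | yes p | yes r = ⊥-elim (1≢0 (trans (sym r) p))
    ... | yes _ | no _  = ≤-refl
    ... | no _  | yes _ = ≤-refl
    ... | no _  | no _  = z≤n

  units : ℕ
  units = ∑[ r ∈ Fs ] nonzero r

  1+units≡q : suc units ≡ q
  1+units≡q = begin
    suc units                                           ≡⟨ cong (_+ units) (Enumeration.once scalars 0#) ⟨
    ∑[ r ∈ Fs ] ⟦ r ≟ᶠ 0# ⟧ + ∑[ r ∈ Fs ] nonzero r      ≡⟨ ∑-+ Fs _ _ ⟨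
    ∑[ r ∈ Fs ] (⟦ r ≟ᶠ 0# ⟧ + nonzero r)               ≡⟨ ∑-cong Fs (λ r → m+[n∸m]≡n (⟦⟧≤1 (r ≟ᶠ 0#))) ⟩
    ∑ Fs (λ _ → 1)                                      ≡⟨ trans (∑-one Fs) length-Fs ⟩
    q                                                   ∎
    where open ≡-Reasoning

  q≤2units : q ≤ 2 * units
  q≤2units = begin
    q               ≡⟨ 1+units≡q ⟨
    suc units       ≤⟨ +-monoˡ-≤ units (≤-pred (≤-trans 2≤q (≤-reflexive (sym 1+units≡q)))) ⟩
    units + units   ≡⟨ cong (units +_) (+-identityʳ units) ⟨
    2 * units       ∎
    where open ≤-Reasoning

  nonzero*-≤ : (r : Carrier) {m n : ℕ} → (r ≢ 0# → m ≤ n) → nonzero r * m ≤ n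
  nonzero*-≤ r {m} h with r ≟ᶠ 0#
  ... | yes _  = z≤n
  ... | no r≢0 = ≤-trans (≤-reflexive (+-identityʳ m)) (h r≢0)

  linear-root : ∀ {a} → a ≢ 0# → ∀ b t → ∑[ c ∈ Fs ] ⟦ a *ᶠ c +ᶠ b ≟ᶠ t ⟧ ≡ 1
  linear-root {a} a≢0 b t = trans
    (∑-cong Fs (λ c → ⟦⟧-cong (a *ᶠ c +ᶠ b ≟ᶠ t) (c ≟ᶠ inv a≢0 *ᶠ (t -ᶠ b)) (forth c) (back c)))
    (Enumeration.once scalars _)
    where
    forth : ∀ c → a *ᶠ c +ᶠ b ≡ t → c ≡ inv a≢0 *ᶠ (t -ᶠ b)
    forth c refl = trans (sym (inv-cancelˡ a≢0 c)) (cong (inv a≢0 *ᶠ_) (sym (≈⇒≡ (solve 2 (λ c b → c :+ b :- b := c) ≈-refl (a *ᶠ c) b))))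
    back : ∀ c → c ≡ inv a≢0 *ᶠ (t -ᶠ b) → a *ᶠ c +ᶠ b ≡ t
    back c refl = trans (cong (_+ᶠ b) (inv-cancelʳ a≢0 (t -ᶠ b))) (≈⇒≡ (solve 2 (λ t b → t :- b :+ b := t) ≈-refl t b))

  infixl 6 _+ᵛ_ _-ᵛ_
  infixl 7 _·_ _∙_

  _+ᵛ_ _-ᵛ_ : ∀ {n} → Vec Carrier n → Vec Carrier n → Vec Carrier n
  _+ᵛ_ = zipWith _+ᶠ_
  _-ᵛ_ = zipWith _-ᶠ_

  _·_ : ∀ {n} → Carrier → Vec Carrier n → Vec Carrier n
  r · v = Vec.map (r *ᶠ_) v

  _∙_ : ∀ {n} → Vec Carrier n → Vec Carrier n → Carrier
  []      ∙ []      = 0#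
  (a ∷ v) ∙ (b ∷ w) = a *ᶠ b +ᶠ v ∙ w

  0ᵛ : ∀ {n} → Vec Carrier n
  0ᵛ = replicate _ 0#

  -- The factor q stands in for the exponent n - 1. A nonzero leading coefficient determines its
  -- coordinate from the others; a zero one leaves its coordinate free, which contributes a factor q
  -- to the induction.
  hyperplane : ∀ {n} (a : Vec Carrier n) → a ≢ 0ᵛ → ∀ t → q * ∑[ c ∈ Vs n ] ⟦ a ∙ c ≟ᶠ t ⟧ ≡ q ^ n
  hyperplane         []      a≢0 t = ⊥-elim (a≢0 refl)
  hyperplane {suc n} (a ∷ v) a≢0 t with a ≟ᶠ 0#
  ... | no a≢0 = cong (q *_) (begin
    ∑[ c ∈ Vs (suc n) ] ⟦ (a ∷ v) ∙ c ≟ᶠ t ⟧             ≡⟨ ∑-vectors scalars _ ⟩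
    ∑[ c ∈ Fs ] ∑[ w ∈ Vs n ] ⟦ a *ᶠ c +ᶠ v ∙ w ≟ᶠ t ⟧   ≡⟨ ∑-swap Fs (Vs n) _ ⟩
    ∑[ w ∈ Vs n ] ∑[ c ∈ Fs ] ⟦ a *ᶠ c +ᶠ v ∙ w ≟ᶠ t ⟧   ≡⟨ ∑-cong (Vs n) (λ w → linear-root a≢0 (v ∙ w) t) ⟩
    ∑ (Vs n) (λ _ → 1)                                   ≡⟨ trans (∑-one (Vs n)) (length-Vs n) ⟩
    q ^ n                                                ∎)
    where open ≡-Reasoning
  ... | yes refl = cong (q *_) (begin
    ∑[ c ∈ Vs (suc n) ] ⟦ (0# ∷ v) ∙ c ≟ᶠ t ⟧            ≡⟨ ∑-vectors scalars _ ⟩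
    ∑[ c ∈ Fs ] ∑[ w ∈ Vs n ] ⟦ 0# *ᶠ c +ᶠ v ∙ w ≟ᶠ t ⟧  ≡⟨ ∑-cong Fs (λ c → ∑-cong (Vs n) (λ w →
                                                              cong (λ s → ⟦ s ≟ᶠ t ⟧) (≈⇒≡ (solve 2 (λ c x → :0 :* c :+ x := x) ≈-refl c (v ∙ w))))) ⟩
    ∑[ c ∈ Fs ] ∑[ w ∈ Vs n ] ⟦ v ∙ w ≟ᶠ t ⟧             ≡⟨ ∑-const Fs _ ⟩
    length Fs * ∑[ w ∈ Vs n ] ⟦ v ∙ w ≟ᶠ t ⟧             ≡⟨ cong (_* ∑[ w ∈ Vs n ] ⟦ v ∙ w ≟ᶠ t ⟧) length-Fs ⟩
    q * ∑[ w ∈ Vs n ] ⟦ v ∙ w ≟ᶠ t ⟧                     ≡⟨ hyperplane v (λ v≡0 → a≢0 (cong (0# ∷_) v≡0)) t ⟩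
    q ^ n                                                ∎)
    where open ≡-Reasoning

  -- Linear algebra and hyperplane counts

  private variable
    m n d : ℕ

  +-sub-cancelʳ : (x y : Vec Carrier n) → x +ᵛ y -ᵛ y ≡ x
  +-sub-cancelʳ []      []      = refl
  +-sub-cancelʳ (a ∷ x) (b ∷ y) =
    cong₂ _∷_ (≈⇒≡ (solve 2 (λ a b → a :+ b :- b := a) ≈-refl a b)) (+-sub-cancelʳ x y)

  sub-+-cancelʳ : (x y : Vec Carrier n) → x -ᵛ y +ᵛ y ≡ x
  sub-+-cancelʳ []      []      = refl
  sub-+-cancelʳ (a ∷ x) (b ∷ y) =
    cong₂ _∷_ (≈⇒≡ (solve 2 (λ a b → a :- b :+ b := a) ≈-refl a b)) (sub-+-cancelʳ x y)

  add-sub : (x y : Vec Carrier n) → x +ᵛ (y -ᵛ x) ≡ y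
  add-sub []      []      = refl
  add-sub (a ∷ x) (b ∷ y) =
    cong₂ _∷_ (≈⇒≡ (solve 2 (λ a b → a :+ (b :- a) := b) ≈-refl a b)) (add-sub x y)

  sub-cancelˡ : (x y : Vec Carrier n) → x +ᵛ y -ᵛ x ≡ y
  sub-cancelˡ []      []      = refl
  sub-cancelˡ (a ∷ x) (b ∷ y) =
    cong₂ _∷_ (≈⇒≡ (solve 2 (λ a b → a :+ b :- a := b) ≈-refl a b)) (sub-cancelˡ x y)

  +-identityʳᵛ : (x : Vec Carrier n) → x +ᵛ 0ᵛ ≡ x
  +-identityʳᵛ []      = refl
  +-identityʳᵛ (a ∷ x) = cong₂ _∷_ (≈⇒≡ (solve 1 (λ a → a :+ :0 := a) ≈-refl a)) (+-identityʳᵛ x)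

  +-identityˡᵛ : (x : Vec Carrier n) → 0ᵛ +ᵛ x ≡ x
  +-identityˡᵛ []      = refl
  +-identityˡᵛ (a ∷ x) = cong₂ _∷_ (≈⇒≡ (solve 1 (λ a → :0 :+ a := a) ≈-refl a)) (+-identityˡᵛ x)

  +-assocᵛ : (x y z : Vec Carrier n) → x +ᵛ y +ᵛ z ≡ x +ᵛ (y +ᵛ z)
  +-assocᵛ []      []      []      = refl
  +-assocᵛ (a ∷ x) (b ∷ y) (c ∷ z) =
    cong₂ _∷_ (≈⇒≡ (solve 3 (λ a b c → a :+ b :+ c := a :+ (b :+ c)) ≈-refl a b c)) (+-assocᵛ x y z)

  x-y≡0ᵛ⇒x≡y : {x y : Vec Carrier n} → x -ᵛ y ≡ 0ᵛ → x ≡ y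
  x-y≡0ᵛ⇒x≡y {x = x} {y} p = trans (sym (sub-+-cancelʳ x y)) (trans (cong (_+ᵛ y) p) (+-identityˡᵛ y))

  ·-zeroˡ : (x : Vec Carrier n) → 0# · x ≡ 0ᵛ
  ·-zeroˡ []      = refl
  ·-zeroˡ (a ∷ x) = cong₂ _∷_ (≈⇒≡ (solve 1 (λ a → :0 :* a := :0) ≈-refl a)) (·-zeroˡ x)

  ·-zeroʳ : (r : Carrier) → r · 0ᵛ {n} ≡ 0ᵛ
  ·-zeroʳ {zero}  r = refl
  ·-zeroʳ {suc n} r = cong₂ _∷_ (*ᶠ-zeroʳ r) (·-zeroʳ r)

  ·-assoc : (r s : Carrier) (x : Vec Carrier n) → r · (s · x) ≡ (r *ᶠ s) · x
  ·-assoc r s []      = refl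
  ·-assoc r s (a ∷ x) = cong₂ _∷_ (*ᶠ-assoc r s a) (·-assoc r s x)

  ·-inv-cancelˡ : ∀ {r} (r≢0 : r ≢ 0#) (x : Vec Carrier n) → inv r≢0 · (r · x) ≡ x
  ·-inv-cancelˡ r≢0 []      = refl
  ·-inv-cancelˡ r≢0 (a ∷ x) = cong₂ _∷_ (inv-cancelˡ r≢0 a) (·-inv-cancelˡ r≢0 x)

  ·-inv-cancelʳ : ∀ {r} (r≢0 : r ≢ 0#) (x : Vec Carrier n) → r · (inv r≢0 · x) ≡ x
  ·-inv-cancelʳ r≢0 []      = refl
  ·-inv-cancelʳ r≢0 (a ∷ x) = cong₂ _∷_ (inv-cancelʳ r≢0 a) (·-inv-cancelʳ r≢0 x)

  ∙-comm : (x y : Vec Carrier n) → x ∙ y ≡ y ∙ x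
  ∙-comm []      []      = refl
  ∙-comm (a ∷ x) (b ∷ y) = cong₂ _+ᶠ_ (*ᶠ-comm a b) (∙-comm x y)

  ∙-zeroʳ : (x : Vec Carrier n) → x ∙ 0ᵛ ≡ 0#
  ∙-zeroʳ []      = refl
  ∙-zeroʳ (a ∷ x) = trans (cong (a *ᶠ 0# +ᶠ_) (∙-zeroʳ x)) (≈⇒≡ (solve 1 (λ a → a :* :0 :+ :0 := :0) ≈-refl a))

  ∙-distribˡ-+ : (x y z : Vec Carrier n) → x ∙ (y +ᵛ z) ≡ x ∙ y +ᶠ x ∙ z
  ∙-distribˡ-+ []      []      []      = ≈⇒≡ (solve 0 (:0 := :0 :+ :0) ≈-refl)
  ∙-distribˡ-+ (a ∷ x) (b ∷ y) (c ∷ z) = trans (cong (a *ᶠ (b +ᶠ c) +ᶠ_) (∙-distribˡ-+ x y z))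
    (≈⇒≡ (solve 5 (λ a b c s t → a :* (b :+ c) :+ (s :+ t) := a :* b :+ s :+ (a :* c :+ t)) ≈-refl a b c (x ∙ y) (x ∙ z)))

  ∙-distribʳ-+ : (x y z : Vec Carrier n) → (x +ᵛ y) ∙ z ≡ x ∙ z +ᶠ y ∙ z
  ∙-distribʳ-+ x y z = trans (∙-comm (x +ᵛ y) z) (trans (∙-distribˡ-+ z x y) (cong₂ _+ᶠ_ (∙-comm z x) (∙-comm z y)))

  ∙-distribˡ-sub : (x y z : Vec Carrier n) → x ∙ (y -ᵛ z) ≡ x ∙ y -ᶠ x ∙ z
  ∙-distribˡ-sub []      []      []      = ≈⇒≡ (solve 0 (:0 := :0 :- :0) ≈-refl)
  ∙-distribˡ-sub (a ∷ x) (b ∷ y) (c ∷ z) = trans (cong (a *ᶠ (b -ᶠ c) +ᶠ_) (∙-distribˡ-sub x y z))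
    (≈⇒≡ (solve 5 (λ a b c s t → a :* (b :- c) :+ (s :- t) := a :* b :+ s :- (a :* c :+ t)) ≈-refl a b c (x ∙ y) (x ∙ z)))

  ∙-distribʳ-sub : (x y z : Vec Carrier n) → (x -ᵛ y) ∙ z ≡ x ∙ z -ᶠ y ∙ z
  ∙-distribʳ-sub x y z = trans (∙-comm (x -ᵛ y) z) (trans (∙-distribˡ-sub z x y) (cong₂ _-ᶠ_ (∙-comm z x) (∙-comm z y)))

  ∙-·ʳ : (x : Vec Carrier n) (r : Carrier) (y : Vec Carrier n) → x ∙ (r · y) ≡ r *ᶠ (x ∙ y)
  ∙-·ʳ []      r []      = sym (*ᶠ-zeroʳ r)
  ∙-·ʳ (a ∷ x) r (b ∷ y) = trans (cong (a *ᶠ (r *ᶠ b) +ᶠ_) (∙-·ʳ x r y))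
    (≈⇒≡ (solve 4 (λ a r b s → a :* (r :* b) :+ r :* s := r :* (a :* b :+ s)) ≈-refl a r b (x ∙ y)))

  Q : Vec Carrier n → Carrier
  Q v = ‖_‖ F v

  Q-+ : (x y : Vec Carrier n) → Q (x +ᵛ y) ≡ Q x +ᶠ (x ∙ y +ᶠ x ∙ y) +ᶠ Q y
  Q-+ []      []      = ≈⇒≡ (solve 0 (:0 := :0 :+ (:0 :+ :0) :+ :0) ≈-refl)
  Q-+ (a ∷ x) (b ∷ y) = trans (cong ((a +ᶠ b) *ᶠ (a +ᶠ b) +ᶠ_) (Q-+ x y))
    (≈⇒≡ (solve 5 (λ a b s t u →
      (a :+ b) :* (a :+ b) :+ (s :+ (t :+ t) :+ u) :=
      a :* a :+ s :+ (a :* b :+ t :+ (a :* b :+ t)) :+ (b :* b :+ u)) ≈-refl a b (Q x) (x ∙ y) (Q y)))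

  Q-· : (r : Carrier) (x : Vec Carrier n) → Q (r · x) ≡ r *ᶠ r *ᶠ Q x
  Q-· r []      = sym (*ᶠ-zeroʳ _)
  Q-· r (a ∷ x) = trans (cong (r *ᶠ a *ᶠ (r *ᶠ a) +ᶠ_) (Q-· r x))
    (≈⇒≡ (solve 3 (λ r a s → r :* a :* (r :* a) :+ r :* r :* s := r :* r :* (a :* a :+ s)) ≈-refl r a (Q x)))

  lin : Vec Carrier m → Vec (Vec Carrier d) m → Vec Carrier d
  lin []      []      = 0ᵛ
  lin (c ∷ s) (b ∷ B) = c · b +ᵛ lin s B

  lin-+ : (s t : Vec Carrier m) (B : Vec (Vec Carrier d) m) → lin (s +ᵛ t) B ≡ lin s B +ᵛ lin t B
  lin-+ []      []      []      = sym (+-identityˡᵛ 0ᵛ)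
  lin-+ (a ∷ s) (c ∷ t) (b ∷ B) = trans (cong ((a +ᶠ c) · b +ᵛ_) (lin-+ s t B)) (regroup b (lin s B) (lin t B))
    where
    regroup : ∀ {n} (x y z : Vec Carrier n) → (a +ᶠ c) · x +ᵛ (y +ᵛ z) ≡ a · x +ᵛ y +ᵛ (c · x +ᵛ z)
    regroup []       []       []       = refl
    regroup (x ∷ xs) (y ∷ ys) (z ∷ zs) = cong₂ _∷_
      (≈⇒≡ (solve 5 (λ a c x y z → (a :+ c) :* x :+ (y :+ z) := a :* x :+ y :+ (c :* x :+ z)) ≈-refl a c x y z))
      (regroup xs ys zs)

  lin-· : (r : Carrier) (s : Vec Carrier m) (B : Vec (Vec Carrier d) m) → lin (r · s) B ≡ r · lin s B
  lin-· r []      []      = sym (·-zeroʳ r)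
  lin-· r (a ∷ s) (b ∷ B) = trans (cong ((r *ᶠ a) · b +ᵛ_) (lin-· r s B)) (regroup b (lin s B))
    where
    regroup : ∀ {n} (x y : Vec Carrier n) → (r *ᶠ a) · x +ᵛ r · y ≡ r · (a · x +ᵛ y)
    regroup []       []       = refl
    regroup (x ∷ xs) (y ∷ ys) = cong₂ _∷_
      (≈⇒≡ (solve 4 (λ r a x y → (r :* a) :* x :+ r :* y := r :* (a :* x :+ y)) ≈-refl r a x y)) (regroup xs ys)

  lin-0 : (B : Vec (Vec Carrier d) m) → lin 0ᵛ B ≡ 0ᵛ
  lin-0 {m = m} B = trans (cong (λ s → lin s B) (sym (·-zeroˡ 0ᵛ))) (trans (lin-· 0# (0ᵛ {m}) B) (·-zeroˡ _))

  lin-sub : (s t : Vec Carrier m) (B : Vec (Vec Carrier d) m) → lin (s -ᵛ t) B ≡ lin s B -ᵛ lin t B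
  lin-sub s t B = begin
    lin (s -ᵛ t) B                        ≡⟨ +-sub-cancelʳ _ (lin t B) ⟨
    lin (s -ᵛ t) B +ᵛ lin t B -ᵛ lin t B  ≡⟨ cong (_-ᵛ lin t B) (lin-+ (s -ᵛ t) t B) ⟨
    lin (s -ᵛ t +ᵛ t) B -ᵛ lin t B        ≡⟨ cong (λ w → lin w B -ᵛ lin t B) (sub-+-cancelʳ s t) ⟩
    lin s B -ᵛ lin t B                    ∎
    where open ≡-Reasoning

  ∙-lin : (u : Vec Carrier d) (s : Vec Carrier m) (B : Vec (Vec Carrier d) m) → u ∙ lin s B ≡ Vec.map (u ∙_) B ∙ s
  ∙-lin u []      []      = ∙-zeroʳ u
  ∙-lin u (a ∷ s) (b ∷ B) = begin
    u ∙ (a · b +ᵛ lin s B)                    ≡⟨ ∙-distribˡ-+ u (a · b) (lin s B) ⟩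
    u ∙ (a · b) +ᶠ u ∙ lin s B                ≡⟨ cong₂ _+ᶠ_ (trans (∙-·ʳ u a b) (*ᶠ-comm a _)) (∙-lin u s B) ⟩
    (u ∙ b) *ᶠ a +ᶠ Vec.map (u ∙_) B ∙ s      ∎
    where open ≡-Reasoning

  Independent : Vec (Vec Carrier d) m → Set
  Independent B = ∀ s → lin s B ≡ 0ᵛ → s ≡ 0ᵛ

  lin-injective : {B : Vec (Vec Carrier d) m} → Independent B → ∀ {s t} → lin s B ≡ lin t B → s ≡ t
  lin-injective {B = B} indep {s} {t} p = x-y≡0ᵛ⇒x≡y (indep (s -ᵛ t) (trans (lin-sub s t B)
    (trans (cong (_-ᵛ lin t B) p) (trans (cong (_-ᵛ lin t B) (sym (+-identityˡᵛ _))) (+-sub-cancelʳ 0ᵛ (lin t B))))))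

  extend-independent : {B : Vec (Vec Carrier d) m} {z : Vec Carrier d} →
    Independent B → (∀ s → lin s B ≢ z) → Independent (z ∷ B)
  extend-independent {B = B} {z} indep z∉ (a ∷ s) p with a ≟ᶠ 0#
  ... | yes refl = cong (0# ∷_) (indep s (trans (sym (+-identityˡᵛ _)) (trans (cong (_+ᵛ lin s B) (sym (·-zeroˡ z))) p)))
  ... | no a≢0   = ⊥-elim (z∉ ((-ᶠ inv a≢0) · s) (trans (lin-· (-ᶠ inv a≢0) s B) (isolate z (lin s B) p)))
    where
    isolate : ∀ {n} (x y : Vec Carrier n) → a · x +ᵛ y ≡ 0ᵛ → (-ᶠ inv a≢0) · y ≡ x
    isolate []       []       p = refl
    isolate (x ∷ xs) (y ∷ ys) p = cong₂ _∷_ (begin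
      (-ᶠ inv a≢0) *ᶠ y
        ≡⟨ ≈⇒≡ (solve 4 (λ i a x y → (:- i) :* y := i :* (a :* x) :- i :* (a :* x :+ y)) ≈-refl (inv a≢0) a x y) ⟩
      inv a≢0 *ᶠ (a *ᶠ x) -ᶠ inv a≢0 *ᶠ (a *ᶠ x +ᶠ y)
        ≡⟨ cong₂ (λ s t → s -ᶠ inv a≢0 *ᶠ t) (inv-cancelˡ a≢0 x) (Vec.∷-injectiveˡ p) ⟩
      x -ᶠ inv a≢0 *ᶠ 0#
        ≡⟨ ≈⇒≡ (solve 2 (λ x i → x :- i :* :0 := x) ≈-refl x (inv a≢0)) ⟩
      x ∎) (isolate xs ys (Vec.∷-injectiveʳ p))
      where open ≡-Reasoning

  1≤units : 1 ≤ units
  1≤units = ≤-pred (≤-trans 2≤q (≤-reflexive (sym 1+units≡q)))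

  1≤q^ : ∀ k → 1 ≤ q ^ k
  1≤q^ k = ≤-trans (≤-reflexive (sym (^-zeroˡ k))) (^-monoˡ-≤ k (≤-trans (n≤1+n 1) 2≤q))

  -- Double counting of the pairs (u, s) with u ∙ lin s B ≡ β ∙ s.
  fibre-bound : {B : Vec (Vec Carrier d) m} → Independent B → (β : Vec Carrier m) →
    q ^ m * ∑[ u ∈ Vs d ] ⟦ Vec.map (u ∙_) B ≟ᵛ β ⟧ ≤ q ^ d
  fibre-bound {d} {m} {B} indep β = *-cancelʳ-≤ _ _ units (+-cancelˡ-≤ (q ^ m * q ^ d) _ _ (begin
    q ^ m * q ^ d + q ^ m * ∑[ u ∈ Vs d ] h u * units
      ≡⟨ collect (q ^ m) (q ^ d) units (∑[ u ∈ Vs d ] h u) ⟩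
    q ^ m * (q ^ d + units * ∑[ u ∈ Vs d ] h u)
      ≡⟨ cong (q ^ m *_) (trans (∑-+ (Vs d) _ _) (cong₂ _+_ (trans (∑-one (Vs d)) (length-Vs d)) (∑-*ˡ (Vs d) units h))) ⟨
    q ^ m * ∑[ u ∈ Vs d ] (1 + units * h u)
      ≡⟨ ∑-*ˡ (Vs d) (q ^ m) _ ⟨
    ∑[ u ∈ Vs d ] (q ^ m * (1 + units * h u))
      ≤⟨ ∑-mono (Vs d) by-point ⟩
    ∑[ u ∈ Vs d ] (q * ∑[ s ∈ Vs m ] incident u s)
      ≡⟨ trans (∑-*ˡ (Vs d) q _) (cong (q *_) (∑-swap (Vs d) (Vs m) incident)) ⟩
    q * ∑[ s ∈ Vs m ] ∑[ u ∈ Vs d ] incident u s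
      ≡⟨ ∑-*ˡ (Vs m) q _ ⟨
    ∑[ s ∈ Vs m ] (q * ∑[ u ∈ Vs d ] incident u s)
      ≤⟨ ∑-mono (Vs m) by-hyperplane ⟩
    ∑[ s ∈ Vs m ] (q ^ d + q ^ d * units * ⟦ s ≟ᵛ 0ᵛ ⟧)
      ≡⟨ trans (∑-+ (Vs m) _ _) (cong₂ _+_ (trans (∑-const (Vs m) _) (cong (_* q ^ d) (length-Vs m)))
           (trans (∑-*ˡ (Vs m) (q ^ d * units) _) (trans (cong (q ^ d * units *_) (Enumeration.once (vectors scalars m) 0ᵛ)) (*-identityʳ _)))) ⟩
    q ^ m * q ^ d + q ^ d * units ∎))
    where
    open ≤-Reasoning
    instance
      units≢0 : NonZero units
      units≢0 = Data.Nat.>-nonZero 1≤units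
    h : Vec Carrier d → ℕ
    h u = ⟦ Vec.map (u ∙_) B ≟ᵛ β ⟧
    incident : Vec Carrier d → Vec Carrier m → ℕ
    incident u s = ⟦ u ∙ lin s B ≟ᶠ β ∙ s ⟧
    collect : ∀ a b c x → a * b + a * x * c ≡ a * (b + c * x)
    collect = solve-∀
    q+ : ∀ a → a + a * units * 1 ≡ q * a
    q+ a = trans (cong (a +_) (*-identityʳ _)) (trans (cong (a +_) (*-comm a units)) (cong (_* a) 1+units≡q))
    -- A point in the fibre meets the condition for all q^m vectors s. Any other point satisfies a
    -- nontrivial linear equation in s, hence meets it for q^(m-1) of them. Both cases are q^m (1 +
    -- (q-1) h u) after multiplication by q.
    by-point : ∀ u → q ^ m * (1 + units * h u) ≤ q * ∑[ s ∈ Vs m ] incident u s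
    by-point u with Vec.map (u ∙_) B ≟ᵛ β
    ... | yes p = ≤-reflexive (begin-equality
      q ^ m * (1 + units * 1)                  ≡⟨ trans (cong (λ x → q ^ m * suc x) (*-identityʳ units)) (cong (q ^ m *_) 1+units≡q) ⟩
      q ^ m * q                                ≡⟨ *-comm (q ^ m) q ⟩
      q * q ^ m                                ≡⟨ cong (q *_) (trans (sym (length-Vs m)) (sym (∑-one (Vs m)))) ⟩
      q * ∑ (Vs m) (λ _ → 1)                   ≡⟨ cong (q *_) (∑-cong (Vs m) (λ s → ⟦⟧-yes (u ∙ lin s B ≟ᶠ β ∙ s)
                                                    (trans (∙-lin u s B) (cong (_∙ s) p)))) ⟨
      q * ∑[ s ∈ Vs m ] incident u s           ∎)
    ... | no ≢β = ≤-reflexive (begin-equality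
      q ^ m * (1 + units * 0)                  ≡⟨ cong (λ x → q ^ m * (1 + x)) (*-zeroʳ units) ⟩
      q ^ m * 1                                ≡⟨ *-identityʳ _ ⟩
      q ^ m                                    ≡⟨ hyperplane (Vec.map (u ∙_) B -ᵛ β) (≢β ∘ x-y≡0ᵛ⇒x≡y) 0# ⟨
      q * ∑[ s ∈ Vs m ] ⟦ (Vec.map (u ∙_) B -ᵛ β) ∙ s ≟ᶠ 0# ⟧
                                               ≡⟨ cong (q *_) (∑-cong (Vs m) (λ s → ⟦⟧-cong _ _
                                                    (λ r → trans (∙-lin u s B) (x-y≡0⇒x≡y (trans (sym (∙-distribʳ-sub (Vec.map (u ∙_) B) β s)) r)))
                                                    (λ r → trans (∙-distribʳ-sub (Vec.map (u ∙_) B) β s) (x≡y⇒x-y≡0 (trans (sym (∙-lin u s B)) r))))) ⟩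
      q * ∑[ s ∈ Vs m ] incident u s           ∎)
    by-hyperplane : ∀ s → q * ∑[ u ∈ Vs d ] incident u s ≤ q ^ d + q ^ d * units * ⟦ s ≟ᵛ 0ᵛ ⟧
    by-hyperplane s with s ≟ᵛ 0ᵛ
    ... | yes _ = begin
      q * ∑[ u ∈ Vs d ] incident u s  ≤⟨ *-monoʳ-≤ q (∑-bound (Vs d) 1 (λ u _ → ⟦⟧≤1 (u ∙ lin s B ≟ᶠ β ∙ s))) ⟩
      q * (length (Vs d) * 1)         ≡⟨ cong (q *_) (trans (*-identityʳ _) (length-Vs d)) ⟩
      q * q ^ d                       ≡⟨ q+ (q ^ d) ⟨
      q ^ d + q ^ d * units * 1       ∎
    ... | no s≢0 = begin
      q * ∑[ u ∈ Vs d ] incident u s                 ≡⟨ cong (q *_) (∑-cong (Vs d) (λ u → cong (λ x → ⟦ x ≟ᶠ β ∙ s ⟧) (∙-comm u (lin s B)))) ⟩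
      q * ∑[ u ∈ Vs d ] ⟦ lin s B ∙ u ≟ᶠ β ∙ s ⟧     ≡⟨ hyperplane (lin s B) (s≢0 ∘ indep s) (β ∙ s) ⟩
      q ^ d                                          ≤⟨ m≤m+n _ _ ⟩
      q ^ d + q ^ d * units * 0                      ∎

  -- Pairs are fixed first: distinct points are related by at most a hyperplane's worth of v, and on
  -- the diagonal all q^d of them are conceded.
  pair-count : {E : List (Vec Carrier d)} → Unique E → {P : Vec Carrier d → Vec Carrier d → Vec Carrier d → Set}
    (P? : ∀ v x y → Dec (P v x y)) →
    (∀ x y → x ≢ y → q * ∑[ v ∈ Vs d ] ⟦ P? v x y ⟧ ≤ q ^ d) →
    q * ∑[ v ∈ Vs d ] ∑[ x ∈ E ] ∑[ y ∈ E ] ⟦ P? v x y ⟧ ≤ q ^ d * (length E * length E) + length E * (q * q ^ d)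
  pair-count {d} {E} uE P? generic = begin
    q * ∑[ v ∈ Vs d ] ∑[ x ∈ E ] ∑[ y ∈ E ] ⟦ P? v x y ⟧
      ≡⟨ cong (q *_) (trans (∑-swap (Vs d) E _) (∑-cong E (λ x → ∑-swap (Vs d) E _))) ⟩
    q * ∑[ x ∈ E ] ∑[ y ∈ E ] ∑[ v ∈ Vs d ] ⟦ P? v x y ⟧
      ≡⟨ trans (∑-cong E (λ x → ∑-*ˡ E q _)) (∑-*ˡ E q _) ⟨
    ∑[ x ∈ E ] ∑[ y ∈ E ] (q * ∑[ v ∈ Vs d ] ⟦ P? v x y ⟧)
      ≤⟨ ∑-mono E (λ x → ∑-mono E (bound x)) ⟩
    ∑[ x ∈ E ] ∑[ y ∈ E ] (q ^ d + ⟦ y ≟ᵛ x ⟧ * (q * q ^ d))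
      ≡⟨ ∑-cong E (λ x → trans (∑-+ E _ _) (cong₂ _+_ (∑-const E _) (∑-*ʳ E (q * q ^ d) _))) ⟩
    ∑[ x ∈ E ] (length E * q ^ d + ∑[ y ∈ E ] ⟦ y ≟ᵛ x ⟧ * (q * q ^ d))
      ≤⟨ ∑-mono E (λ x → +-monoʳ-≤ (length E * q ^ d) (*-monoˡ-≤ (q * q ^ d) (∑-Unique _≟ᵛ_ uE x))) ⟩
    ∑[ x ∈ E ] (length E * q ^ d + 1 * (q * q ^ d))
      ≡⟨ ∑-const E _ ⟩
    length E * (length E * q ^ d + 1 * (q * q ^ d))
      ≡⟨ arrange (length E) (q ^ d) (q * q ^ d) ⟩
    q ^ d * (length E * length E) + length E * (q * q ^ d) ∎
    where
    open ≤-Reasoning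
    arrange : ∀ n a b → n * (n * a + 1 * b) ≡ a * (n * n) + n * b
    arrange = solve-∀
    bound : ∀ x y → q * ∑[ v ∈ Vs d ] ⟦ P? v x y ⟧ ≤ q ^ d + ⟦ y ≟ᵛ x ⟧ * (q * q ^ d)
    bound x y with y ≟ᵛ x
    ... | no y≢x = ≤-trans (generic x y (y≢x ∘ sym)) (m≤m+n _ _)
    ... | yes _  = begin
      q * ∑[ v ∈ Vs d ] ⟦ P? v x y ⟧  ≤⟨ *-monoʳ-≤ q (∑-bound (Vs d) 1 (λ v _ → ⟦⟧≤1 (P? v x y))) ⟩
      q * (length (Vs d) * 1)         ≡⟨ cong (q *_) (trans (*-identityʳ _) (length-Vs d)) ⟩
      q * q ^ d                       ≤⟨ ≤-trans (m≤m+n (q * q ^ d) 0) (m≤n+m (q * q ^ d + 0) (q ^ d)) ⟩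
      q ^ d + 1 * (q * q ^ d)         ∎

  -- A second moment estimate. Every v reaches the mean term N², so the truncated differences are
  -- exact, and subtracting the means removes the off-diagonal part of `pair-count`. Only the
  -- diagonal N q^(d+1) is left.
  excess-bound : {E : List (Vec Carrier d)} → Unique E → {P : Vec Carrier d → Vec Carrier d → Vec Carrier d → Set}
    (P? : ∀ v x y → Dec (P v x y)) →
    (∀ x y → x ≢ y → q * ∑[ v ∈ Vs d ] ⟦ P? v x y ⟧ ≤ q ^ d) →
    (∀ v → length E * length E ≤ q * ∑[ x ∈ E ] ∑[ y ∈ E ] ⟦ P? v x y ⟧) →
    ∑[ v ∈ Vs d ] (q * ∑[ x ∈ E ] ∑[ y ∈ E ] ⟦ P? v x y ⟧ ∸ length E * length E) ≤ length E * (q * q ^ d)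
  excess-bound {d} {E} uE P? generic lower = +-cancelˡ-≤ (q ^ d * (length E * length E)) _ _ (begin
    q ^ d * (length E * length E) + ∑[ v ∈ Vs d ] (U v ∸ length E * length E)
      ≡⟨ cong (_+ ∑[ v ∈ Vs d ] (U v ∸ length E * length E)) (trans (∑-const (Vs d) _) (cong (_* (length E * length E)) (length-Vs d))) ⟨
    ∑[ v ∈ Vs d ] (length E * length E) + ∑[ v ∈ Vs d ] (U v ∸ length E * length E)
      ≡⟨ ∑-+ (Vs d) _ _ ⟨
    ∑[ v ∈ Vs d ] (length E * length E + (U v ∸ length E * length E))
      ≡⟨ ∑-cong (Vs d) (λ v → m+[n∸m]≡n (lower v)) ⟩
    ∑[ v ∈ Vs d ] U v
      ≡⟨ ∑-*ˡ (Vs d) q _ ⟩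
    q * ∑[ v ∈ Vs d ] ∑[ x ∈ E ] ∑[ y ∈ E ] ⟦ P? v x y ⟧
      ≤⟨ pair-count uE P? generic ⟩
    q ^ d * (length E * length E) + length E * (q * q ^ d) ∎)
    where
    open ≤-Reasoning
    U : Vec Carrier d → ℕ
    U v = q * ∑[ x ∈ E ] ∑[ y ∈ E ] ⟦ P? v x y ⟧

  -- Sumset growth

  Subset : ℕ → Set
  Subset d = Vec Carrier d → Bool

  infix 4 _⊆_
  _⊆_ : Subset d → Subset d → Set
  X ⊆ Y = ∀ v → X v ≡ true → Y v ≡ true

  card : Subset d → ℕ
  card {d} X = ∑[ v ∈ Vs d ] 𝟙 (X v)

  card-mono : {X Y : Subset d} → X ⊆ Y → card X ≤ card Y
  card-mono {d} X⊆Y = ∑-mono (Vs d) (λ v → 𝟙-mono (X⊆Y v))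

  card-shift : (X : Subset d) (c : Vec Carrier d) → ∑[ v ∈ Vs d ] 𝟙 (X (v -ᵛ c)) ≡ card X
  card-shift {d} X c =
    Enumeration.reindex (vectors scalars d) (_-ᵛ c) (_+ᵛ c) (λ v → sub-+-cancelʳ v c) (λ v → +-sub-cancelʳ v c) (𝟙 ∘ X)

  infixl 6 _⊞_
  -- The asymmetry is deliberate: the left summand is a predicate, so cardinalities are sums without
  -- repetitions, while the right one is a list, on which `petridis` runs its induction.
  _⊞_ : Subset d → List (Vec Carrier d) → Subset d
  (X ⊞ C) v = any (λ c → X (v -ᵛ c)) C

  ⊞⁺ : (X : Subset d) {C : List (Vec Carrier d)} {c v : Vec Carrier d} →
    c ∈ C → X (v -ᵛ c) ≡ true → (X ⊞ C) v ≡ true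
  ⊞⁺ X {v = v} = any⁺ (λ c → X (v -ᵛ c))

  ⊞⁻ : (X : Subset d) (C : List (Vec Carrier d)) {v : Vec Carrier d} →
    (X ⊞ C) v ≡ true → ∃ λ c → c ∈ C × X (v -ᵛ c) ≡ true
  ⊞⁻ X C {v} = any⁻ (λ c → X (v -ᵛ c)) C

  -- The ratio |Y + E| / |Y| is least at Y = X, multiplied out so that the empty Y needs no
  -- exception.
  MinimalGrowth : List (Vec Carrier d) → Subset d → Set
  MinimalGrowth E X = ∀ Y → Y ⊆ X → card (X ⊞ E) * card Y ≤ card (Y ⊞ E) * card X

  module _ {E : List (Vec Carrier d)} {X : Subset d} (minimal : MinimalGrowth E X) where

    -- Petridis: adjoining c to C, the points of X whose translates X + E + c are already
    -- covered form a subset Y of X, which grows at least as fast as X does.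
    petridis : ∀ C → card (X ⊞ E ⊞ C) * card X ≤ card (X ⊞ E) * card (X ⊞ C)
    petridis []      = ≤-trans (≤-reflexive (cong (_* card X) (∑-zero (Vs d)))) z≤n
    petridis (c ∷ C) = +-cancelʳ-≤ (card (X ⊞ E) * card Y) _ _ (begin
      card (X ⊞ E ⊞ (c ∷ C)) * card X + card (X ⊞ E) * card Y
        ≤⟨ +-monoʳ-≤ (card (X ⊞ E ⊞ (c ∷ C)) * card X) (minimal Y Y⊆X) ⟩
      card (X ⊞ E ⊞ (c ∷ C)) * card X + card (Y ⊞ E) * card X
        ≡⟨ *-distribʳ-+ (card X) (card (X ⊞ E ⊞ (c ∷ C))) _ ⟨
      (card (X ⊞ E ⊞ (c ∷ C)) + card (Y ⊞ E)) * card X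
        ≤⟨ *-monoˡ-≤ (card X) union-bound ⟩
      (card (X ⊞ E) + card T) * card X
        ≡⟨ *-distribʳ-+ (card X) (card (X ⊞ E)) _ ⟩
      card (X ⊞ E) * card X + card T * card X
        ≤⟨ +-monoʳ-≤ (card (X ⊞ E) * card X) (petridis C) ⟩
      card (X ⊞ E) * card X + card (X ⊞ E) * card (X ⊞ C)
        ≡⟨ *-distribˡ-+ (card (X ⊞ E)) (card X) _ ⟨
      card (X ⊞ E) * (card X + card (X ⊞ C))
        ≤⟨ *-monoʳ-≤ (card (X ⊞ E)) sum-bound ⟩
      card (X ⊞ E) * (card (X ⊞ (c ∷ C)) + card Y)
        ≡⟨ *-distribˡ-+ (card (X ⊞ E)) _ (card Y) ⟩
      card (X ⊞ E) * card (X ⊞ (c ∷ C)) + card (X ⊞ E) * card Y ∎)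
      where
      open ≤-Reasoning
      T : Subset d
      T = X ⊞ E ⊞ C
      Y : Subset d
      Y x = X x ∧ all (λ e → T (x +ᵛ c +ᵛ e)) E
      Y⇒X∧T : ∀ x → Y x ≡ true → X x ≡ true × (∀ e → e ∈ E → T (x +ᵛ c +ᵛ e) ≡ true)
      Y⇒X∧T x h with X x
      ... | true = refl , λ e → all⁻ (λ e → T (x +ᵛ c +ᵛ e)) h
      Y⊆X : Y ⊆ X
      Y⊆X x h = proj₁ (Y⇒X∧T x h)
      reassociate : ∀ {n} (v c e : Vec Carrier n) → v -ᵛ c -ᵛ e +ᵛ c +ᵛ e ≡ v
      reassociate []      []      []      = refl
      reassociate (x ∷ v) (y ∷ c) (z ∷ e) =
        cong₂ _∷_ (≈⇒≡ (solve 3 (λ x y z → x :- y :- z :+ y :+ z := x) ≈-refl x y z)) (reassociate v c e)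
      swap-sub : ∀ {n} (v e c : Vec Carrier n) → v +ᵛ e -ᵛ c -ᵛ e ≡ v -ᵛ c
      swap-sub []      []      []      = refl
      swap-sub (x ∷ v) (y ∷ e) (z ∷ c) =
        cong₂ _∷_ (≈⇒≡ (solve 3 (λ x y z → x :+ y :- z :- y := x :- z) ≈-refl x y z)) (swap-sub v e c)
      -- A point of Y + E + c lies in X + E + c and, by the definition of Y, also in T, so the right
      -- side counts it twice.
      union-point : ∀ v → 𝟙 ((X ⊞ E) (v -ᵛ c) ∨ T v) + 𝟙 ((Y ⊞ E) (v -ᵛ c)) ≤ 𝟙 ((X ⊞ E) (v -ᵛ c)) + 𝟙 (T v)
      union-point v with (Y ⊞ E) (v -ᵛ c) in y
      ... | true with ⊞⁻ Y E y
      ...   | e , e∈E , Yv with Y⇒X∧T _ Yv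
      ...     | Xv , Tv rewrite ⊞⁺ X {v = v -ᵛ c} e∈E Xv | trans (cong T (sym (reassociate v c e))) (Tv e e∈E) = ≤-refl
      union-point v | false with (X ⊞ E) (v -ᵛ c) | T v
      ... | true  | _     = s≤s z≤n
      ... | false | true  = ≤-refl
      ... | false | false = z≤n
      union-bound : card (X ⊞ E ⊞ (c ∷ C)) + card (Y ⊞ E) ≤ card (X ⊞ E) + card T
      union-bound = begin
        card (X ⊞ E ⊞ (c ∷ C)) + card (Y ⊞ E)
          ≡⟨ cong (card (X ⊞ E ⊞ (c ∷ C)) +_) (card-shift (Y ⊞ E) c) ⟨
        card (X ⊞ E ⊞ (c ∷ C)) + ∑[ v ∈ Vs d ] 𝟙 ((Y ⊞ E) (v -ᵛ c))
          ≡⟨ ∑-+ (Vs d) _ _ ⟨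
        ∑[ v ∈ Vs d ] (𝟙 ((X ⊞ E) (v -ᵛ c) ∨ T v) + 𝟙 ((Y ⊞ E) (v -ᵛ c)))
          ≤⟨ ∑-mono (Vs d) union-point ⟩
        ∑[ v ∈ Vs d ] (𝟙 ((X ⊞ E) (v -ᵛ c)) + 𝟙 (T v))
          ≡⟨ trans (∑-+ (Vs d) _ _) (cong (_+ card T) (card-shift (X ⊞ E) c)) ⟩
        card (X ⊞ E) + card T ∎
      -- If v lies in X + c and in X + c′ with c′ in C, then v + e lies in X + E + c′ for every e in
      -- E, so v - c belongs to Y: the overlap of X + c and X + C is contained in Y + c.
      sum-point : ∀ v → 𝟙 (X (v -ᵛ c)) + 𝟙 ((X ⊞ C) v) ≤ 𝟙 (X (v -ᵛ c) ∨ (X ⊞ C) v) + 𝟙 (Y (v -ᵛ c))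
      sum-point v with X (v -ᵛ c) in Xv | (X ⊞ C) v in XCv
      ... | false | b     = m≤m+n (𝟙 b) _
      ... | true  | false = s≤s z≤n
      ... | true  | true with ⊞⁻ X C XCv
      ...   | c′ , c′∈C , Xc′ = ≤-reflexive (cong (1 +_) (sym (cong 𝟙 covered)))
        where
        covered : all (λ e → T (v -ᵛ c +ᵛ c +ᵛ e)) E ≡ true
        covered = all⁺ _ E (λ e e∈E → ⊞⁺ (X ⊞ E) c′∈C (⊞⁺ X e∈E
          (trans (cong X (trans (cong (λ w → w +ᵛ e -ᵛ c′ -ᵛ e) (sub-+-cancelʳ v c)) (swap-sub v e c′))) Xc′)))
      sum-bound : card X + card (X ⊞ C) ≤ card (X ⊞ (c ∷ C)) + card Y
      sum-bound = begin
        card X + card (X ⊞ C)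
          ≡⟨ cong (_+ card (X ⊞ C)) (card-shift X c) ⟨
        ∑[ v ∈ Vs d ] 𝟙 (X (v -ᵛ c)) + card (X ⊞ C)
          ≡⟨ ∑-+ (Vs d) _ _ ⟨
        ∑[ v ∈ Vs d ] (𝟙 (X (v -ᵛ c)) + 𝟙 ((X ⊞ C) v))
          ≤⟨ ∑-mono (Vs d) sum-point ⟩
        ∑[ v ∈ Vs d ] (𝟙 (X (v -ᵛ c) ∨ (X ⊞ C) v) + 𝟙 (Y (v -ᵛ c)))
          ≡⟨ trans (∑-+ (Vs d) _ _) (cong (card (X ⊞ (c ∷ C)) +_) (card-shift Y c)) ⟩
        card (X ⊞ (c ∷ C)) + card Y ∎

  -- Descent to a subset of smaller ratio as long as one exists. Whether one exists is not decided,
  -- since this would need a search through all subsets; hence the double negation, harmless because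
  -- the result is only used to refute.
  minimal-growth : (E : List (Vec Carrier d)) (α β : ℕ) (X : Subset d) → 0 < card X → card (X ⊞ E) * α ≤ β * card X →
    ¬ ¬ (∃ λ Y → Y ⊆ X × 0 < card Y × card (Y ⊞ E) * α ≤ β * card Y × MinimalGrowth E Y)
  minimal-growth {d} E α β X 0<X growth = descend X 0<X growth (<-wellFounded _)
    where
    descend : ∀ X → 0 < card X → card (X ⊞ E) * α ≤ β * card X → Acc _<_ (card (X ⊞ E)) →
      ¬ ¬ (∃ λ Y → Y ⊆ X × 0 < card Y × card (Y ⊞ E) * α ≤ β * card Y × MinimalGrowth E Y)
    descend X 0<X growth (acc rs) none = none (X , (λ _ h → h) , 0<X , growth , minimal)
      where
      minimal : MinimalGrowth E X
      minimal Y Y⊆X with card (X ⊞ E) * card Y ≤? card (Y ⊞ E) * card X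
      ... | yes p = p
      ... | no ¬p = ⊥-elim (descend Y 0<Y growth′ (rs shrinks)
        (λ { (Z , Z⊆Y , rest) → none (Z , (λ v → Y⊆X v ∘ Z⊆Y v) , rest) }))
        where
        slower : card (Y ⊞ E) * card X < card (X ⊞ E) * card Y
        slower = ≰⇒> ¬p
        0<Y : 0 < card Y
        0<Y = n≢0⇒n>0 (λ Y≡0 → n≮0 (subst (card (Y ⊞ E) * card X <_) (trans (cong (card (X ⊞ E) *_) Y≡0) (*-zeroʳ (card (X ⊞ E)))) slower))
        -- A smaller ratio on a subset forces a smaller sumset: |Y+E| |X| < |X+E| |Y| ≤ |X+E| |X|.
        -- This natural number is the measure of the descent.
        shrinks : card (Y ⊞ E) < card (X ⊞ E)
        shrinks = *-cancelʳ-< (card X) _ _ (<-≤-trans slower (*-monoʳ-≤ (card (X ⊞ E)) (card-mono Y⊆X)))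
        instance
          X≢0 : NonZero (card X)
          X≢0 = >-nonZero 0<X
        open ≤-Reasoning
        swapʳ : ∀ a b c → a * b * c ≡ a * c * b
        swapʳ = solve-∀
        growth′ : card (Y ⊞ E) * α ≤ β * card Y
        growth′ = *-cancelʳ-≤ _ _ (card X) (begin
          card (Y ⊞ E) * α * card X    ≡⟨ swapʳ (card (Y ⊞ E)) α (card X) ⟩
          card (Y ⊞ E) * card X * α    ≤⟨ *-monoˡ-≤ α (<⇒≤ slower) ⟩
          card (X ⊞ E) * card Y * α    ≡⟨ swapʳ (card (X ⊞ E)) (card Y) α ⟩
          card (X ⊞ E) * α * card Y    ≤⟨ *-monoˡ-≤ (card Y) growth ⟩
          β * card X * card Y          ≡⟨ swapʳ β (card X) (card Y) ⟩
          β * card Y * card X          ∎)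

  module OddCharacteristic (char≢2 : CharNot2 F) where

    -- Incidences and rich directions

    half : Carrier
    half = inv (char≢2 ∘ ≡⇒≈)

    halve : ∀ x → half *ᶠ (x +ᶠ x) ≡ x
    halve x = trans (cong (half *ᶠ_) (≈⇒≡ (solve 1 (λ x → x :+ x := (:1 :+ :1) :* x) ≈-refl x))) (inv-cancelˡ (char≢2 ∘ ≡⇒≈) x)

    -- Expanding both norms cancels Q w, so for fixed y and y′ a collision is an affine linear
    -- condition on w. Isolating the inner product takes division by 2.
    polar : ∀ {n} (w y y′ : Vec Carrier n) → Q (w +ᵛ y) ≡ Q (w +ᵛ y′) → (y′ -ᵛ y) ∙ w ≡ half *ᶠ (Q y -ᶠ Q y′)
    polar w y y′ p = begin
      (y′ -ᵛ y) ∙ w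
        ≡⟨ trans (∙-comm _ w) (∙-distribˡ-sub w y′ y) ⟩
      w ∙ y′ -ᶠ w ∙ y
        ≡⟨ halve _ ⟨
      half *ᶠ (w ∙ y′ -ᶠ w ∙ y +ᶠ (w ∙ y′ -ᶠ w ∙ y))
        ≡⟨ cong (half *ᶠ_) (≈⇒≡ (solve 5 (λ s t u v v′ →
             t :- s :+ (t :- s) := u :+ (t :+ t) :+ v′ :- (u :+ (s :+ s) :+ v) :+ (v :- v′)) ≈-refl
             (w ∙ y) (w ∙ y′) (Q w) (Q y) (Q y′))) ⟩
      half *ᶠ (Q w +ᶠ (w ∙ y′ +ᶠ w ∙ y′) +ᶠ Q y′ -ᶠ (Q w +ᶠ (w ∙ y +ᶠ w ∙ y) +ᶠ Q y) +ᶠ (Q y -ᶠ Q y′))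
        ≡⟨ cong (λ x → half *ᶠ (x +ᶠ (Q y -ᶠ Q y′))) (x≡y⇒x-y≡0 (trans (sym (Q-+ w y′)) (trans (sym p) (Q-+ w y)))) ⟩
      half *ᶠ (0# +ᶠ (Q y -ᶠ Q y′))
        ≡⟨ cong (half *ᶠ_) (≈⇒≡ (solve 1 (λ x → :0 :+ x := x) ≈-refl (Q y -ᶠ Q y′))) ⟩
      half *ᶠ (Q y -ᶠ Q y′) ∎
      where open ≡-Reasoning

    module PointSet {d : ℕ} (E : List (Vec Carrier d)) (uE : Unique E) where
      N : ℕ
      N = length E

      indicator : Vec Carrier d → ℕ
      indicator w = ∑[ y ∈ E ] ⟦ y ≟ᵛ w ⟧

      open DecMembership (_≟ᵛ_ {d}) using (_∈?_)

      asSubset : Subset d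
      asSubset v = does (v ∈? E)

      asSubset⁻ : ∀ {v} → asSubset v ≡ true → v ∈ E
      asSubset⁻ {v} h with v ∈? E
      ... | yes v∈E = v∈E

      𝟙-asSubset : ∀ v → 𝟙 (asSubset v) ≡ indicator v
      𝟙-asSubset v with v ∈? E
      ... | yes v∈E = ≤-antisym (∑-member _≟ᵛ_ v∈E) (∑-Unique _≟ᵛ_ uE v)
      ... | no v∉E with indicator v in eq
      ...   | zero  = refl
      ...   | suc k = ⊥-elim (v∉E (∑-member⁻ _≟ᵛ_ E (subst (1 ≤_) (sym eq) (s≤s z≤n))))

      card-asSubset : card asSubset ≡ N
      card-asSubset = begin
        card asSubset                         ≡⟨ ∑-cong (Vs d) 𝟙-asSubset ⟩
        ∑[ v ∈ Vs d ] ∑[ y ∈ E ] ⟦ y ≟ᵛ v ⟧   ≡⟨ ∑-swap (Vs d) E _ ⟩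
        ∑[ y ∈ E ] ∑[ v ∈ Vs d ] ⟦ y ≟ᵛ v ⟧   ≡⟨ ∑-cong E (λ y → trans
                                                   (∑-cong (Vs d) (λ v → ⟦⟧-cong (y ≟ᵛ v) (v ≟ᵛ y) sym sym))
                                                   (Enumeration.once (vectors scalars d) y)) ⟩
        ∑ E (λ _ → 1)                         ≡⟨ ∑-one E ⟩
        N                                     ∎
        where open ≡-Reasoning

      sphere-pairs : Vec Carrier d → Vec Carrier d → ℕ
      sphere-pairs s x = ∑[ y ∈ E ] ∑[ y′ ∈ E ] ⟦ Q (s +ᵛ x +ᵛ y) ≟ᶠ Q (s +ᵛ x +ᵛ y′) ⟧

      -- For x in E + E the N points s + x + y take at most q/2 values, so x sees at least 2N²/q
      -- collisions, twice the mean, and has excess at least N². All excesses together are at most N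
      -- q^(d+1), which limits the number of such x.
      sumset-bound : (s : Vec Carrier d) {D : List Carrier} → Unique D → 2 * length D ≤ q → 0 < N →
        (∀ {x₁ x₂ y} → x₁ ∈ E → x₂ ∈ E → y ∈ E → Q (s +ᵛ (x₁ +ᵛ x₂) +ᵛ y) ∈ D) →
        card (asSubset ⊞ E) * N ≤ q * q ^ d
      sumset-bound s {D} uD 2D≤q 0<N values = *-cancelʳ-≤ _ _ N (begin
        card (asSubset ⊞ E) * N * N
          ≡⟨ *-assoc (card (asSubset ⊞ E)) N N ⟩
        card (asSubset ⊞ E) * (N * N)
          ≡⟨ ∑-*ʳ (Vs d) (N * N) _ ⟨
        ∑[ x ∈ Vs d ] (𝟙 ((asSubset ⊞ E) x) * (N * N))
          ≤⟨ ∑-mono (Vs d) popular ⟩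
        ∑[ x ∈ Vs d ] (q * sphere-pairs s x ∸ N * N)
          ≤⟨ excess-bound uE (λ x y y′ → Q (s +ᵛ x +ᵛ y) ≟ᶠ Q (s +ᵛ x +ᵛ y′)) generic lower ⟩
        N * (q * q ^ d)
          ≡⟨ *-comm N (q * q ^ d) ⟩
        q * q ^ d * N ∎)
        where
        open ≤-Reasoning
        instance
          N≢0 : NonZero N
          N≢0 = >-nonZero 0<N
        popular : ∀ x → 𝟙 ((asSubset ⊞ E) x) * (N * N) ≤ q * sphere-pairs s x ∸ N * N
        popular x with (asSubset ⊞ E) x in x∈2E
        ... | false = z≤n
        ... | true with ⊞⁻ asSubset E x∈2E
        ...   | x₂ , x₂∈E , x₁∈E = begin
          1 * (N * N)                            ≡⟨ *-identityˡ _ ⟩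
          N * N                                  ≡⟨ m+n∸n≡m (N * N) (N * N) ⟨
          N * N + N * N ∸ N * N                  ≤⟨ ∸-monoˡ-≤ (N * N) twice ⟩
          q * sphere-pairs s x ∸ N * N           ∎
          where
          value : ∀ y → y ∈ E → Q (s +ᵛ x +ᵛ y) ∈ D
          value y y∈E = subst (λ w → Q (s +ᵛ w +ᵛ y) ∈ D) (sub-+-cancelʳ x x₂) (values (asSubset⁻ x₁∈E) x₂∈E y∈E)
          twice : N * N + N * N ≤ q * sphere-pairs s x
          twice = begin
            N * N + N * N                        ≡⟨ cong (N * N +_) (+-identityʳ _) ⟨
            2 * (N * N)                          ≤⟨ *-monoʳ-≤ 2 (pair-collisions _≟ᶠ_ uD E (λ y → Q (s +ᵛ x +ᵛ y)) value) ⟩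
            2 * (length D * sphere-pairs s x)    ≡⟨ *-assoc 2 (length D) (sphere-pairs s x) ⟨
            2 * length D * sphere-pairs s x      ≤⟨ *-monoˡ-≤ (sphere-pairs s x) 2D≤q ⟩
            q * sphere-pairs s x                 ∎
        lower : ∀ x → N * N ≤ q * sphere-pairs s x
        lower x = subst (λ k → N * N ≤ k * sphere-pairs s x) length-Fs
          (pair-collisions _≟ᶠ_ (Enumeration.unique scalars) E (λ y → Q (s +ᵛ x +ᵛ y)) (λ _ _ → Enumeration.complete scalars _))
        generic : ∀ y y′ → y ≢ y′ → q * ∑[ x ∈ Vs d ] ⟦ Q (s +ᵛ x +ᵛ y) ≟ᶠ Q (s +ᵛ x +ᵛ y′) ⟧ ≤ q ^ d
        generic y y′ y≢y′ = begin
          q * ∑[ x ∈ Vs d ] ⟦ Q (s +ᵛ x +ᵛ y) ≟ᶠ Q (s +ᵛ x +ᵛ y′) ⟧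
            ≤⟨ *-monoʳ-≤ q (∑-mono (Vs d) (λ x → ⟦⟧-mono (Q (s +ᵛ x +ᵛ y) ≟ᶠ Q (s +ᵛ x +ᵛ y′)) (z ∙ x ≟ᶠ k -ᶠ z ∙ s) (on-plane x))) ⟩
          q * ∑[ x ∈ Vs d ] ⟦ z ∙ x ≟ᶠ k -ᶠ z ∙ s ⟧
            ≡⟨ hyperplane z (λ z≡0 → y≢y′ (sym (x-y≡0ᵛ⇒x≡y z≡0))) (k -ᶠ z ∙ s) ⟩
          q ^ d ∎
          where
          z = y′ -ᵛ y
          k = half *ᶠ (Q y -ᶠ Q y′)
          on-plane : ∀ x → Q (s +ᵛ x +ᵛ y) ≡ Q (s +ᵛ x +ᵛ y′) → z ∙ x ≡ k -ᶠ z ∙ s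
          on-plane x p = trans (≈⇒≡ (solve 2 (λ a b → b := a :+ b :- a) ≈-refl (z ∙ s) (z ∙ x)))
            (cong (_-ᶠ z ∙ s) (trans (sym (∙-distribˡ-+ z s x)) (polar (s +ᵛ x) y y′ p)))

      S : Vec Carrier d → ℕ
      S z = ∑[ x ∈ E ] ∑[ x′ ∈ E ] ⟦ x ∙ z ≟ᶠ x′ ∙ z ⟧

      N²≤qS : ∀ z → N * N ≤ q * S z
      N²≤qS z = subst (λ k → N * N ≤ k * S z) length-Fs
        (pair-collisions _≟ᶠ_ (Enumeration.unique scalars) E (_∙ z) (λ _ _ → Enumeration.complete scalars _))

      excess : Vec Carrier d → ℕ
      excess z = q * S z ∸ N * N

      total-excess : ∑[ z ∈ Vs d ] excess z ≤ N * (q * q ^ d)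
      total-excess = excess-bound uE (λ z x y → x ∙ z ≟ᶠ y ∙ z) generic N²≤qS
        where
        generic : ∀ x y → x ≢ y → q * ∑[ z ∈ Vs d ] ⟦ x ∙ z ≟ᶠ y ∙ z ⟧ ≤ q ^ d
        generic x y x≢y = ≤-reflexive (trans
          (cong (q *_) (∑-cong (Vs d) (λ z → ⟦⟧-cong (x ∙ z ≟ᶠ y ∙ z) ((x -ᵛ y) ∙ z ≟ᶠ 0#)
            (λ p → trans (∙-distribʳ-sub x y z) (x≡y⇒x-y≡0 p))
            (λ p → x-y≡0⇒x≡y (trans (sym (∙-distribʳ-sub x y z)) p)))))
          (hyperplane (x -ᵛ y) (x≢y ∘ x-y≡0ᵛ⇒x≡y) 0#))

      S-scale : ∀ {r} → r ≢ 0# → ∀ z → S (r · z) ≡ S z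
      S-scale {r} r≢0 z = ∑-cong E (λ x → ∑-cong E (λ x′ → ⟦⟧-cong (x ∙ (r · z) ≟ᶠ x′ ∙ (r · z)) (x ∙ z ≟ᶠ x′ ∙ z)
        (λ p → trans (sym (inv-cancelˡ r≢0 _)) (trans (cong (inv r≢0 *ᶠ_) (trans (sym (∙-·ʳ x r z)) (trans p (∙-·ʳ x′ r z)))) (inv-cancelˡ r≢0 _)))
        (λ p → trans (∙-·ʳ x r z) (trans (cong (r *ᶠ_) p) (sym (∙-·ʳ x′ r z))))))

      line : Vec Carrier d → Vec Carrier d → ℕ
      line y z = ∑[ t ∈ Fs ] indicator (y +ᵛ t · z)

      line-scale : ∀ {r} → r ≢ 0# → ∀ y z → line y (r · z) ≡ line y z
      line-scale {r} r≢0 y z = trans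
        (∑-cong Fs (λ t → cong (λ w → indicator (y +ᵛ w)) (·-assoc t r z)))
        (Enumeration.reindex scalars (_*ᶠ r) (_*ᶠ inv r≢0)
          (λ t → trans (*ᶠ-comm _ _) (trans (cong (inv r≢0 *ᶠ_) (*ᶠ-comm t r)) (inv-cancelˡ r≢0 t)))
          (λ t → trans (*ᶠ-comm _ r) (trans (cong (r *ᶠ_) (*ᶠ-comm t _)) (inv-cancelʳ r≢0 t)))
          (λ t → indicator (y +ᵛ t · z)))

      -- The threshold is chosen so that the poor directions contribute an excess of at most the
      -- main term N⁴; the factor 2 pays for q ≤ 2(q-1).
      RichAt : Vec Carrier d → Vec Carrier d → Set
      RichAt z y = N * N < 2 * q ^ d * line y z

      Rich : Vec Carrier d → Set
      Rich z = Any (RichAt z) E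

      rich? : ∀ z → Dec (Rich z)
      rich? z = Any.any? (λ y → N * N <? 2 * q ^ d * line y z) E

      poor : Vec Carrier d → ℕ
      poor z = ⟦ ¬? (rich? z) ⟧

      rich-scale : ∀ {r} → r ≢ 0# → ∀ z → Rich z → Rich (r · z)
      rich-scale r≢0 z = Any.map (λ {y} → subst (λ k → N * N < 2 * q ^ d * k) (sym (line-scale r≢0 y z)))

      poor-scale : ∀ {r} → r ≢ 0# → ∀ z → poor (r · z) ≡ poor z
      poor-scale {r} r≢0 z = ⟦⟧-cong (¬? (rich? (r · z))) (¬? (rich? z))
        (λ ¬rich → ¬rich ∘ rich-scale r≢0 z)
        (λ ¬rich → ¬rich ∘ subst Rich (·-inv-cancelˡ r≢0 z) ∘ rich-scale (inv≢0 r≢0) (r · z))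

      poor-excess : Vec Carrier d → ℕ
      poor-excess z = poor z * excess z

      poor-excess-scale : ∀ {r} → r ≢ 0# → ∀ z → poor-excess (r · z) ≡ poor-excess z
      poor-excess-scale r≢0 z = cong₂ _*_ (poor-scale r≢0 z) (cong (λ k → q * k ∸ N * N) (S-scale r≢0 z))

      -- poor-excess is constant on punctured lines through 0, so it can be averaged over them.
      line-average : units * ∑[ y ∈ E ] ∑[ y′ ∈ E ] poor-excess (y′ -ᵛ y) ≤
        ∑[ v ∈ Vs d ] (poor-excess v * ∑[ y ∈ E ] line y v)
      line-average = begin
        units * ∑[ y ∈ E ] ∑[ y′ ∈ E ] poor-excess (y′ -ᵛ y)
          ≡⟨ trans (∑-cong E (λ y → ∑-*ˡ E units _)) (∑-*ˡ E units _) ⟨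
        ∑[ y ∈ E ] ∑[ y′ ∈ E ] (units * poor-excess (y′ -ᵛ y))
          ≤⟨ ∑-mono E (λ y → ∑-mono E (spread y)) ⟩
        ∑[ y ∈ E ] ∑[ y′ ∈ E ] ∑[ v ∈ Vs d ] ∑[ r ∈ Fs ] (⟦ y′ ≟ᵛ y +ᵛ r · v ⟧ * poor-excess v)
          ≡⟨ ∑-cong E (λ y → ∑-swap E (Vs d) _) ⟩
        ∑[ y ∈ E ] ∑[ v ∈ Vs d ] ∑[ y′ ∈ E ] ∑[ r ∈ Fs ] (⟦ y′ ≟ᵛ y +ᵛ r · v ⟧ * poor-excess v)
          ≡⟨ ∑-cong E (λ y → ∑-cong (Vs d) (λ v → trans (∑-swap E Fs _)
               (trans (∑-cong Fs (λ r → ∑-*ʳ E (poor-excess v) _)) (trans (∑-*ʳ Fs (poor-excess v) _) (*-comm _ (poor-excess v)))))) ⟩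
        ∑[ y ∈ E ] ∑[ v ∈ Vs d ] (poor-excess v * line y v)
          ≡⟨ trans (∑-swap E (Vs d) _) (∑-cong (Vs d) (λ v → ∑-*ˡ E (poor-excess v) _)) ⟩
        ∑[ v ∈ Vs d ] (poor-excess v * ∑[ y ∈ E ] line y v) ∎
        where
        open ≤-Reasoning
        -- Each nonzero r writes y′ - y as r · v for exactly one v, and v has the same `poor-excess`
        -- as y′ - y.
        spread : ∀ y y′ → units * poor-excess (y′ -ᵛ y) ≤
          ∑[ v ∈ Vs d ] ∑[ r ∈ Fs ] (⟦ y′ ≟ᵛ y +ᵛ r · v ⟧ * poor-excess v)
        spread y y′ = begin
          units * poor-excess (y′ -ᵛ y)
            ≡⟨ ∑-*ʳ Fs (poor-excess (y′ -ᵛ y)) nonzero ⟨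
          ∑[ r ∈ Fs ] (nonzero r * poor-excess (y′ -ᵛ y))
            ≤⟨ ∑-mono Fs (λ r → nonzero*-≤ r (λ r≢0 → ≤-reflexive (one-scalar r≢0))) ⟩
          ∑[ r ∈ Fs ] ∑[ v ∈ Vs d ] (⟦ y′ ≟ᵛ y +ᵛ r · v ⟧ * poor-excess v)
            ≡⟨ ∑-swap Fs (Vs d) _ ⟩
          ∑[ v ∈ Vs d ] ∑[ r ∈ Fs ] (⟦ y′ ≟ᵛ y +ᵛ r · v ⟧ * poor-excess v) ∎
          where
          one-scalar : ∀ {r} → r ≢ 0# → poor-excess (y′ -ᵛ y) ≡ ∑[ v ∈ Vs d ] (⟦ y′ ≟ᵛ y +ᵛ r · v ⟧ * poor-excess v)
          one-scalar {r} r≢0 = begin-equality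
            poor-excess (y′ -ᵛ y)
              ≡⟨ poor-excess-scale (inv≢0 r≢0) (y′ -ᵛ y) ⟨
            poor-excess (inv r≢0 · (y′ -ᵛ y))
              ≡⟨ Enumeration.pick (vectors scalars d) poor-excess _ ⟨
            ∑[ v ∈ Vs d ] (⟦ v ≟ᵛ inv r≢0 · (y′ -ᵛ y) ⟧ * poor-excess v)
              ≡⟨ ∑-cong (Vs d) (λ v → cong (_* poor-excess v) (⟦⟧-cong (v ≟ᵛ inv r≢0 · (y′ -ᵛ y)) (y′ ≟ᵛ y +ᵛ r · v)
                   (λ { refl → sym (trans (cong (y +ᵛ_) (·-inv-cancelʳ r≢0 _)) (add-sub y y′)) })
                   (λ { refl → sym (trans (cong (inv r≢0 ·_) (sub-cancelˡ y (r · v))) (·-inv-cancelˡ r≢0 v)) }))) ⟩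
            ∑[ v ∈ Vs d ] (⟦ y′ ≟ᵛ y +ᵛ r · v ⟧ * poor-excess v) ∎

      poor-line : ∀ z → poor z * (2 * q ^ d * ∑[ y ∈ E ] line y z) ≤ poor z * (N * (N * N))
      poor-line z = ⟦⟧*-mono (¬? (rich? z)) (λ ¬rich → begin
        2 * q ^ d * ∑[ y ∈ E ] line y z    ≡⟨ ∑-*ˡ E (2 * q ^ d) _ ⟨
        ∑[ y ∈ E ] (2 * q ^ d * line y z)  ≤⟨ ∑-bound E (N * N) (λ y y∈E → ≮⇒≥ (¬rich ∘ lose y∈E)) ⟩
        N * (N * N)                        ∎)
        where open ≤-Reasoning

      -- In a poor direction every line through a point of E has at most N²/2q^d points. Inserting
      -- this in `line-average` leaves `total-excess`, and N q^(d+1) · N³/2q^d is at most (q-1) N⁴.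
      poor-excess-sum : ∑[ y ∈ E ] ∑[ y′ ∈ E ] poor-excess (y′ -ᵛ y) ≤ N * N * (N * N)
      poor-excess-sum = *-cancelˡ-≤ (2 * q ^ d * units) (begin
        2 * q ^ d * units * ∑[ y ∈ E ] ∑[ y′ ∈ E ] poor-excess (y′ -ᵛ y)
          ≡⟨ *-assoc (2 * q ^ d) units _ ⟩
        2 * q ^ d * (units * ∑[ y ∈ E ] ∑[ y′ ∈ E ] poor-excess (y′ -ᵛ y))
          ≤⟨ *-monoʳ-≤ (2 * q ^ d) line-average ⟩
        2 * q ^ d * ∑[ v ∈ Vs d ] (poor-excess v * ∑[ y ∈ E ] line y v)
          ≡⟨ ∑-*ˡ (Vs d) (2 * q ^ d) _ ⟨
        ∑[ v ∈ Vs d ] (2 * q ^ d * (poor-excess v * ∑[ y ∈ E ] line y v))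
          ≤⟨ ∑-mono (Vs d) pointwise ⟩
        ∑[ v ∈ Vs d ] (excess v * (N * (N * N)))
          ≡⟨ ∑-*ʳ (Vs d) (N * (N * N)) excess ⟩
        ∑ (Vs d) excess * (N * (N * N))
          ≤⟨ *-monoˡ-≤ (N * (N * N)) total-excess ⟩
        N * (q * q ^ d) * (N * (N * N))
          ≤⟨ *-monoˡ-≤ (N * (N * N)) (*-monoʳ-≤ N (*-monoˡ-≤ (q ^ d) q≤2units)) ⟩
        N * (2 * units * q ^ d) * (N * (N * N))
          ≡⟨ arrange₂ N units (q ^ d) ⟩
        2 * q ^ d * units * (N * N * (N * N)) ∎)
        where
        open ≤-Reasoning
        instance
          scale≢0 : NonZero (2 * q ^ d * units)
          scale≢0 = >-nonZero (*-mono-≤ (*-mono-≤ {1} {2} (s≤s z≤n) (1≤q^ d)) 1≤units)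
        arrange₁ : ∀ a p x l → a * (p * x * l) ≡ x * (p * (a * l))
        arrange₁ = solve-∀
        arrange₂ : ∀ n u a → n * (2 * u * a) * (n * (n * n)) ≡ 2 * a * u * (n * n * (n * n))
        arrange₂ = solve-∀
        pointwise : ∀ v → 2 * q ^ d * (poor-excess v * ∑[ y ∈ E ] line y v) ≤ excess v * (N * (N * N))
        pointwise v = begin
          2 * q ^ d * (poor v * excess v * ∑[ y ∈ E ] line y v)  ≡⟨ arrange₁ (2 * q ^ d) (poor v) (excess v) _ ⟩
          excess v * (poor v * (2 * q ^ d * ∑[ y ∈ E ] line y v)) ≤⟨ *-monoʳ-≤ (excess v) (poor-line v) ⟩
          excess v * (poor v * (N * (N * N)))                    ≤⟨ *-monoʳ-≤ (excess v) (⟦⟧*-≤ (¬? (rich? v)) (λ _ → ≤-refl)) ⟩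
          excess v * (N * (N * N))                               ∎

      -- One N⁴ is the mean value N² of q S over N² pairs, the other is the excess.
      poor-sum : q * ∑[ y ∈ E ] ∑[ y′ ∈ E ] (poor (y′ -ᵛ y) * S (y′ -ᵛ y)) ≤ 2 * (N * N * (N * N))
      poor-sum = begin
        q * ∑[ y ∈ E ] ∑[ y′ ∈ E ] (poor (y′ -ᵛ y) * S (y′ -ᵛ y))
          ≡⟨ trans (∑-cong E (λ y → ∑-*ˡ E q _)) (∑-*ˡ E q _) ⟨
        ∑[ y ∈ E ] ∑[ y′ ∈ E ] (q * (poor (y′ -ᵛ y) * S (y′ -ᵛ y)))
          ≤⟨ ∑-mono E (λ y → ∑-mono E (λ y′ → split (y′ -ᵛ y))) ⟩
        ∑[ y ∈ E ] ∑[ y′ ∈ E ] (N * N + poor-excess (y′ -ᵛ y))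
          ≡⟨ ∑-cong E (λ y → trans (∑-+ E _ _) (cong (_+ ∑[ y′ ∈ E ] poor-excess (y′ -ᵛ y)) (∑-const E (N * N)))) ⟩
        ∑[ y ∈ E ] (N * (N * N) + ∑[ y′ ∈ E ] poor-excess (y′ -ᵛ y))
          ≡⟨ trans (∑-+ E _ _) (cong (_+ Σpoor) (∑-const E (N * (N * N)))) ⟩
        N * (N * (N * N)) + Σpoor
          ≤⟨ +-mono-≤ (≤-reflexive (sym (*-assoc N N (N * N)))) poor-excess-sum ⟩
        N * N * (N * N) + N * N * (N * N)
          ≡⟨ cong (N * N * (N * N) +_) (+-identityʳ _) ⟨
        2 * (N * N * (N * N)) ∎
        where
        open ≤-Reasoning
        Σpoor = ∑[ y ∈ E ] ∑[ y′ ∈ E ] poor-excess (y′ -ᵛ y)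
        arrange : ∀ a p s → a * (p * s) ≡ p * (a * s)
        arrange = solve-∀
        split : ∀ z → q * (poor z * S z) ≤ N * N + poor-excess z
        split z = begin
          q * (poor z * S z)                       ≡⟨ arrange q (poor z) (S z) ⟩
          poor z * (q * S z)                       ≡⟨ cong (poor z *_) (m+[n∸m]≡n (N²≤qS z)) ⟨
          poor z * (N * N + excess z)              ≡⟨ *-distribˡ-+ (poor z) (N * N) (excess z) ⟩
          poor z * (N * N) + poor-excess z         ≤⟨ +-monoˡ-≤ (poor-excess z) (⟦⟧*-≤ (¬? (rich? z)) (λ _ → ≤-refl)) ⟩
          N * N + poor-excess z                    ∎

    -- Zeros of the norm on a subspace

    -- A nonzero constant term excludes the zero polynomial whatever the degree; this matters
    -- because the leading coefficient will be Q ω, which vanishes for isotropic ω. One root is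
    -- split off, and the cofactor is linear.
    quadratic-roots : ∀ α β {γ} → γ ≢ 0# → ∑[ r ∈ Fs ] ⟦ α *ᶠ (r *ᶠ r) +ᶠ β *ᶠ r +ᶠ γ ≟ᶠ 0# ⟧ ≤ 2
    quadratic-roots α β {γ} γ≢0 with Any.any? (λ r → α *ᶠ (r *ᶠ r) +ᶠ β *ᶠ r +ᶠ γ ≟ᶠ 0#) Fs
    ... | no rootless = ≤-trans
      (∑-mono-∈ Fs (λ r r∈Fs → ≤-reflexive (⟦⟧-no (α *ᶠ (r *ᶠ r) +ᶠ β *ᶠ r +ᶠ γ ≟ᶠ 0#) (rootless ∘ lose r∈Fs))))
      (≤-trans (≤-reflexive (∑-zero Fs)) z≤n)
    ... | yes rooted with find rooted
    ...   | r₁ , _ , root = begin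
      ∑[ r ∈ Fs ] ⟦ p r ≟ᶠ 0# ⟧
        ≤⟨ ∑-mono Fs factor ⟩
      ∑[ r ∈ Fs ] (⟦ r ≟ᶠ r₁ ⟧ + ⟦ α *ᶠ r +ᶠ (α *ᶠ r₁ +ᶠ β) ≟ᶠ 0# ⟧)
        ≡⟨ trans (∑-+ Fs _ _) (cong (_+ ∑[ r ∈ Fs ] ⟦ α *ᶠ r +ᶠ (α *ᶠ r₁ +ᶠ β) ≟ᶠ 0# ⟧) (Enumeration.once scalars r₁)) ⟩
      1 + ∑[ r ∈ Fs ] ⟦ α *ᶠ r +ᶠ (α *ᶠ r₁ +ᶠ β) ≟ᶠ 0# ⟧
        ≤⟨ s≤s cofactor ⟩
      2 ∎
      where
      open ≤-Reasoning
      p : Carrier → Carrier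
      p r = α *ᶠ (r *ᶠ r) +ᶠ β *ᶠ r +ᶠ γ
      factor : ∀ r → ⟦ p r ≟ᶠ 0# ⟧ ≤ ⟦ r ≟ᶠ r₁ ⟧ + ⟦ α *ᶠ r +ᶠ (α *ᶠ r₁ +ᶠ β) ≟ᶠ 0# ⟧
      factor r with r ≟ᶠ r₁
      ... | yes _   = ≤-trans (⟦⟧≤1 (p r ≟ᶠ 0#)) (m≤m+n 1 _)
      ... | no r≢r₁ = ⟦⟧-mono (p r ≟ᶠ 0#) (α *ᶠ r +ᶠ (α *ᶠ r₁ +ᶠ β) ≟ᶠ 0#) (λ pr≡0 → integral (r≢r₁ ∘ x-y≡0⇒x≡y)
        (trans (≈⇒≡ (solve 5 (λ α β γ r r₁ → (r :- r₁) :* (α :* r :+ (α :* r₁ :+ β)) :=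
                  α :* (r :* r) :+ β :* r :+ γ :- (α :* (r₁ :* r₁) :+ β :* r₁ :+ γ)) ≈-refl α β γ r r₁))
               (x≡y⇒x-y≡0 (trans pr≡0 (sym root)))))
      cofactor : ∑[ r ∈ Fs ] ⟦ α *ᶠ r +ᶠ (α *ᶠ r₁ +ᶠ β) ≟ᶠ 0# ⟧ ≤ 1
      cofactor with α ≟ᶠ 0#
      ... | no α≢0   = ≤-reflexive (linear-root α≢0 (α *ᶠ r₁ +ᶠ β) 0#)
      -- For α = 0 the cofactor is the constant β. It is nonzero, since β = 0 together with the root
      -- r₁ would give γ = 0.
      ... | yes refl = ≤-trans (≤-reflexive (trans (∑-cong Fs (λ r → ⟦⟧-no (0# *ᶠ r +ᶠ (0# *ᶠ r₁ +ᶠ β) ≟ᶠ 0#) (rootless r))) (∑-zero Fs))) z≤n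
        where
        rootless : ∀ r → 0# *ᶠ r +ᶠ (0# *ᶠ r₁ +ᶠ β) ≢ 0#
        rootless r h = γ≢0 (trans (≈⇒≡ (solve 4 (λ β γ r r₁ →
          γ := :0 :* (r₁ :* r₁) :+ β :* r₁ :+ γ :- (:0 :* r :+ (:0 :* r₁ :+ β)) :* r₁) ≈-refl β γ r r₁))
          (trans (cong₂ (λ s t → s -ᶠ t *ᶠ r₁) root h) (≈⇒≡ (solve 1 (λ r₁ → :0 :- :0 :* r₁ := :0) ≈-refl r₁))))

    module Span {d m : ℕ} (B : Vec (Vec Carrier d) m) where

      same-norm? : (u : Vec Carrier d) (s : Vec Carrier m) → Dec (Q u ≡ Q (u +ᵛ lin s B))
      same-norm? u s = Q u ≟ᶠ Q (u +ᵛ lin s B)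

      zeros : Vec Carrier d → ℕ
      zeros u = ∑[ s ∈ Vs m ] ⟦ same-norm? u s ⟧

      zeros≤ : ∀ u → zeros u ≤ q ^ m
      zeros≤ u = ≤-trans (∑-bound (Vs m) 1 (λ s _ → ⟦⟧≤1 (same-norm? u s)))
        (≤-reflexive (trans (*-identityʳ _) (length-Vs m)))

      -- On every line through a point where Q does not take the value Q u, it does so at most twice.
      few-zeros : ∀ u s₀ → Q u ≢ Q (u +ᵛ lin s₀ B) → units * zeros u ≤ 2 * q ^ m
      few-zeros u s₀ s₀-misses = begin
        units * zeros u
          ≡⟨ ∑-*ʳ Fs (zeros u) nonzero ⟨
        ∑[ r ∈ Fs ] (nonzero r * zeros u)
          ≤⟨ ∑-mono Fs (λ r → nonzero*-≤ r (λ r≢0 → ≤-reflexive (recentre r≢0))) ⟩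
        ∑[ r ∈ Fs ] ∑[ w ∈ Vs m ] ⟦ same-norm? u (s₀ +ᵛ r · w) ⟧
          ≡⟨ ∑-swap Fs (Vs m) _ ⟩
        ∑[ w ∈ Vs m ] ∑[ r ∈ Fs ] ⟦ same-norm? u (s₀ +ᵛ r · w) ⟧
          ≤⟨ ∑-bound (Vs m) 2 (λ w _ → on-line w) ⟩
        length (Vs m) * 2
          ≡⟨ trans (*-comm (length (Vs m)) 2) (cong (2 *_) (length-Vs m)) ⟩
        2 * q ^ m ∎
        where
        open ≤-Reasoning
        p = u +ᵛ lin s₀ B
        recentre : ∀ {r} → r ≢ 0# → zeros u ≡ ∑[ w ∈ Vs m ] ⟦ same-norm? u (s₀ +ᵛ r · w) ⟧
        recentre {r} r≢0 = sym (Enumeration.reindex (vectors scalars m) (λ w → s₀ +ᵛ r · w) (λ s → inv r≢0 · (s -ᵛ s₀))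
          (λ w → trans (cong (inv r≢0 ·_) (sub-cancelˡ s₀ (r · w))) (·-inv-cancelˡ r≢0 w))
          (λ s → trans (cong (s₀ +ᵛ_) (·-inv-cancelʳ r≢0 (s -ᵛ s₀))) (add-sub s₀ s))
          (λ s → ⟦ same-norm? u s ⟧))
        on-line : ∀ w → ∑[ r ∈ Fs ] ⟦ same-norm? u (s₀ +ᵛ r · w) ⟧ ≤ 2
        on-line w = ≤-trans
          (∑-mono Fs (λ r → ⟦⟧-mono (same-norm? u (s₀ +ᵛ r · w))
            (Q ω *ᶠ (r *ᶠ r) +ᶠ (p ∙ ω +ᶠ p ∙ ω) *ᶠ r +ᶠ (Q p -ᶠ Q u) ≟ᶠ 0#) (equation r)))
          (quadratic-roots (Q ω) (p ∙ ω +ᶠ p ∙ ω) (λ h → s₀-misses (sym (x-y≡0⇒x≡y h))))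
          where
          ω = lin w B
          expand : ∀ r → Q (u +ᵛ lin (s₀ +ᵛ r · w) B) ≡ Q p +ᶠ (r *ᶠ (p ∙ ω) +ᶠ r *ᶠ (p ∙ ω)) +ᶠ r *ᶠ r *ᶠ Q ω
          expand r = trans
            (cong Q (trans (cong (u +ᵛ_) (trans (lin-+ s₀ (r · w) B) (cong (lin s₀ B +ᵛ_) (lin-· r w B))))
                           (sym (+-assocᵛ u (lin s₀ B) (r · ω)))))
            (trans (Q-+ p (r · ω)) (cong₂ (λ s t → Q p +ᶠ (s +ᶠ s) +ᶠ t) (∙-·ʳ p r ω) (Q-· r ω)))
          equation : ∀ r → Q u ≡ Q (u +ᵛ lin (s₀ +ᵛ r · w) B) →
            Q ω *ᶠ (r *ᶠ r) +ᶠ (p ∙ ω +ᶠ p ∙ ω) *ᶠ r +ᶠ (Q p -ᶠ Q u) ≡ 0#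
          equation r h = trans
            (≈⇒≡ (solve 5 (λ a b c e r → a :* (r :* r) :+ (b :+ b) :* r :+ (c :- e) := c :+ (r :* b :+ r :* b) :+ r :* r :* a :- e)
              ≈-refl (Q ω) (p ∙ ω) (Q p) (Q u) r))
            (x≡y⇒x-y≡0 (sym (trans h (expand r))))

    -- Each basis vector is itself a combination, with a unit coordinate vector as coefficients. The
    -- functions are arbitrary because one of those compared later is quadratic.
    map-span : ∀ {d m} (f g : Vec Carrier d → Carrier) (B : Vec (Vec Carrier d) m) →
      (∀ s → f (lin s B) ≡ g (lin s B)) → Vec.map f B ≡ Vec.map g B
    map-span f g []      h = refl
    map-span f g (b ∷ B) h = cong₂ _∷_
      (subst (λ w → f w ≡ g w) head (h (1# ∷ 0ᵛ)))
      (map-span f g B (λ s → subst (λ w → f w ≡ g w) (trans (cong (_+ᵛ lin s B) (·-zeroˡ b)) (+-identityˡᵛ _)) (h (0# ∷ s))))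
      where
      ·-identity : ∀ {n} (v : Vec Carrier n) → 1# · v ≡ v
      ·-identity []      = refl
      ·-identity (a ∷ v) = cong₂ _∷_ (*ᶠ-identityˡ a) (·-identity v)
      head : 1# · b +ᵛ lin 0ᵛ B ≡ b
      head = trans (cong₂ _+ᵛ_ (·-identity b) (lin-0 B)) (+-identityʳᵛ b)

    module Exceptional {d n m : ℕ} (d≡n+n : d ≡ n + n) (B : Vec (Vec Carrier d) m) where
      open Span B

      exceptional? : ∀ u → Dec (4 * q ^ n < q * zeros u)
      exceptional? u = 4 * q ^ n <? q * zeros u

      -- A single s with a different norm would give q · zeros ≤ 2(q-1) · zeros ≤ 4 q^m by
      -- `few-zeros`. This is the origin of the threshold 4 q^n.
      exceptional-full : m ≤ n → ∀ u → 4 * q ^ n < q * zeros u → ∀ s → Q u ≡ Q (u +ᵛ lin s B)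
      exceptional-full m≤n u h s = decidable-stable (same-norm? u s) (λ misses → <⇒≱ h (begin
        q * zeros u            ≤⟨ *-monoˡ-≤ (zeros u) q≤2units ⟩
        2 * units * zeros u    ≡⟨ *-assoc 2 units _ ⟩
        2 * (units * zeros u)  ≤⟨ *-monoʳ-≤ 2 (few-zeros u s misses) ⟩
        2 * (2 * q ^ m)        ≡⟨ *-assoc 2 2 (q ^ m) ⟨
        4 * q ^ m              ≤⟨ *-monoʳ-≤ 4 (^-monoʳ-≤ q {{>-nonZero (≤-trans (n≤1+n 1) 2≤q)}} m≤n) ⟩
        4 * q ^ n              ∎))
        where open ≤-Reasoning

      -- If Q (u + w) = Q u for all w in the span, then 2 u ∙ w = - Q w. So all such u have the same
      -- inner products with the basis, and `fibre-bound` counts them.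
      full⇒fibre : ∀ u → (∀ s → Q u ≡ Q (u +ᵛ lin s B)) →
        Vec.map (u ∙_) B ≡ Vec.map (λ b → half *ᶠ (-ᶠ Q b)) B
      full⇒fibre u h = map-span (u ∙_) (λ b → half *ᶠ (-ᶠ Q b)) B (λ s → begin
        u ∙ lin s B
          ≡⟨ halve _ ⟨
        half *ᶠ (u ∙ lin s B +ᶠ u ∙ lin s B)
          ≡⟨ cong (half *ᶠ_) (≈⇒≡ (solve 3 (λ a b c → b :+ b := a :+ (b :+ b) :+ c :- a :- c) ≈-refl (Q u) (u ∙ lin s B) (Q (lin s B)))) ⟩
        half *ᶠ (Q u +ᶠ (u ∙ lin s B +ᶠ u ∙ lin s B) +ᶠ Q (lin s B) -ᶠ Q u -ᶠ Q (lin s B))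
          ≡⟨ cong (λ x → half *ᶠ (x -ᶠ Q (lin s B))) (x≡y⇒x-y≡0 (sym (trans (h s) (Q-+ u (lin s B))))) ⟩
        half *ᶠ (0# -ᶠ Q (lin s B))
          ≡⟨ cong (half *ᶠ_) (≈⇒≡ (solve 1 (λ x → :0 :- x := :- x) ≈-refl (Q (lin s B)))) ⟩
        half *ᶠ (-ᶠ Q (lin s B)) ∎)
        where open ≡-Reasoning

      -- For m < n nothing is exceptional, as even q^m zeros stay below the threshold. For m = n the
      -- exceptional points lie in one fibre, of size q^(d-n) = q^n; this equality is where d = 2n
      -- is used.
      exceptional-count : Independent B → m ≤ n → ∑[ u ∈ Vs d ] ⟦ exceptional? u ⟧ ≤ q ^ n
      exceptional-count indep m≤n with m≤n⇒m<n∨m≡n m≤n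
      ... | inj₁ m<n = ≤-trans (≤-reflexive (trans (∑-cong (Vs d) (λ u → ⟦⟧-no (exceptional? u) (λ h → <⇒≱ h (begin
        q * zeros u   ≤⟨ *-monoʳ-≤ q (zeros≤ u) ⟩
        q ^ suc m     ≤⟨ ^-monoʳ-≤ q {{>-nonZero (≤-trans (n≤1+n 1) 2≤q)}} m<n ⟩
        q ^ n         ≤⟨ m≤n*m (q ^ n) 4 ⟩
        4 * q ^ n     ∎)))) (∑-zero (Vs d)))) z≤n
        where open ≤-Reasoning
      ... | inj₂ refl = *-cancelˡ-≤ (q ^ n) {{>-nonZero (1≤q^ n)}} (begin
        q ^ n * ∑[ u ∈ Vs d ] ⟦ exceptional? u ⟧
          ≤⟨ *-monoʳ-≤ (q ^ n) (∑-mono (Vs d) (λ u → ⟦⟧-mono (exceptional? u) (Vec.map (u ∙_) B ≟ᵛ Vec.map (λ b → half *ᶠ (-ᶠ Q b)) B)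
               (full⇒fibre u ∘ exceptional-full m≤n u))) ⟩
        q ^ n * ∑[ u ∈ Vs d ] ⟦ Vec.map (u ∙_) B ≟ᵛ Vec.map (λ b → half *ᶠ (-ᶠ Q b)) B ⟧
          ≤⟨ fibre-bound indep _ ⟩
        q ^ d
          ≡⟨ trans (cong (q ^_) d≡n+n) (^-distribˡ-+-* q n n) ⟩
        q ^ n * q ^ n ∎)
        where open ≤-Reasoning

    -- Collisions when the rich directions are covered

    module Convolution {d : ℕ} (E : List (Vec Carrier d)) (uE : Unique E) where
      open PointSet E uE

      -- With h a the number of x in E on x ∙ z = a, the left side is the sum of h a · h (k - a), at
      -- most the sum of h², which is S z, because a ↦ k - a permutes the field.
      convolution : ∀ z k → ∑[ x₁ ∈ E ] ∑[ x₂ ∈ E ] ⟦ x₁ ∙ z +ᶠ x₂ ∙ z ≟ᶠ k ⟧ ≤ S z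
      convolution z k = *-cancelˡ-≤ 2 (begin
        2 * ∑[ x₁ ∈ E ] ∑[ x₂ ∈ E ] ⟦ x₁ ∙ z +ᶠ x₂ ∙ z ≟ᶠ k ⟧
          ≡⟨ cong (2 *_) (∑-cong E (λ x₁ → trans (∑-cong E (λ x₂ → slice x₁ x₂)) (∑-swap E Fs _))) ⟩
        2 * ∑[ x₁ ∈ E ] ∑[ a ∈ Fs ] ∑[ x₂ ∈ E ] (⟦ x₁ ∙ z ≟ᶠ a ⟧ * ⟦ x₂ ∙ z ≟ᶠ k -ᶠ a ⟧)
          ≡⟨ cong (2 *_) (trans (∑-swap E Fs _) (∑-cong Fs (λ a → ∑-product E E _ _))) ⟩
        2 * ∑[ a ∈ Fs ] (h a * h (k -ᶠ a))
          ≡⟨ ∑-*ˡ Fs 2 _ ⟨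
        ∑[ a ∈ Fs ] (2 * (h a * h (k -ᶠ a)))
          ≤⟨ ∑-mono Fs (λ a → 2mn≤m²+n² (h a) (h (k -ᶠ a))) ⟩
        ∑[ a ∈ Fs ] (h a * h a + h (k -ᶠ a) * h (k -ᶠ a))
          ≡⟨ trans (∑-+ Fs _ _) (cong₂ _+_ square (trans (Enumeration.reindex scalars (λ a → k -ᶠ a) (λ a → k -ᶠ a) reflect reflect (λ a → h a * h a)) square)) ⟩
        S z + S z
          ≡⟨ cong (S z +_) (+-identityʳ _) ⟨
        2 * S z ∎)
        where
        open ≤-Reasoning
        h : Carrier → ℕ
        h a = ∑[ x ∈ E ] ⟦ x ∙ z ≟ᶠ a ⟧
        reflect : ∀ a → k -ᶠ (k -ᶠ a) ≡ a
        reflect a = ≈⇒≡ (solve 2 (λ k a → k :- (k :- a) := a) ≈-refl k a)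
        slice : ∀ x₁ x₂ → ⟦ x₁ ∙ z +ᶠ x₂ ∙ z ≟ᶠ k ⟧ ≡ ∑[ a ∈ Fs ] (⟦ x₁ ∙ z ≟ᶠ a ⟧ * ⟦ x₂ ∙ z ≟ᶠ k -ᶠ a ⟧)
        slice x₁ x₂ = begin-equality
          ⟦ x₁ ∙ z +ᶠ x₂ ∙ z ≟ᶠ k ⟧
            ≡⟨ ⟦⟧-cong (x₁ ∙ z +ᶠ x₂ ∙ z ≟ᶠ k) (x₂ ∙ z ≟ᶠ k -ᶠ x₁ ∙ z)
                 (λ { refl → ≈⇒≡ (solve 2 (λ s t → t := s :+ t :- s) ≈-refl (x₁ ∙ z) (x₂ ∙ z)) })
                 (λ p → trans (cong (x₁ ∙ z +ᶠ_) p) (≈⇒≡ (solve 2 (λ s k → s :+ (k :- s) := k) ≈-refl (x₁ ∙ z) k))) ⟩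
          ⟦ x₂ ∙ z ≟ᶠ k -ᶠ x₁ ∙ z ⟧
            ≡⟨ Enumeration.pick scalars (λ a → ⟦ x₂ ∙ z ≟ᶠ k -ᶠ a ⟧) (x₁ ∙ z) ⟨
          ∑[ a ∈ Fs ] (⟦ a ≟ᶠ x₁ ∙ z ⟧ * ⟦ x₂ ∙ z ≟ᶠ k -ᶠ a ⟧)
            ≡⟨ ∑-cong Fs (λ a → cong (_* ⟦ x₂ ∙ z ≟ᶠ k -ᶠ a ⟧) (⟦⟧-cong (a ≟ᶠ x₁ ∙ z) (x₁ ∙ z ≟ᶠ a) sym sym)) ⟩
          ∑[ a ∈ Fs ] (⟦ x₁ ∙ z ≟ᶠ a ⟧ * ⟦ x₂ ∙ z ≟ᶠ k -ᶠ a ⟧) ∎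
        square : ∑[ a ∈ Fs ] (h a * h a) ≡ S z
        square = begin-equality
          ∑[ a ∈ Fs ] (h a * h a)
            ≡⟨ ∑-cong Fs (λ a → ∑-product E E _ _) ⟨
          ∑[ a ∈ Fs ] ∑[ x ∈ E ] ∑[ x′ ∈ E ] (⟦ x ∙ z ≟ᶠ a ⟧ * ⟦ x′ ∙ z ≟ᶠ a ⟧)
            ≡⟨ trans (∑-swap Fs E _) (∑-cong E (λ x → ∑-swap Fs E _)) ⟩
          ∑[ x ∈ E ] ∑[ x′ ∈ E ] ∑[ a ∈ Fs ] (⟦ x ∙ z ≟ᶠ a ⟧ * ⟦ x′ ∙ z ≟ᶠ a ⟧)
            ≡⟨ ∑-cong E (λ x → ∑-cong E (λ x′ → trans
                 (∑-cong Fs (λ a → cong₂ _*_ (⟦⟧-cong (x ∙ z ≟ᶠ a) (a ≟ᶠ x ∙ z) sym sym) refl))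
                 (trans (Enumeration.pick scalars (λ a → ⟦ x′ ∙ z ≟ᶠ a ⟧) (x ∙ z)) (⟦⟧-cong (x′ ∙ z ≟ᶠ x ∙ z) (x ∙ z ≟ᶠ x′ ∙ z) sym sym)))) ⟩
          S z ∎

    module Covered {d n m : ℕ} (d≡n+n : d ≡ n + n) (E : List (Vec Carrier d)) (uE : Unique E)
      (B : Vec (Vec Carrier d) m) (indep : Independent B) (m≤n : m ≤ n)
      (cover : ∀ z → PointSet.Rich E uE z → ∃ λ c → lin c B ≡ z)
      (s : Vec Carrier d) where
      open PointSet E uE
      open Convolution E uE
      open Span B
      open Exceptional {n = n} d≡n+n B

      generic : Vec Carrier d → ℕ
      generic u = ⟦ ¬? (exceptional? u) ⟧

      point : Vec Carrier d → Vec Carrier d → Vec Carrier d → Vec Carrier d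
      point x₁ x₂ y = s +ᵛ (x₁ +ᵛ x₂) +ᵛ y

      collision : Vec Carrier d → Vec Carrier d → Vec Carrier d → Vec Carrier d → ℕ
      collision x₁ x₂ y y′ = ⟦ Q (point x₁ x₂ y) ≟ᶠ Q (point x₁ x₂ y′) ⟧

      pairs : Vec Carrier d → Vec Carrier d → ℕ
      pairs x₁ x₂ = ∑[ y ∈ E ] ∑[ y′ ∈ E ] (generic (point x₁ x₂ y) * generic (point x₁ x₂ y′) * collision x₁ x₂ y y′)

      poor-pairs : Vec Carrier d → Vec Carrier d → ℕ
      poor-pairs x₁ x₂ = ∑[ y ∈ E ] ∑[ y′ ∈ E ] (poor (y′ -ᵛ y) * collision x₁ x₂ y y′)

      span-pairs : Vec Carrier d → ℕ
      span-pairs u = generic u * zeros u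

      -- If y′ - y is rich, `cover` writes it as `lin c B`, and the collision becomes a zero c of
      -- the norm difference at u = `point x₁ x₂ y`. Genericity is retained only for this u, where
      -- it bounds the number of such c.
      pair-split : ∀ x₁ x₂ y y′ →
        generic (point x₁ x₂ y) * generic (point x₁ x₂ y′) * collision x₁ x₂ y y′ ≤
        poor (y′ -ᵛ y) * collision x₁ x₂ y y′ +
        ∑[ c ∈ Vs m ] (generic (point x₁ x₂ y) * ⟦ same-norm? (point x₁ x₂ y) c ⟧ * ⟦ y′ ≟ᵛ y +ᵛ lin c B ⟧)
      pair-split x₁ x₂ y y′ with Q (point x₁ x₂ y) ≟ᶠ Q (point x₁ x₂ y′)
      ... | no _ = ≤-trans (≤-reflexive (*-zeroʳ (generic (point x₁ x₂ y) * generic (point x₁ x₂ y′)))) z≤n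
      ... | yes same with rich? (y′ -ᵛ y)
      ...   | no _ = ≤-trans (*-monoˡ-≤ 1 (*-mono-≤ (⟦⟧≤1 (¬? (exceptional? (point x₁ x₂ y)))) (⟦⟧≤1 (¬? (exceptional? (point x₁ x₂ y′)))))) (m≤m+n 1 _)
      ...   | yes rich with cover (y′ -ᵛ y) rich
      ...     | c , spans = begin
        generic u * generic (point x₁ x₂ y′) * 1
          ≤⟨ *-monoˡ-≤ 1 (*-monoʳ-≤ (generic u) (⟦⟧≤1 (¬? (exceptional? (point x₁ x₂ y′))))) ⟩
        generic u * 1 * 1
          ≡⟨ cong₂ (λ a b → generic u * a * b) (⟦⟧-yes (same-norm? u c) same′) (⟦⟧-yes (y′ ≟ᵛ y +ᵛ lin c B) y′≡) ⟨
        generic u * ⟦ same-norm? u c ⟧ * ⟦ y′ ≟ᵛ y +ᵛ lin c B ⟧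
          ≤⟨ ∑-∈ (Vs m) (λ c → generic u * ⟦ same-norm? u c ⟧ * ⟦ y′ ≟ᵛ y +ᵛ lin c B ⟧) (Enumeration.complete (vectors scalars m) c) ⟩
        ∑[ c ∈ Vs m ] (generic u * ⟦ same-norm? u c ⟧ * ⟦ y′ ≟ᵛ y +ᵛ lin c B ⟧) ∎
        where
        open ≤-Reasoning
        u = point x₁ x₂ y
        y′≡ : y′ ≡ y +ᵛ lin c B
        y′≡ = trans (sym (add-sub y y′)) (cong (y +ᵛ_) (sym spans))
        same′ : Q u ≡ Q (u +ᵛ lin c B)
        same′ = trans same (cong Q (trans (cong ((s +ᵛ (x₁ +ᵛ x₂)) +ᵛ_) y′≡) (sym (+-assocᵛ (s +ᵛ (x₁ +ᵛ x₂)) y (lin c B)))))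

      pairs≤ : ∀ x₁ x₂ → pairs x₁ x₂ ≤ poor-pairs x₁ x₂ + ∑[ y ∈ E ] span-pairs (point x₁ x₂ y)
      pairs≤ x₁ x₂ = begin
        pairs x₁ x₂
          ≤⟨ ∑-mono E (λ y → ∑-mono E (pair-split x₁ x₂ y)) ⟩
        ∑[ y ∈ E ] ∑[ y′ ∈ E ] (poor (y′ -ᵛ y) * collision x₁ x₂ y y′ +
          ∑[ c ∈ Vs m ] (generic (point x₁ x₂ y) * ⟦ same-norm? (point x₁ x₂ y) c ⟧ * ⟦ y′ ≟ᵛ y +ᵛ lin c B ⟧))
          ≡⟨ trans (∑-cong E (λ y → ∑-+ E _ _)) (∑-+ E _ _) ⟩
        poor-pairs x₁ x₂ + ∑[ y ∈ E ] ∑[ y′ ∈ E ] ∑[ c ∈ Vs m ]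
          (generic (point x₁ x₂ y) * ⟦ same-norm? (point x₁ x₂ y) c ⟧ * ⟦ y′ ≟ᵛ y +ᵛ lin c B ⟧)
          ≤⟨ +-monoʳ-≤ (poor-pairs x₁ x₂) (∑-mono E (λ y → one-partner y (point x₁ x₂ y))) ⟩
        poor-pairs x₁ x₂ + ∑[ y ∈ E ] span-pairs (point x₁ x₂ y) ∎
        where
        open ≤-Reasoning
        -- Since E has no repetitions, each c determines at most one y′ in E.
        one-partner : ∀ y u → ∑[ y′ ∈ E ] ∑[ c ∈ Vs m ] (generic u * ⟦ same-norm? u c ⟧ * ⟦ y′ ≟ᵛ y +ᵛ lin c B ⟧) ≤ span-pairs u
        one-partner y u = begin
          ∑[ y′ ∈ E ] ∑[ c ∈ Vs m ] (generic u * ⟦ same-norm? u c ⟧ * ⟦ y′ ≟ᵛ y +ᵛ lin c B ⟧)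
            ≡⟨ trans (∑-swap E (Vs m) _) (∑-cong (Vs m) (λ c → ∑-*ˡ E (generic u * ⟦ same-norm? u c ⟧) _)) ⟩
          ∑[ c ∈ Vs m ] (generic u * ⟦ same-norm? u c ⟧ * indicator (y +ᵛ lin c B))
            ≤⟨ ∑-mono (Vs m) (λ c → *-monoʳ-≤ (generic u * ⟦ same-norm? u c ⟧) (∑-Unique _≟ᵛ_ uE (y +ᵛ lin c B))) ⟩
          ∑[ c ∈ Vs m ] (generic u * ⟦ same-norm? u c ⟧ * 1)
            ≡⟨ trans (∑-cong (Vs m) (λ c → *-identityʳ _)) (∑-*ˡ (Vs m) (generic u) _) ⟩
          span-pairs u ∎

      -- With y and y′ fixed, `polar` turns the collision into a prescribed value of x₁ ∙ z + x₂ ∙ z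
      -- for z = y′ - y, and `convolution` applies.
      poor-pairs-total : ∑[ x₁ ∈ E ] ∑[ x₂ ∈ E ] poor-pairs x₁ x₂ ≤ ∑[ y ∈ E ] ∑[ y′ ∈ E ] (poor (y′ -ᵛ y) * S (y′ -ᵛ y))
      poor-pairs-total = begin
        ∑[ x₁ ∈ E ] ∑[ x₂ ∈ E ] ∑[ y ∈ E ] ∑[ y′ ∈ E ] (poor (y′ -ᵛ y) * collision x₁ x₂ y y′)
          ≡⟨ trans (∑-cong E (λ x₁ → ∑-swap E E _)) (∑-swap E E _) ⟩
        ∑[ y ∈ E ] ∑[ x₁ ∈ E ] ∑[ x₂ ∈ E ] ∑[ y′ ∈ E ] (poor (y′ -ᵛ y) * collision x₁ x₂ y y′)
          ≡⟨ ∑-cong E (λ y → trans (∑-cong E (λ x₁ → ∑-swap E E _)) (∑-swap E E _)) ⟩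
        ∑[ y ∈ E ] ∑[ y′ ∈ E ] ∑[ x₁ ∈ E ] ∑[ x₂ ∈ E ] (poor (y′ -ᵛ y) * collision x₁ x₂ y y′)
          ≡⟨ ∑-cong E (λ y → ∑-cong E (λ y′ → trans (∑-cong E (λ x₁ → ∑-*ˡ E (poor (y′ -ᵛ y)) _)) (∑-*ˡ E (poor (y′ -ᵛ y)) _))) ⟩
        ∑[ y ∈ E ] ∑[ y′ ∈ E ] (poor (y′ -ᵛ y) * ∑[ x₁ ∈ E ] ∑[ x₂ ∈ E ] collision x₁ x₂ y y′)
          ≤⟨ ∑-mono E (λ y → ∑-mono E (λ y′ → *-monoʳ-≤ (poor (y′ -ᵛ y)) (centres y y′))) ⟩
        ∑[ y ∈ E ] ∑[ y′ ∈ E ] (poor (y′ -ᵛ y) * S (y′ -ᵛ y)) ∎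
        where
        open ≤-Reasoning
        centres : ∀ y y′ → ∑[ x₁ ∈ E ] ∑[ x₂ ∈ E ] collision x₁ x₂ y y′ ≤ S (y′ -ᵛ y)
        centres y y′ = ≤-trans
          (∑-mono E (λ x₁ → ∑-mono E (λ x₂ → ⟦⟧-mono (Q (point x₁ x₂ y) ≟ᶠ Q (point x₁ x₂ y′)) (x₁ ∙ z +ᶠ x₂ ∙ z ≟ᶠ k -ᶠ z ∙ s) (on-plane x₁ x₂))))
          (convolution z (k -ᶠ z ∙ s))
          where
          z = y′ -ᵛ y
          k = half *ᶠ (Q y -ᶠ Q y′)
          on-plane : ∀ x₁ x₂ → Q (point x₁ x₂ y) ≡ Q (point x₁ x₂ y′) → x₁ ∙ z +ᶠ x₂ ∙ z ≡ k -ᶠ z ∙ s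
          on-plane x₁ x₂ p = trans (sym (∙-distribʳ-+ x₁ x₂ z)) (trans (∙-comm (x₁ +ᵛ x₂) z)
            (trans (≈⇒≡ (solve 2 (λ a b → b := a :+ b :- a) ≈-refl (z ∙ s) (z ∙ (x₁ +ᵛ x₂))))
              (cong (_-ᶠ z ∙ s) (trans (sym (∙-distribˡ-+ z s (x₁ +ᵛ x₂))) (polar (s +ᵛ (x₁ +ᵛ x₂)) y y′ p)))))

      span-pairs≤ : ∀ u → q * span-pairs u ≤ 4 * q ^ n
      span-pairs≤ u = ≤-trans (≤-reflexive (swapˡ q (generic u) (zeros u)))
        (⟦⟧*-≤ (¬? (exceptional? u)) ≮⇒≥)
        where
        swapˡ : ∀ a b c → a * (b * c) ≡ b * (a * c)
        swapˡ = solve-∀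

      module _ (large : 4 * q ^ n ≤ N) where

        -- Poor differences contribute 2 N⁴. Differences in the span contribute at most 4 q^n ≤ N
        -- for each of the N³ triples, hence one more N⁴.
        pairs-total : q * ∑[ x₁ ∈ E ] ∑[ x₂ ∈ E ] pairs x₁ x₂ ≤ 3 * (N * N * (N * N))
        pairs-total = begin
          q * ∑[ x₁ ∈ E ] ∑[ x₂ ∈ E ] pairs x₁ x₂
            ≤⟨ *-monoʳ-≤ q (∑-mono E (λ x₁ → ∑-mono E (pairs≤ x₁))) ⟩
          q * ∑[ x₁ ∈ E ] ∑[ x₂ ∈ E ] (poor-pairs x₁ x₂ + ∑[ y ∈ E ] span-pairs (point x₁ x₂ y))
            ≡⟨ cong (q *_) (trans (∑-cong E (λ x₁ → ∑-+ E _ _)) (∑-+ E _ _)) ⟩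
          q * (∑[ x₁ ∈ E ] ∑[ x₂ ∈ E ] poor-pairs x₁ x₂ + ∑[ x₁ ∈ E ] ∑[ x₂ ∈ E ] ∑[ y ∈ E ] span-pairs (point x₁ x₂ y))
            ≡⟨ *-distribˡ-+ q _ _ ⟩
          q * ∑[ x₁ ∈ E ] ∑[ x₂ ∈ E ] poor-pairs x₁ x₂ + q * ∑[ x₁ ∈ E ] ∑[ x₂ ∈ E ] ∑[ y ∈ E ] span-pairs (point x₁ x₂ y)
            ≤⟨ +-mono-≤ (≤-trans (*-monoʳ-≤ q poor-pairs-total) poor-sum) span-total ⟩
          2 * (N * N * (N * N)) + N * (N * (N * N))
            ≡⟨ arrange N ⟩
          3 * (N * N * (N * N)) ∎
          where
          open ≤-Reasoning
          arrange : ∀ a → 2 * (a * a * (a * a)) + a * (a * (a * a)) ≡ 3 * (a * a * (a * a))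
          arrange = solve-∀
          span-total : q * ∑[ x₁ ∈ E ] ∑[ x₂ ∈ E ] ∑[ y ∈ E ] span-pairs (point x₁ x₂ y) ≤ N * (N * (N * N))
          span-total = begin
            q * ∑[ x₁ ∈ E ] ∑[ x₂ ∈ E ] ∑[ y ∈ E ] span-pairs (point x₁ x₂ y)
              ≡⟨ trans (∑-cong E (λ x₁ → trans (∑-cong E (λ x₂ → ∑-*ˡ E q _)) (∑-*ˡ E q _))) (∑-*ˡ E q _) ⟨
            ∑[ x₁ ∈ E ] ∑[ x₂ ∈ E ] ∑[ y ∈ E ] (q * span-pairs (point x₁ x₂ y))
              ≤⟨ ∑-bound E (N * (N * N)) (λ x₁ _ → ∑-bound E (N * N) (λ x₂ _ → ∑-bound E N (λ y _ → ≤-trans (span-pairs≤ (point x₁ x₂ y)) large))) ⟩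
            N * (N * (N * N)) ∎

        generic-total : ℕ
        generic-total = ∑[ x₁ ∈ E ] ∑[ x₂ ∈ E ] ∑[ y ∈ E ] generic (point x₁ x₂ y)

        -- For fixed x₁ and x₂ the points are distinct translates, so at most q^n ≤ N/4 of them are
        -- exceptional.
        most-generic : N * N * N ≤ 2 * generic-total
        most-generic = *-cancelˡ-≤ 2 (+-cancelʳ-≤ (N * N * N) _ _ (begin
          2 * (N * N * N) + N * N * N                       ≤⟨ m≤m+n _ (N * N * N) ⟩
          2 * (N * N * N) + N * N * N + N * N * N           ≡⟨ arrange₁ N ⟩
          4 * (N * (N * N))                                 ≡⟨ cong (4 *_) count ⟨
          4 * (generic-total + exceptional-total)           ≡⟨ *-distribˡ-+ 4 generic-total _ ⟩
          4 * generic-total + 4 * exceptional-total         ≤⟨ +-mono-≤ (≤-reflexive (*-assoc 2 2 generic-total)) (*-monoʳ-≤ 4 exceptional-total≤) ⟩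
          2 * (2 * generic-total) + 4 * (N * (N * q ^ n))   ≡⟨ cong (2 * (2 * generic-total) +_) (arrange₂ N (q ^ n)) ⟩
          2 * (2 * generic-total) + N * N * (4 * q ^ n)     ≤⟨ +-monoʳ-≤ (2 * (2 * generic-total)) (*-monoʳ-≤ (N * N) large) ⟩
          2 * (2 * generic-total) + N * N * N               ∎))
          where
          open ≤-Reasoning
          arrange₁ : ∀ a → 2 * (a * a * a) + a * a * a + a * a * a ≡ 4 * (a * (a * a))
          arrange₁ = solve-∀
          arrange₂ : ∀ a b → 4 * (a * (a * b)) ≡ a * a * (4 * b)
          arrange₂ = solve-∀
          exceptional-total : ℕ
          exceptional-total = ∑[ x₁ ∈ E ] ∑[ x₂ ∈ E ] ∑[ y ∈ E ] ⟦ exceptional? (point x₁ x₂ y) ⟧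
          complement : ∀ u → generic u + ⟦ exceptional? u ⟧ ≡ 1
          complement u with exceptional? u
          ... | yes _ = refl
          ... | no _  = refl
          count : generic-total + exceptional-total ≡ N * (N * N)
          count = begin-equality
            generic-total + exceptional-total
              ≡⟨ trans (∑-cong E (λ x₁ → trans (∑-cong E (λ x₂ → ∑-+ E _ _)) (∑-+ E _ _))) (∑-+ E _ _) ⟨
            ∑[ x₁ ∈ E ] ∑[ x₂ ∈ E ] ∑[ y ∈ E ] (generic (point x₁ x₂ y) + ⟦ exceptional? (point x₁ x₂ y) ⟧)
              ≡⟨ ∑-cong E (λ x₁ → ∑-cong E (λ x₂ → trans (∑-cong E (λ y → complement (point x₁ x₂ y))) (∑-one E))) ⟩
            ∑[ x₁ ∈ E ] ∑[ x₂ ∈ E ] N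
              ≡⟨ trans (∑-cong E (λ _ → ∑-const E N)) (∑-const E (N * N)) ⟩
            N * (N * N) ∎
          translates-distinct : ∀ w a → ∑[ y ∈ E ] ⟦ w +ᵛ y ≟ᵛ a ⟧ ≤ 1
          translates-distinct w a = ≤-trans
            (∑-mono E (λ y → ⟦⟧-mono (w +ᵛ y ≟ᵛ a) (y ≟ᵛ a -ᵛ w) (λ { refl → sym (sub-cancelˡ w y) })))
            (∑-Unique _≟ᵛ_ uE (a -ᵛ w))
          exceptional-total≤ : exceptional-total ≤ N * (N * q ^ n)
          exceptional-total≤ = ∑-bound E (N * q ^ n) (λ x₁ _ → ∑-bound E (q ^ n) (λ x₂ _ → ≤-trans
            (Enumeration.∑-image (vectors scalars d) E (s +ᵛ (x₁ +ᵛ x₂) +ᵛ_) (translates-distinct (s +ᵛ (x₁ +ᵛ x₂))) (λ u → ⟦ exceptional? u ⟧))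
            (exceptional-count indep m≤n)))

        -- Two applications of Cauchy-Schwarz: over the pairs (x₁, x₂), then over the values in D.
        -- The constant is 12 = 4 · 3, with 4 from squaring the half in `most-generic` and 3 from
        -- `pairs-total`.
        many-values : {D : List Carrier} → Unique D →
          (∀ {x₁ x₂ y} → x₁ ∈ E → x₂ ∈ E → y ∈ E → Q (point x₁ x₂ y) ∈ D) → q ≤ 12 * length D
        many-values {D} uD values = *-cancelʳ-≤ _ _ (N * N * N * (N * N * N)) (begin
          q * (N * N * N * (N * N * N))
            ≤⟨ *-monoʳ-≤ q (*-mono-≤ most-generic most-generic) ⟩
          q * (2 * generic-total * (2 * generic-total))
            ≡⟨ arrange₁ q generic-total ⟩
          4 * q * (generic-total * generic-total)
            ≤⟨ *-monoʳ-≤ (4 * q) (≤-trans (∑∑-cauchy-schwarz E (λ x₁ x₂ → ∑[ y ∈ E ] generic (point x₁ x₂ y))) (*-monoʳ-≤ (N * N) squares)) ⟩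
          4 * q * (N * N * (length D * Σpairs))
            ≡⟨ arrange₂ q (N * N) (length D) Σpairs ⟩
          4 * (N * N) * length D * (q * Σpairs)
            ≤⟨ *-monoʳ-≤ (4 * (N * N) * length D) pairs-total ⟩
          4 * (N * N) * length D * (3 * (N * N * (N * N)))
            ≡⟨ arrange₃ N (length D) ⟩
          12 * length D * (N * N * N * (N * N * N)) ∎)
          where
          open ≤-Reasoning
          Σpairs = ∑[ x₁ ∈ E ] ∑[ x₂ ∈ E ] pairs x₁ x₂
          1≤N : 1 ≤ N
          1≤N = ≤-trans (*-mono-≤ {1} {4} (s≤s z≤n) (1≤q^ n)) large
          instance
            N⁶≢0 : NonZero (N * N * N * (N * N * N))
            N⁶≢0 = >-nonZero (*-mono-≤ (*-mono-≤ (*-mono-≤ 1≤N 1≤N) 1≤N) (*-mono-≤ (*-mono-≤ 1≤N 1≤N) 1≤N))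
          arrange₁ : ∀ a g → a * (2 * g * (2 * g)) ≡ 4 * a * (g * g)
          arrange₁ = solve-∀
          arrange₂ : ∀ a b l p → 4 * a * (b * (l * p)) ≡ 4 * b * l * (a * p)
          arrange₂ = solve-∀
          arrange₃ : ∀ a l → 4 * (a * a) * l * (3 * (a * a * (a * a))) ≡ 12 * l * (a * a * a * (a * a * a))
          arrange₃ = solve-∀
          squares : ∑[ x₁ ∈ E ] ∑[ x₂ ∈ E ] (∑[ y ∈ E ] generic (point x₁ x₂ y) * ∑[ y ∈ E ] generic (point x₁ x₂ y)) ≤ length D * Σpairs
          squares = ≤-trans
            (∑-mono-∈ E (λ x₁ x₁∈E → ∑-mono-∈ E (λ x₂ x₂∈E →
              collisions _≟ᶠ_ uD E (λ y → generic (point x₁ x₂ y)) (λ y → Q (point x₁ x₂ y)) (λ y y∈E _ → values x₁∈E x₂∈E y∈E))))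
            (≤-reflexive (trans (∑-cong E (λ x₁ → ∑-*ˡ E (length D) _)) (∑-*ˡ E (length D) _)))

    -- Independent rich directions

    module Directions {d : ℕ} (E : List (Vec Carrier d)) (uE : Unique E) where
      open PointSet E uE
      open DecMembership (_≟ᵛ_ {d}) using (_∈?_)

      Covering : ℕ → Set
      Covering m = ∃ λ (B : Vec (Vec Carrier d) m) → Independent B × (∀ z → Rich z → ∃ λ c → lin c B ≡ z)

      -- `Y` records for each direction a base point of E whose line in that direction is rich.
      RichFamily : ℕ → Set
      RichFamily m = ∃₂ λ (B Y : Vec (Vec Carrier d) m) → Independent B × Pointwise RichAt B Y

      -- A greedy step: either every rich direction is spanned already, or an unspanned one is
      -- adjoined and independence persists.
      cover-or-extend : ∀ {m} → RichFamily m → Covering m ⊎ RichFamily (suc m)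
      cover-or-extend {m} (B , Y , indep , rich) with Any.any? (λ z → rich? z ×-dec ¬? (spanned? z)) (Vs d)
        where
        spanned? : ∀ z → Dec (Any (λ c → lin c B ≡ z) (Vs m))
        spanned? z = Any.any? (λ c → lin c B ≟ᵛ z) (Vs m)
      ... | yes found with find found
      ...   | z , _ , rich-z , unspanned with find rich-z
      ...     | y , _ , rich-at = inj₂ (z ∷ B , y ∷ Y ,
                extend-independent indep (λ c p → unspanned (lose (Enumeration.complete (vectors scalars m) c) p)) , rich-at ∷ rich)
      cover-or-extend {m} (B , Y , indep , rich) | no none = inj₁ (B , indep , λ z rich-z →
        let (c , _ , p) = find (decidable-stable (Any.any? (λ c → lin c B ≟ᵛ z) (Vs m))
                            (λ unspanned → none (lose (Enumeration.complete (vectors scalars d) z) (rich-z , unspanned))))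
        in c , p)

      cover-or-family : ∀ n → (∃ λ m → m ≤ n × Covering m) ⊎ RichFamily (suc n)
      cover-or-family n = grow n
        where
        grow : ∀ k → (∃ λ m → m ≤ k × Covering m) ⊎ RichFamily (suc k)
        grow zero with cover-or-extend ([] , [] , (λ { [] _ → refl }) , [])
        ... | inj₁ cov = inj₁ (0 , z≤n , cov)
        ... | inj₂ fam = inj₂ fam
        grow (suc k) with grow k
        ... | inj₁ (m , m≤k , cov) = inj₁ (m , m≤n⇒m≤1+n m≤k , cov)
        ... | inj₂ fam with cover-or-extend fam
        ...   | inj₁ cov  = inj₁ (suc k , ≤-refl , cov)
        ...   | inj₂ fam′ = inj₂ fam′

      -- The part of E on the line through y, translated by - y so that it lies on the line through
      -- 0.
      piece : Vec Carrier d → Vec Carrier d → List (Vec Carrier d)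
      piece b y = map (_· b) (filter (λ t → y +ᵛ t · b ∈? E) Fs)

      sums : ∀ {m} → Vec (Vec Carrier d) m → Vec (Vec Carrier d) m → List (Vec Carrier d)
      sums []      []      = 0ᵛ ∷ []
      sums (b ∷ B) (y ∷ Y) = cartesianProductWith _+ᵛ_ (piece b y) (sums B Y)

      -- Coordinates for the sum of the pieces: the weight of T is 1 when every t · b lies in its
      -- piece and 0 otherwise, so that counting factors over the lines.
      weight : ∀ {m} → Vec Carrier m → Vec (Vec Carrier d) m → Vec (Vec Carrier d) m → ℕ
      weight []      []      []      = 1
      weight (t ∷ T) (b ∷ B) (y ∷ Y) = indicator (y +ᵛ t · b) * weight T B Y

      lines : ∀ {m} → Vec (Vec Carrier d) m → Vec (Vec Carrier d) m → ℕ
      lines []      []      = 1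
      lines (b ∷ B) (y ∷ Y) = line y b * lines B Y

      total-weight : ∀ {m} (B Y : Vec (Vec Carrier d) m) → ∑[ T ∈ Vs m ] weight T B Y ≡ lines B Y
      total-weight []      []      = refl
      total-weight {suc m} (b ∷ B) (y ∷ Y) = begin
        ∑[ T ∈ Vs (suc m) ] weight T (b ∷ B) (y ∷ Y)                          ≡⟨ ∑-vectors scalars (λ T → weight T (b ∷ B) (y ∷ Y)) ⟩
        ∑[ t ∈ Fs ] ∑[ T ∈ Vs m ] (indicator (y +ᵛ t · b) * weight T B Y)     ≡⟨ ∑-product Fs (Vs m) _ _ ⟩
        line y b * ∑[ T ∈ Vs m ] weight T B Y                                 ≡⟨ cong (line y b *_) (total-weight B Y) ⟩
        line y b * lines B Y                                                  ∎
        where open ≡-Reasoning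

      weight≤ : ∀ {m} (T : Vec Carrier m) (B Y : Vec (Vec Carrier d) m) {k : ℕ} → (lin T B ∈ sums B Y → 1 ≤ k) → weight T B Y ≤ k
      weight≤ []      []      []      h = h (here refl)
      weight≤ (t ∷ T) (b ∷ B) (y ∷ Y) {k} h with y +ᵛ t · b ∈? E
      ... | no ∉E = ≤-trans (≤-reflexive (cong (_* weight T B Y) (n≤0⇒n≡0 (≮⇒≥ (∉E ∘ ∑-member⁻ _≟ᵛ_ E))))) z≤n
      ... | yes ∈E = begin
        indicator (y +ᵛ t · b) * weight T B Y  ≤⟨ *-mono-≤ (∑-Unique _≟ᵛ_ uE (y +ᵛ t · b)) (weight≤ T B Y rest) ⟩
        1 * k                                  ≡⟨ *-identityˡ k ⟩
        k                                      ∎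
        where
        open ≤-Reasoning
        rest : lin T B ∈ sums B Y → 1 ≤ k
        rest T∈ = h (∈-cartesianProductWith⁺ _+ᵛ_ (∈-map⁺ (_· b) (∈-filter⁺ (λ t → y +ᵛ t · b ∈? E) (Enumeration.complete scalars t) ∈E)) T∈)

      rich-lines : ∀ {m} {B Y : Vec (Vec Carrier d) m} → Pointwise RichAt B Y → (N * N) ^ m ≤ (2 * q ^ d) ^ m * lines B Y
      rich-lines [] = ≤-refl
      rich-lines {suc m} {b ∷ B} {y ∷ Y} (rich-at ∷ rich) = ≤-trans (*-mono-≤ (<⇒≤ rich-at) (rich-lines rich))
        (≤-reflexive (interchange (2 * q ^ d) (line y b) ((2 * q ^ d) ^ m) (lines B Y)))
        where
        interchange : ∀ a b c e → a * b * (c * e) ≡ a * c * (b * e)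
        interchange = solve-∀

      -- One point x of X suffices: by independence T ↦ x + `lin T B` is injective, so the points of
      -- the lines combine to distinct elements of X + `sums B Y`.
      sums-large : ∀ {m} (X : Subset d) → 0 < card X → (B Y : Vec (Vec Carrier d) m) → Independent B →
        lines B Y ≤ card (X ⊞ sums B Y)
      sums-large {m} X 0<X B Y indep with Any.any? (λ v → X v Data.Bool.≟ true) (Vs d)
      ... | no empty = contradiction 0<X (≤⇒≯ (≤-trans (∑-mono-∈ (Vs d) (λ v v∈ → outside v (empty ∘ lose v∈))) (≤-reflexive (∑-zero (Vs d)))))
        where
        outside : ∀ v → X v ≢ true → 𝟙 (X v) ≤ 0
        outside v ¬Xv with X v
        ... | true  = contradiction refl ¬Xv
        ... | false = z≤n
      ... | yes nonempty with find nonempty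
      ...   | x , _ , Xx = begin
        lines B Y                                             ≡⟨ total-weight B Y ⟨
        ∑[ T ∈ Vs m ] weight T B Y                            ≤⟨ ∑-mono (Vs m) (λ T → weight≤ T B Y (λ T∈ → ≤-reflexive (cong 𝟙 (sym
                                                                   (⊞⁺ X T∈ (trans (cong X (+-sub-cancelʳ x (lin T B))) Xx)))))) ⟩
        ∑[ T ∈ Vs m ] 𝟙 ((X ⊞ sums B Y) (x +ᵛ lin T B))       ≤⟨ Enumeration.∑-image (vectors scalars d) (Vs m) (λ T → x +ᵛ lin T B) distinct (𝟙 ∘ (X ⊞ sums B Y)) ⟩
        card (X ⊞ sums B Y)                                   ∎
        where
        open ≤-Reasoning
        distinct : ∀ a → ∑[ T ∈ Vs m ] ⟦ x +ᵛ lin T B ≟ᵛ a ⟧ ≤ 1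
        distinct a with Any.any? (λ T → x +ᵛ lin T B ≟ᵛ a) (Vs m)
        ... | no missed = ≤-trans (∑-mono-∈ (Vs m) (λ T T∈ → ≤-reflexive (⟦⟧-no (x +ᵛ lin T B ≟ᵛ a) (missed ∘ lose T∈)))) (≤-trans (≤-reflexive (∑-zero (Vs m))) z≤n)
        ... | yes hit with find hit
        ...   | T₀ , _ , refl = ≤-trans
          (∑-mono (Vs m) (λ T → ⟦⟧-mono (x +ᵛ lin T B ≟ᵛ x +ᵛ lin T₀ B) (T ≟ᵛ T₀) (λ p → lin-injective indep
            (trans (sym (sub-cancelˡ x (lin T B))) (trans (cong (_-ᵛ x) p) (sub-cancelˡ x (lin T₀ B)))))))
          (≤-reflexive (Enumeration.once (vectors scalars m) T₀))

      -- Each piece lies in a translate of E. Replacing the first piece by E can only enlarge the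
      -- set, and `growth`, with the remaining sums as C, removes this E again at the cost of a
      -- factor β/α.
      sums-small : ∀ {α β} {X : Subset d} → (∀ C → card (X ⊞ E ⊞ C) * α ≤ β * card (X ⊞ C)) →
        ∀ {m} (B Y : Vec (Vec Carrier d) m) → card (X ⊞ sums B Y) * α ^ m ≤ β ^ m * card X
      sums-small {X = X} growth [] [] = ≤-reflexive (begin
        card (X ⊞ sums [] []) * 1          ≡⟨ *-identityʳ _ ⟩
        card (X ⊞ (0ᵛ ∷ []))               ≡⟨ ∑-cong (Vs d) (λ v → cong 𝟙 (∨-identityʳ (X (v -ᵛ 0ᵛ)))) ⟩
        ∑[ v ∈ Vs d ] 𝟙 (X (v -ᵛ 0ᵛ))      ≡⟨ card-shift X 0ᵛ ⟩
        card X                             ≡⟨ +-identityʳ _ ⟨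
        1 * card X                         ∎)
        where
        open ≡-Reasoning
        open import Data.Bool.Properties using (∨-identityʳ)
      sums-small {α} {β} {X} growth {suc m} (b ∷ B) (y ∷ Y) = begin
        card (X ⊞ sums (b ∷ B) (y ∷ Y)) * (α * α ^ m)
          ≤⟨ *-monoˡ-≤ (α * α ^ m) shifted ⟩
        card (X ⊞ E ⊞ sums B Y) * (α * α ^ m)
          ≡⟨ *-assoc (card (X ⊞ E ⊞ sums B Y)) α (α ^ m) ⟨
        card (X ⊞ E ⊞ sums B Y) * α * α ^ m
          ≤⟨ *-monoˡ-≤ (α ^ m) (growth (sums B Y)) ⟩
        β * card (X ⊞ sums B Y) * α ^ m
          ≡⟨ *-assoc β _ (α ^ m) ⟩
        β * (card (X ⊞ sums B Y) * α ^ m)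
          ≤⟨ *-monoʳ-≤ β (sums-small growth B Y) ⟩
        β * (β ^ m * card X)
          ≡⟨ *-assoc β (β ^ m) (card X) ⟨
        β * β ^ m * card X ∎
        where
        open ≤-Reasoning
        rotate : ∀ {n} (v y p w : Vec Carrier n) → v -ᵛ w -ᵛ (y +ᵛ p) ≡ v -ᵛ y -ᵛ (p +ᵛ w)
        rotate []      []      []      []      = refl
        rotate (a ∷ v) (c ∷ y) (e ∷ p) (f ∷ w) =
          cong₂ _∷_ (≈⇒≡ (solve 4 (λ a c e f → a :- f :- (c :+ e) := a :- c :- (e :+ f)) ≈-refl a c e f)) (rotate v y p w)
        -- Translation by y carries the point t · b of the piece to the point y + t · b of E.
        translate : ∀ v → (X ⊞ sums (b ∷ B) (y ∷ Y)) (v -ᵛ y) ≡ true → (X ⊞ E ⊞ sums B Y) v ≡ true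
        translate v h with ⊞⁻ X (sums (b ∷ B) (y ∷ Y)) h
        ... | c , c∈ , Xc with ∈-cartesianProductWith⁻ _+ᵛ_ (piece b y) (sums B Y) c∈
        ...   | p , w , p∈ , w∈ , refl with ∈-map⁻ (_· b) p∈
        ...     | t , t∈ , refl with ∈-filter⁻ (λ t → y +ᵛ t · b ∈? E) {xs = Fs} t∈
        ...       | _ , e∈E = ⊞⁺ (X ⊞ E) w∈ (⊞⁺ X e∈E (trans (cong X (rotate v y (t · b) w)) Xc))
        shifted : card (X ⊞ sums (b ∷ B) (y ∷ Y)) ≤ card (X ⊞ E ⊞ sums B Y)
        shifted = ≤-trans (≤-reflexive (sym (card-shift (X ⊞ sums (b ∷ B) (y ∷ Y)) y))) (∑-mono (Vs d) (λ v → 𝟙-mono (translate v)))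

      -- `doubling` says that E itself grows by a factor of at most q^(d+1)/N². Passing to a subset
      -- X of minimal growth preserves this ratio and makes `petridis` available; then |X +
      -- `sums B Y`| is bounded from below by `sums-large` and from above by `sums-small`.
      family-bound : ∀ {m} → 0 < N → card (asSubset ⊞ E) * N ≤ q * q ^ d → RichFamily m →
        ¬ ¬ ((N * N) ^ m * (N * N) ^ m ≤ (2 * q ^ d) ^ m * (q * q ^ d) ^ m * N)
      family-bound {m} 0<N doubling (B , Y , indep , rich) fails =
        minimal-growth E (N * N) (q * q ^ d) asSubset (subst (0 <_) (sym card-asSubset) 0<N)
          (begin
            card (asSubset ⊞ E) * (N * N)   ≡⟨ *-assoc (card (asSubset ⊞ E)) N N ⟨
            card (asSubset ⊞ E) * N * N     ≤⟨ *-monoˡ-≤ N doubling ⟩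
            q * q ^ d * N                   ≡⟨ cong (q * q ^ d *_) card-asSubset ⟨
            q * q ^ d * card asSubset       ∎)
          (λ { (X , X⊆E , 0<X , ratio , minimal) → fails (bound X X⊆E 0<X ratio minimal) })
        where
        open ≤-Reasoning
        swapʳ : ∀ a b c → a * b * c ≡ a * c * b
        swapʳ = solve-∀
        bound : ∀ X → X ⊆ asSubset → 0 < card X → card (X ⊞ E) * (N * N) ≤ q * q ^ d * card X → MinimalGrowth E X →
          (N * N) ^ m * (N * N) ^ m ≤ (2 * q ^ d) ^ m * (q * q ^ d) ^ m * N
        bound X X⊆E 0<X ratio minimal = begin
          (N * N) ^ m * (N * N) ^ m
            ≤⟨ *-monoˡ-≤ ((N * N) ^ m) (rich-lines rich) ⟩
          (2 * q ^ d) ^ m * lines B Y * (N * N) ^ m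
            ≤⟨ *-monoˡ-≤ ((N * N) ^ m) (*-monoʳ-≤ ((2 * q ^ d) ^ m) (sums-large X 0<X B Y indep)) ⟩
          (2 * q ^ d) ^ m * card (X ⊞ sums B Y) * (N * N) ^ m
            ≡⟨ *-assoc ((2 * q ^ d) ^ m) _ _ ⟩
          (2 * q ^ d) ^ m * (card (X ⊞ sums B Y) * (N * N) ^ m)
            ≤⟨ *-monoʳ-≤ ((2 * q ^ d) ^ m) (sums-small growth B Y) ⟩
          (2 * q ^ d) ^ m * ((q * q ^ d) ^ m * card X)
            ≤⟨ *-monoʳ-≤ ((2 * q ^ d) ^ m) (*-monoʳ-≤ ((q * q ^ d) ^ m) (≤-trans (card-mono X⊆E) (≤-reflexive card-asSubset))) ⟩
          (2 * q ^ d) ^ m * ((q * q ^ d) ^ m * N)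
            ≡⟨ *-assoc ((2 * q ^ d) ^ m) _ N ⟨
          (2 * q ^ d) ^ m * (q * q ^ d) ^ m * N ∎
          where
          instance
            X≢0 : NonZero (card X)
            X≢0 = >-nonZero 0<X
          growth : ∀ C → card (X ⊞ E ⊞ C) * (N * N) ≤ q * q ^ d * card (X ⊞ C)
          growth C = *-cancelʳ-≤ _ _ (card X) (begin
            card (X ⊞ E ⊞ C) * (N * N) * card X          ≡⟨ swapʳ (card (X ⊞ E ⊞ C)) (N * N) (card X) ⟩
            card (X ⊞ E ⊞ C) * card X * (N * N)          ≤⟨ *-monoˡ-≤ (N * N) (petridis {E = E} {X} minimal C) ⟩
            card (X ⊞ E) * card (X ⊞ C) * (N * N)        ≡⟨ swapʳ (card (X ⊞ E)) (card (X ⊞ C)) (N * N) ⟩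
            card (X ⊞ E) * (N * N) * card (X ⊞ C)        ≤⟨ *-monoˡ-≤ (card (X ⊞ C)) ratio ⟩
            q * q ^ d * card X * card (X ⊞ C)            ≡⟨ swapʳ (q * q ^ d) (card X) (card (X ⊞ C)) ⟩
            q * q ^ d * card (X ⊞ C) * card X            ∎)

      values-bound : ∀ {n} → d ≡ n + n → (s : Vec Carrier d) {D : List Carrier} → Unique D →
        (∀ {x₁ x₂ y} → x₁ ∈ E → x₂ ∈ E → y ∈ E → Q (s +ᵛ (x₁ +ᵛ x₂) +ᵛ y) ∈ D) →
        4 * q ^ n ≤ N →
        ¬ ((N * N) ^ suc n * (N * N) ^ suc n ≤ (2 * q ^ d) ^ suc n * (q * q ^ d) ^ suc n * N) →
        q ≤ 12 * length D
      -- The conclusion is tested first. Its failure supplies 2 |D| ≤ q for `sumset-bound`, and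
      -- deciding it leaves only a contradiction to prove, which the double negation of
      -- `family-bound` permits.
      values-bound {n} d≡n+n s {D} uD values large dense with q ≤? 12 * length D
      ... | yes q≤12D = q≤12D
      ... | no q≰12D with cover-or-family n
      ...   | inj₁ (m , m≤n , B , indep , cover) = Covered.many-values d≡n+n E uE B indep m≤n cover s large uD values
      ...   | inj₂ family = ⊥-elim (family-bound 0<N (sumset-bound s uD 2D≤q 0<N values) family dense)
        where
        0<N : 0 < N
        0<N = ≤-trans (*-mono-≤ {1} {4} (s≤s z≤n) (1≤q^ n)) large
        2D≤q : 2 * length D ≤ q
        2D≤q = ≤-trans (*-monoˡ-≤ (length D) {2} {12} (s≤s (s≤s z≤n))) (<⇒≤ (≰⇒> q≰12D))

    -- Sums of three and four points

    kSums-step : ∀ {d k} {E : List (Vec Carrier d)} {x v} → x ∈ E → v ∈ kSums F k E → x +ᵛ v ∈ kSums F (suc k) E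
    kSums-step {x = x} x∈E v∈ = ∈-concatMap⁺ _ (lose x∈E (∈-map⁺ (x +ᵛ_) v∈))

    values : ∀ {d} → ℕ → List (Vec Carrier d) → List Carrier
    values k E = deduplicate _≟ᶠ_ (map Q (kSums F k E))

    values-Unique : ∀ {d} k (E : List (Vec Carrier d)) → Unique (values k E)
    values-Unique k E = UniqueDec.deduplicate-! _≟ᶠ_ (map Q (kSums F k E))

    kSums⇒value : ∀ {d k} {E : List (Vec Carrier d)} {v} → v ∈ kSums F k E → Q v ∈ values k E
    kSums⇒value v∈ = ∈-deduplicate⁺ _≟ᶠ_ (∈-map⁺ Q v∈)

    three-sums : ∀ {d} {E : List (Vec Carrier d)} {x₁ x₂ y} → x₁ ∈ E → x₂ ∈ E → y ∈ E →
      x₁ +ᵛ (x₂ +ᵛ (y +ᵛ 0ᵛ)) ∈ kSums F 3 E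
    three-sums {E = E} x₁∈E x₂∈E y∈E =
      kSums-step {k = 2} {E} x₁∈E (kSums-step {k = 1} {E} x₂∈E (kSums-step {k = 0} {E} y∈E (here refl)))

    regroup : ∀ {d} (s x₁ x₂ y : Vec Carrier d) → s +ᵛ (x₁ +ᵛ (x₂ +ᵛ (y +ᵛ 0ᵛ))) ≡ s +ᵛ (x₁ +ᵛ x₂) +ᵛ y
    regroup s x₁ x₂ y = trans (cong (s +ᵛ_) (trans (cong (λ w → x₁ +ᵛ (x₂ +ᵛ w)) (+-identityʳᵛ y)) (sym (+-assocᵛ x₁ x₂ y))))
      (sym (+-assocᵛ s (x₁ +ᵛ x₂) y))

    module _ {d n : ℕ} (d≡n+n : d ≡ n + n) (1≤n : 1 ≤ n) (E : List (Vec Carrier d)) (uE : Unique E) (dense : Dense d q (length E)) where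
      private
        large : 4 * q ^ n ≤ length E
        large = dense⇒large {n = n} d≡n+n (≤-trans (n≤1+n 1) 2≤q) dense
        1≤N : 1 ≤ length E
        1≤N = ≤-trans (*-mono-≤ {1} {4} (s≤s z≤n) (1≤q^ n)) large
        growing = dense⇒growing {n = n} d≡n+n 1≤n (≤-trans (n≤1+n 1) 2≤q) 1≤N dense

      three-summands : 1 * q ≤ 12 * ∣Δ∣ F 3 E
      three-summands = ≤-trans (≤-reflexive (*-identityˡ q))
        -- The shift s = 0 leaves exactly the sums of three points.
        (Directions.values-bound E uE {n} d≡n+n 0ᵛ (values-Unique 3 E)
          (λ {x₁} {x₂} {y} x₁∈E x₂∈E y∈E → subst (_∈ values 3 E)
            (cong Q (trans (sym (+-identityˡᵛ _)) (regroup 0ᵛ x₁ x₂ y))) (kSums⇒value {k = 3} {E} (three-sums x₁∈E x₂∈E y∈E)))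
          large growing)

      four-summands : 1 * q ≤ 12 * ∣Δ∣ F 4 E
      four-summands = ≤-trans (≤-reflexive (*-identityˡ q))
        -- The fourth summand is one fixed point s of E, so all values are norms of sums of four
        -- points.
        (Directions.values-bound E uE {n} d≡n+n s (values-Unique 4 E)
          (λ {x₁} {x₂} {y} x₁∈E x₂∈E y∈E → subst (_∈ values 4 E)
            (cong Q (regroup s x₁ x₂ y)) (kSums⇒value {k = 4} {E} (kSums-step {k = 3} {E} s∈E (three-sums x₁∈E x₂∈E y∈E))))
          large growing)
        where
        element : ∀ {L : List (Vec Carrier d)} → 1 ≤ length L → ∃ (_∈ L)
        element {x ∷ L} _ = x , here refl
        s = proj₁ (element {E} 1≤N)
        s∈E = proj₂ (element {E} 1≤N)

theorem1p3 :
    ((d : ℕ) → (d ≡ 4 ⊎ d ≡ 6) →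
      Σ ℕ λ a → Σ ℕ λ b → Σ ℕ λ m → Σ ℕ λ n →
        (0 < b) × (b < a) × (0 < m) × (m ≤ n) ×
        ((q : ℕ) (F : FiniteField q) → CharNot2 F →
          (E : List (Vec (FiniteField.Carrier F) d)) → Unique E →
          a ^ (2 * (3 * d + 1)) * q ^ (d * (3 * d + 4)) ≤ b ^ (2 * (3 * d + 1)) * length E ^ (2 * (3 * d + 1)) →
          m * q ≤ n * ∣Δ∣ F 3 E))
    ×
    ((d : ℕ) → 8 ≤ d → (∃ λ t → d ≡ 2 * t) →
      Σ ℕ λ a → Σ ℕ λ b → Σ ℕ λ m → Σ ℕ λ n →
        (0 < b) × (b < a) × (0 < m) × (m ≤ n) ×
        ((q : ℕ) (F : FiniteField q) → CharNot2 F →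
          (E : List (Vec (FiniteField.Carrier F) d)) → Unique E →
          a ^ (2 * (3 * d + 1)) * q ^ (d * (3 * d + 4)) ≤ b ^ (2 * (3 * d + 1)) * length E ^ (2 * (3 * d + 1)) →
          m * q ≤ n * ∣Δ∣ F 4 E))
theorem1p3 =
  -- C = 4/1 is what `dense⇒large` requires, and c = 1/12 comes from `many-values`.
  (λ d d∈ → 4 , 1 , 1 , 12 , s≤s z≤n , s≤s (s≤s z≤n) , s≤s z≤n , s≤s z≤n ,
    λ q F char≢2 E uE → let (n , d≡n+n , 1≤n) = halves d∈ in OverField.OddCharacteristic.three-summands F char≢2 d≡n+n 1≤n E uE) ,
  (λ d 8≤d even → 4 , 1 , 1 , 12 , s≤s z≤n , s≤s (s≤s z≤n) , s≤s z≤n , s≤s z≤n ,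
    λ q F char≢2 E uE → let (n , d≡n+n , 1≤n) = halves′ 8≤d even in OverField.OddCharacteristic.four-summands F char≢2 d≡n+n 1≤n E uE)
  where
  halves : ∀ {d} → d ≡ 4 ⊎ d ≡ 6 → ∃ λ n → d ≡ n + n × 1 ≤ n
  halves (inj₁ d≡4) = 2 , d≡4 , s≤s z≤n
  halves (inj₂ d≡6) = 3 , d≡6 , s≤s z≤n
  halves′ : ∀ {d} → 8 ≤ d → (∃ λ t → d ≡ 2 * t) → ∃ λ n → d ≡ n + n × 1 ≤ n
  halves′ 8≤d (suc t , d≡2t) = suc t , trans d≡2t (cong (suc t +_) (+-identityʳ (suc t))) , s≤s z≤n
  halves′ 8≤d (zero , d≡0)   = contradiction (subst (8 ≤_) d≡0 8≤d) (λ ())
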